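{- On finite structures, $\mathrm{LFP} = \mathrm{FO}(\mathrm{Horn\text{ - }Res})$. That is, a class of finite relational structures (over a fixed finite vocabulary) is definable by a sentence of least fixed-point logic $\mathrm{LFP}$ if and only if it is definable by a sentence of $\mathrm{FO}(\mathrm{Horn\text{ - }Res})$, the Lindström extension of first-order logic by the generalised quantifier for Horn resolution.
   Context: All structures are finite and relational. A propositional CNF-formula $\psi$ is encoded as a structure over the vocabulary $\{C,V,P,N\}$ whose universe consists of the clauses and variables of $\psi$, where the unary predicates $C,V$ identify clauses and variables, and $Pvc$ (respectively $Nvc$) holds iff variable $v$ occurs positively (respectively negatively) in clause $c$. $\mathrm{Horn\text{ - }Res}$ denotes the class of structures encoding propositional Horn formulas (each clause has at most one positive literal) from which the empty clause can be derived by resolution restricted to Horn clauses. Interpretations: for vocabularies $\sigma$ and $\tau=\{S_1,\dots,S_\ell\}$ and a logic $L$, a $d$-dimensional $L[\sigma,\tau]$-interpretation with parameters $\vec z$ is a tuple $I(\vec z)=(\varphi_\delta,\varphi_\approx,\varphi_{S_1},\dots,\varphi_{S_\ell})$ of $L[\sigma]$-formulas with free variables $\vec z$ plus one $d$-tuple of variables for $\varphi_\delta$, two for $\varphi_\approx$, and $\mathrm{arity}(S_i)$ many for $\varphi_{S_i}$. Given a $\sigma$-structure $\mathfrak A$ and values $\vec a$ for $\vec z$, let $\mathfrak B$ be the structure with universe $\{\vec b\in A^d : \mathfrak A\models\varphi_\delta(\vec b,\vec a)\}$ and relations $S_i$ defined by $\varphi_{S_i}$; if $\varphi_\approx$ defines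 a congruence $\mathcal E$ on $\mathfrak B$, then $I(\mathfrak A,\vec a):=\mathfrak B/\mathcal E$, otherwise $I(\mathfrak A,\vec a)$ is undefined. Lindström extension: for a class $\mathcal K$ of $\tau$-structures, $L(\mathcal Q_{\mathcal K})$ is obtained by closing $L$ under the additional rule that for every $L(\mathcal Q_{\mathcal K})[\sigma,\tau]$-interpretation $I(\vec z)$, $\mathcal Q_{\mathcal K}I(\vec z)$ is a formula, with $(\mathfrak A,\vec a)\models \mathcal Q_{\mathcal K}I(\vec z)$ iff $I(\mathfrak A,\vec a)$ is defined and belongs to $\mathcal K$. $\mathrm{FO}(\mathrm{Horn\text{ - }Res})$ is $\mathrm{FO}(\mathcal Q_{\mathcal K})$ for $\mathcal K=\mathrm{Horn\text{ - }Res}$. -}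

module Defs where

open import Level using (Level; 0ℓ; _⊔_) renaming (suc to lsuc)
open import Data.Bool using (Bool; T)
open import Data.Fin using (Fin)
open import Data.List using (List; []; _∷_)
open import Data.List.Membership.Propositional using (_∈_)
open import Data.List.Relation.Unary.All using (All; []; _∷_) renaming (lookup to lookupAll)
open import Data.List.Relation.Unary.Any using (Any; here; there)
open import Data.Nat using (ℕ; suc; _+_; _*_)
open import Data.Product using (Σ; Σ-syntax; ∃-syntax; _×_; _,_; proj₁)
open import Data.Sum using (_⊎_)
open import Data.Vec using (Vec; []; _∷_; _++_; concat; lookup; map)
open import Data.Vec.Relation.Binary.Pointwise.Inductive using (Pointwise)
open import Function.Bundles using (Inverse; _⇔_)
open import Relation.Binary using (Rel; Setoid; IsEquivalence; _Respects_)
open import Relation.Binary.PropositionalEquality using (refl; setoid)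
open import Relation.Nullary using (¬_)
open import Relation.Unary using (Pred; Decidable; _⊆_; _≐_; _∪_; _∖_)

-- A finite relational vocabulary is the list of the arities of its symbols;
-- the symbols of arity k are the positions  s : k ∈ σ.
Vocabulary : Set
Vocabulary = List ℕ

-- Quotients are represented by setoids: a structure is a raw structure whose
-- relation _≈_ is a congruence, and it stands for  Universe / _≈_.
record RawStructure (σ : Vocabulary) : Set₁ where
  field
    Universe : Set
    _≈_      : Rel Universe 0ℓ
    rel      : ∀ {k} → k ∈ σ → Pred (Vec Universe k) 0ℓ

record IsCongruent {σ : Vocabulary} (𝔅 : RawStructure σ) : Set where
  open RawStructure 𝔅
  field
    isEquivalence : IsEquivalence _≈_
    rel-resp      : ∀ {k} (s : k ∈ σ) → rel s Respects (Pointwise _≈_)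

record Structure (σ : Vocabulary) : Set₁ where
  field
    raw         : RawStructure σ
    isCongruent : IsCongruent raw

  open RawStructure raw public
  open IsCongruent isCongruent public

  universe : Setoid 0ℓ 0ℓ
  universe = record { isEquivalence = isEquivalence }

-- Decidability of the relations is part of what it means, constructively, to
-- be a finite structure; decidability of _≈_ follows from the enumeration.
-- The empty universe is allowed, since interpretations can produce it.
record FiniteStructure (σ : Vocabulary) : Set₁ where
  field
    structure   : Structure σ
  open Structure structure public
  field
    size        : ℕ
    enumeration : Inverse universe (setoid (Fin size))
    rel?        : ∀ {k} (s : k ∈ σ) → Decidable (rel s)

open FiniteStructure using (structure)

------------------------------------------------------------------------
-- Least fixed-point logic

-- Subsets of a finite set are exactly its decidable subsets, so the relations
-- over which fixed points are taken are Bool-valued.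
record Relation {σ : Vocabulary} (𝔄 : Structure σ) (k : ℕ) : Set where
  open Structure 𝔄
  field
    holds : Vec Universe k → Bool

  ⟦_⟧ : Pred (Vec Universe k) 0ℓ
  ⟦ xs ⟧ = T (holds xs)

  field
    resp : ⟦_⟧ Respects (Pointwise _≈_)

open Relation using (⟦_⟧)

module _ {σ : Vocabulary} {𝔄 : Structure σ} {k : ℕ} where
  open Structure 𝔄

  IsFixedPoint : (Relation 𝔄 k → Pred (Vec Universe k) 0ℓ) → Pred (Relation 𝔄 k) 0ℓ
  IsFixedPoint F R = ⟦ R ⟧ ≐ F R

  IsLeastFixedPoint : (Relation 𝔄 k → Pred (Vec Universe k) 0ℓ) → Pred (Relation 𝔄 k) 0ℓ
  IsLeastFixedPoint F R =
    IsFixedPoint F R × (∀ S → IsFixedPoint F S → ⟦ R ⟧ ⊆ ⟦ S ⟧)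

-- LFP σ Δ Θ n: formulas with free element variables in Fin n (de Bruijn), and
-- free relation variables Δ ∪ Θ (lists of arities), those in Δ occurring only
-- positively (under an even number of negations) and those in Θ only
-- negatively.  Negation exchanges the two, and lfp binds a positive variable.
-- Nothing is lost for sentences, where each relation variable is bound by lfp.
-- In  lfp φ xs  the first k element variables of φ are bound, and the fixed
-- point is applied to the variables xs.
data LFP (σ : Vocabulary) : (Δ Θ : List ℕ) (n : ℕ) → Set where
  eq   : ∀ {Δ Θ n} → Fin n → Fin n → LFP σ Δ Θ n
  atom : ∀ {Δ Θ n k} → k ∈ σ → Vec (Fin n) k → LFP σ Δ Θ n
  var  : ∀ {Δ Θ n k} → k ∈ Δ → Vec (Fin n) k → LFP σ Δ Θ n
  not  : ∀ {Δ Θ n} → LFP σ Θ Δ n → LFP σ Δ Θ n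
  _and_ : ∀ {Δ Θ n} → LFP σ Δ Θ n → LFP σ Δ Θ n → LFP σ Δ Θ n
  ex   : ∀ {Δ Θ n} → LFP σ Δ Θ (suc n) → LFP σ Δ Θ n
  lfp  : ∀ {Δ Θ n k} → LFP σ (k ∷ Δ) Θ (k + n) → Vec (Fin n) k → LFP σ Δ Θ n

module _ {σ : Vocabulary} (𝔄 : Structure σ) where
  open Structure 𝔄

  SatLFP : ∀ {Δ Θ n} → LFP σ Δ Θ n →
           All (Relation 𝔄) Δ → All (Relation 𝔄) Θ → Vec Universe n → Set
  SatLFP (eq x y)    δ θ ρ = lookup ρ x ≈ lookup ρ y
  SatLFP (atom s xs) δ θ ρ = rel s (map (lookup ρ) xs)
  SatLFP (var X xs)  δ θ ρ = ⟦ lookupAll δ X ⟧ (map (lookup ρ) xs)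
  SatLFP (not φ)     δ θ ρ = ¬ SatLFP φ θ δ ρ
  SatLFP (φ and ψ)   δ θ ρ = SatLFP φ δ θ ρ × SatLFP ψ δ θ ρ
  SatLFP (ex φ)      δ θ ρ = Σ[ a ∈ Universe ] SatLFP φ δ θ (a ∷ ρ)
  SatLFP (lfp {k = k} φ xs) δ θ ρ =
    Σ[ R ∈ Relation 𝔄 k ]
      IsLeastFixedPoint (λ S bs → SatLFP φ (S ∷ δ) θ (bs ++ ρ)) R
      × ⟦ R ⟧ (map (lookup ρ) xs)

LFPSentence : Vocabulary → Set
LFPSentence σ = LFP σ [] [] 0

_⊨LFP_ : ∀ {σ} → Structure σ → LFPSentence σ → Set
𝔄 ⊨LFP φ = SatLFP 𝔄 φ [] [] []

------------------------------------------------------------------------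
-- Lindström extensions of first-order logic

-- L n is the set of formulas with free variables in Fin n.  All n variables
-- of the context serve as parameters; in each component they come after the
-- tuple(s) of variables ranging over the interpreted universe.
record Interpretation (L : ℕ → Set) (τ : Vocabulary) (n : ℕ) : Set where
  inductive
  constructor interpretation
  field
    dim : ℕ
    φδ  : L (dim + n)
    φ≈  : L ((dim + dim) + n)
    φS  : ∀ {k} → k ∈ τ → L (k * dim + n)

data FO+Q (τ σ : Vocabulary) : ℕ → Set where
  eq   : ∀ {n} → Fin n → Fin n → FO+Q τ σ n
  atom : ∀ {n k} → k ∈ σ → Vec (Fin n) k → FO+Q τ σ n
  not  : ∀ {n} → FO+Q τ σ n → FO+Q τ σ n
  _and_ : ∀ {n} → FO+Q τ σ n → FO+Q τ σ n → FO+Q τ σ n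
  ex   : ∀ {n} → FO+Q τ σ (suc n) → FO+Q τ σ n
  Q    : ∀ {n} → Interpretation (FO+Q τ σ) τ n → FO+Q τ σ n

module _ {τ σ : Vocabulary} (𝒦 : Pred (Structure τ) 0ℓ) (𝔄 : Structure σ) where
  open Structure 𝔄

  -- interpret I ρ is the structure 𝔅 together with the relation ℰ defined by
  -- φ≈; the interpretation is defined iff ℰ is a congruence on 𝔅, and its
  -- value is then 𝔅 / ℰ.
  mutual
    SatQ : ∀ {n} → FO+Q τ σ n → Vec Universe n → Set
    SatQ (eq x y)   ρ = lookup ρ x ≈ lookup ρ y
    SatQ (atom s xs) ρ = rel s (map (lookup ρ) xs)
    SatQ (not φ)    ρ = ¬ SatQ φ ρ
    SatQ (φ and ψ)  ρ = SatQ φ ρ × SatQ ψ ρ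
    SatQ (ex φ)     ρ = Σ[ a ∈ Universe ] SatQ φ (a ∷ ρ)
    SatQ (Q I)      ρ = Σ[ c ∈ IsCongruent (interpret I ρ) ]
                          𝒦 (record { raw = interpret I ρ ; isCongruent = c })

    interpret : ∀ {n} → Interpretation (FO+Q τ σ) τ n → Vec Universe n → RawStructure τ
    interpret (interpretation d φδ φ≈ φS) ρ = record
      { Universe = Σ[ b ∈ Vec Universe d ] SatQ φδ (b ++ ρ)
      ; _≈_      = λ b b′ → SatQ φ≈ ((proj₁ b ++ proj₁ b′) ++ ρ)
      ; rel      = λ s bs → SatQ (φS s) (concat (map proj₁ bs) ++ ρ)
      }

------------------------------------------------------------------------
-- Horn resolution

-- The vocabulary {C, V, P, N}.
cnfVoc : Vocabulary
cnfVoc = 1 ∷ 1 ∷ 2 ∷ 2 ∷ []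

data Literal (U : Set) : Set where
  pos neg : U → Literal U

module CNF (ψ : Structure cnfVoc) where
  open Structure ψ

  C V : Pred Universe 0ℓ
  C c = rel (here refl) (c ∷ [])
  V v = rel (there (here refl)) (v ∷ [])

  P N : Universe → Universe → Set
  P v c = rel (there (there (here refl))) (v ∷ c ∷ [])
  N v c = rel (there (there (there (here refl)))) (v ∷ c ∷ [])

  record EncodesCNF : Set where
    field
      clause-or-variable : ∀ x → C x ⊎ V x
      disjoint           : ∀ x → ¬ (C x × V x)
      P-typed            : ∀ {v c} → P v c → V v × C c
      N-typed            : ∀ {v c} → N v c → V v × C c

  data _≈ₗ_ : Rel (Literal Universe) 0ℓ where
    pos : ∀ {u v} → u ≈ v → pos u ≈ₗ pos v
    neg : ∀ {u v} → u ≈ v → neg u ≈ₗ neg v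

  literals : Universe → Pred (Literal Universe) 0ℓ
  literals c (pos v) = P v c
  literals c (neg v) = N v c

  IsHorn : Pred (Pred (Literal Universe) 0ℓ) 0ℓ
  IsHorn D = ∀ {u v} → D (pos u) → D (pos v) → u ≈ v

  -- Clauses in derivations are finite sets of literals, given by lists that
  -- matter only through their sets of members.
  Clause : Set
  Clause = List (Literal Universe)

  ⟪_⟫ : Clause → Pred (Literal Universe) 0ℓ
  ⟪ D ⟫ l = Any (l ≈ₗ_) D

  data Derivable : Clause → Set where
    axiom   : ∀ {c D} → C c → ⟪ D ⟫ ≐ literals c → IsHorn ⟪ D ⟫ → Derivable D
    resolve : ∀ {D E F} v → Derivable D → Derivable E →
              ⟪ D ⟫ (pos v) → ⟪ E ⟫ (neg v) →
              ⟪ F ⟫ ≐ ((⟪ D ⟫ ∖ (pos v ≈ₗ_)) ∪ (⟪ E ⟫ ∖ (neg v ≈ₗ_))) →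
              IsHorn ⟪ F ⟫ → Derivable F

-- Distinct elements of C may have the same literals, so a formula is a family
-- of clauses; variables occurring in no clause are allowed.
record HornRes (ψ : Structure cnfVoc) : Set where
  open CNF ψ
  field
    encodesCNF    : EncodesCNF
    horn          : ∀ c → C c → IsHorn (literals c)
    refutable     : Derivable []

FO+HornRes-Sentence : Vocabulary → Set
FO+HornRes-Sentence σ = FO+Q cnfVoc σ 0

_⊨FO+HornRes_ : ∀ {σ} → Structure σ → FO+HornRes-Sentence σ → Set
𝔄 ⊨FO+HornRes φ = SatQ HornRes 𝔄 φ []

------------------------------------------------------------------------
-- Definability of classes of finite structures

module _ {ℓ : Level} {σ : Vocabulary} (𝒞 : Pred (FiniteStructure σ) ℓ) where

  LFP-Definable : Set (lsuc 0ℓ ⊔ ℓ)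
  LFP-Definable = ∃[ φ ] (∀ 𝔄 → 𝒞 𝔄 ⇔ (structure 𝔄 ⊨LFP φ))

  FO+HornRes-Definable : Set (lsuc 0ℓ ⊔ ℓ)
  FO+HornRes-Definable = ∃[ φ ] (∀ 𝔄 → 𝒞 𝔄 ⇔ (structure 𝔄 ⊨FO+HornRes φ))

{-# OPTIONS --safe #-}

-- A Horn formula is refutable iff some clause without positive literals has all
-- its negated variables in the least set closed under unit propagation; this is
-- a least fixed point, and being a Horn formula is first-order.
--
-- Conversely, the truth of an LFP sentence is computed by a Horn program whose
-- facts say that a subformula is true, or false, under an assignment.  The
-- difficulty is negation of nested fixed points.  It is met by letting each bound
-- relation variable denote a stage of its induction, given by a pointer: a tuple
-- that entered at this stage.  Both membership and non-membership in a stage S are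
-- derivable: a tuple that F(S) adds to S points to the next stage, and S is known
-- to be the fixed point once each tuple is known to be in S or outside F(S).
-- Quantification over all tuples is harmless, since the length of clauses is not
-- bounded.  The names of facts and rules are coded by tuples over two distinct
-- elements; structures with at most one element are treated separately.
module Submission where

open import Defs
open import Data.Bool using (Bool; true; false; if_then_else_)
open import Data.Empty using (⊥; ⊥-elim)
open import Data.Fin as Fin using (Fin; zero; suc; _↑ˡ_; _↑ʳ_; splitAt; toℕ; fromℕ<)
open import Data.Fin.Properties using (toℕ-fromℕ<; fromℕ<-toℕ; toℕ<n; toℕ-injective; ↑ˡ-injective; ↑ʳ-injective; splitAt-↑ˡ; splitAt-↑ʳ; splitAt⁻¹-↑ˡ; splitAt⁻¹-↑ʳ)
open import Data.List using (List; []; _∷_; length; filter; concatMap; allFin; cartesianProduct) renaming (map to mapₗ; _++_ to _++ₗ_)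
open import Data.List.Membership.Propositional using (_∈_; find; lose)
open import Data.List.Membership.Propositional.Properties using (∈-allFin; ∈-lookup; ∈-cartesianProduct⁺)
import Data.List.Membership.Setoid.Properties as Membershipₛ
open import Data.List.Properties using (length-filter)
open import Data.List.Relation.Unary.All as All using ([]; _∷_) renaming (All to Allₗ; lookup to lookupAll)
open import Data.List.Relation.Unary.All.Properties using (all-filter)
open import Data.List.Relation.Unary.Any as Any using (Any; here; there; any?)
open import Data.List.Relation.Unary.Any.Properties using (concatMap⁺; concatMap⁻; map⁺; map⁻; ++⁺ˡ; ++⁺ʳ; ++⁻; lookup-index)
open import Data.Maybe as Maybe using (Maybe; just; nothing; maybe; Is-just)
import Data.Maybe.Relation.Unary.Any as MaybeAny
open import Data.Nat using (ℕ; zero; suc; _+_; _*_; _∸_; _≤_; _<_; _<?_; z≤n; s≤s; _≤′_; ≤′-reflexive; ≤′-refl; ≤′-step)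
open import Data.Nat.ListAction using (sum)
import Data.Nat.Properties as ℕₚ
open import Data.Product using (Σ; Σ-syntax; ∃-syntax; _×_; _,_; proj₁; proj₂)
open import Data.Product.Function.NonDependent.Propositional using (_×-⇔_)
open import Data.Sum as Sum using (_⊎_; inj₁; inj₂; [_,_]; [_,_]′)
open import Data.Unit using (⊤; tt)
open import Data.Vec as Vec using (Vec; []; _∷_; _++_; lookup; map; concat; tabulate)
open import Data.Vec.Properties using (map-∘; map-cong; map-++; map-concat; map-lookup-allFin; lookup-map; lookup-++ˡ; lookup-++ʳ; lookup-splitAt; tabulate∘lookup; lookup∘tabulate; tabulate-∘; tabulate-cong)
open import Data.Vec.Relation.Binary.Pointwise.Inductive as PW using (Pointwise; []; _∷_)
open import Function using (_∘_; id)
open import Function.Bundles using (_⇔_; mk⇔; Equivalence; Inverse)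
open import Function.Construct.Composition using (_⇔-∘_)
open import Level using (Level; 0ℓ)
open import Relation.Binary using (Rel; IsEquivalence; _Respects_) renaming (Decidable to Decidable₂)
open import Relation.Binary.PropositionalEquality using (_≡_; refl; sym; trans; cong; cong₂; subst; subst₂)
open import Relation.Nullary using (¬_; Dec; yes; no; does; contradiction)
open import Relation.Nullary.Decidable using (map′; ¬?; T?; toSum; _×-dec_; isYes; toWitness; fromWitness; decidable-stable; dec-true; dec-false)
open import Relation.Unary using (Pred; Decidable; _⊆_; _≐_)

-- Finite structures and fixed points

-- A Horn program derives only positive facts, so a subformula and its negation need separate facts,
-- and the falsity of an `lfp` needs a certificate: a closed stage that omits the tuple. The
-- structure has no order, so a stage cannot be named by a number; a tuple entering at it serves as
-- its name. No tuple enters at the empty stage, whence the additional flag of a pointer. An inner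
-- operator depends on the values of the outer relation variables, so an inner pointer has a meaning
-- only together with the outer ones, and all of them are kept in the environment. The meaning of
-- each fact is fixed semantically, independently of derivations. Soundness is then an induction on
-- derivations, and completeness is an induction on formulas with a walk up the stages at each
-- `lfp`. Classical steps rest on the decidability of satisfaction in finite structures; for
-- FO(Horn-Res) it is inherited from LFP through the translation.

record Listing {A : Set} (_≈_ : Rel A 0ℓ) : Set where
  field
    elements : List A
    complete : ∀ x → Any (x ≈_) elements

  search : ∀ {P : Pred A 0ℓ} → P Respects _≈_ → Decidable P → Dec (Σ A P)
  search resp P? = map′ Any.satisfied (λ (x , px) → Any.map (λ x≈y → resp x≈y px) (complete x))
                        (any? P? elements)

open Listing using (search)

Vec-listing : ∀ {A : Set} {_≈_ : Rel A 0ℓ} → Listing _≈_ → ∀ k → Listing (Pointwise _≈_ {k} {k})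
Vec-listing L zero = record { elements = [] ∷ [] ; complete = λ { [] → here [] } }
Vec-listing {_≈_ = _≈_} L (suc k) = record
  { elements = concatMap (λ x → mapₗ (x ∷_) (elements Lₖ)) (elements L)
  ; complete = λ { (x ∷ xs) → concatMap⁺ _ (Any.map (λ x≈y → map⁺ (Any.map (x≈y ∷_) (complete Lₖ xs)))
                                                      (complete L x)) }
  }
  where
  open Listing
  Lₖ = Vec-listing L k

lookupPW : ∀ {A : Set} {_≈_ : Rel A 0ℓ} {n} {ρ ρ′ : Vec A n} →
           Pointwise _≈_ ρ ρ′ → ∀ {k} (xs : Vec (Fin n) k) →
           Pointwise _≈_ (map (lookup ρ) xs) (map (lookup ρ′) xs)
lookupPW ρ≈ [] = []
lookupPW ρ≈ (x ∷ xs) = PW.lookup ρ≈ x ∷ lookupPW ρ≈ xs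

module _ {A : Set} {P Q : Pred A 0ℓ} (P? : Decidable P) (Q? : Decidable Q) (P⊆Q : P ⊆ Q) where

  filter-mono : ∀ xs → length (filter P? xs) ≤ length (filter Q? xs)
  filter-mono [] = z≤n
  filter-mono (x ∷ xs) with P? x | Q? x
  ... | yes p | yes q = s≤s (filter-mono xs)
  ... | yes p | no ¬q = contradiction (P⊆Q p) ¬q
  ... | no ¬p | yes q = ℕₚ.m≤n⇒m≤1+n (filter-mono xs)
  ... | no ¬p | no ¬q = filter-mono xs

  filter-mono-< : ∀ {xs} → Any (λ x → Q x × ¬ P x) xs → length (filter P? xs) < length (filter Q? xs)
  filter-mono-< {x ∷ xs} w with P? x | Q? x | w
  ... | yes p | _     | here (_ , ¬p) = contradiction p ¬p
  ... | no ¬p | yes q | here _ = s≤s (filter-mono xs)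
  ... | _     | no ¬q | here (q , _) = contradiction q ¬q
  ... | yes p | yes q | there w′ = s≤s (filter-mono-< w′)
  ... | yes p | no ¬q | there w′ = contradiction (P⊆Q p) ¬q
  ... | no ¬p | yes q | there w′ = ℕₚ.m≤n⇒m≤1+n (filter-mono-< w′)
  ... | no ¬p | no ¬q | there w′ = filter-mono-< w′

open Relation using (⟦_⟧; resp)

module Tuples {σ : Vocabulary} (𝔄 : Structure σ) where
  open Structure 𝔄

  ≋-refl : ∀ {k} {ρ : Vec Universe k} → Pointwise _≈_ ρ ρ
  ≋-refl = PW.refl (IsEquivalence.refl isEquivalence)

  ≋-sym : ∀ {k} {ρ ρ′ : Vec Universe k} → Pointwise _≈_ ρ ρ′ → Pointwise _≈_ ρ′ ρ
  ≋-sym = PW.sym (IsEquivalence.sym isEquivalence)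

module _ {σ : Vocabulary} {𝔄 : Structure σ} where
  open Structure 𝔄
  open Tuples 𝔄

  empty : ∀ {k} → Relation 𝔄 k
  empty = record { holds = λ _ → false ; resp = λ _ () }

  ⟦⟧? : ∀ {k} (R : Relation 𝔄 k) → Decidable ⟦ R ⟧
  ⟦⟧? R xs = T? (Relation.holds R xs)

  module _ {k} {P : Pred (Vec Universe k) 0ℓ} (P? : Decidable P) (P-resp : P Respects Pointwise _≈_) where

    fromDecidable : Relation 𝔄 k
    fromDecidable = record
      { holds = λ xs → isYes (P? xs)
      ; resp  = λ {xs} {ys} xs≈ys t → fromWitness {a? = P? ys} (P-resp xs≈ys (toWitness {a? = P? xs} t))
      }

    fromDecidable⁻ : ⟦ fromDecidable ⟧ ⊆ P
    fromDecidable⁻ {xs} = toWitness {a? = P? xs}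

    fromDecidable⁺ : P ⊆ ⟦ fromDecidable ⟧
    fromDecidable⁺ {xs} = fromWitness {a? = P? xs}

  infix 4 _⊑_
  _⊑_ : ∀ {Δ} → Allₗ (Relation 𝔄) Δ → Allₗ (Relation 𝔄) Δ → Set
  δ ⊑ δ′ = ∀ {k} (X : k ∈ _) → ⟦ lookupAll δ X ⟧ ⊆ ⟦ lookupAll δ′ {k} X ⟧

  ⊑-∷ : ∀ {k Δ} {R S : Relation 𝔄 k} {δ δ′ : Allₗ (Relation 𝔄) Δ} →
        ⟦ R ⟧ ⊆ ⟦ S ⟧ → δ ⊑ δ′ → (R ∷ δ) ⊑ (S ∷ δ′)
  ⊑-∷ R⊆S δ⊑ (here refl) = R⊆S
  ⊑-∷ R⊆S δ⊑ (there X)   = δ⊑ X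

  ⊑-refl : ∀ {Δ} {δ : Allₗ (Relation 𝔄) Δ} → δ ⊑ δ
  ⊑-refl X = id

  module Iteration (L : Listing _≈_) {k} (F : Relation 𝔄 k → Pred (Vec Universe k) 0ℓ)
                   (F? : ∀ R → Decidable (F R)) (F-resp : ∀ R → F R Respects Pointwise _≈_)
                   (F-mono : ∀ {R S} → ⟦ R ⟧ ⊆ ⟦ S ⟧ → F R ⊆ F S) where

    stage : ℕ → Relation 𝔄 k
    stage zero    = empty
    stage (suc i) = fromDecidable (F? (stage i)) (F-resp (stage i))

    stage-suc⁻ : ∀ i → ⟦ stage (suc i) ⟧ ⊆ F (stage i)
    stage-suc⁻ i = fromDecidable⁻ (F? (stage i)) (F-resp (stage i))

    stage-suc⁺ : ∀ i → F (stage i) ⊆ ⟦ stage (suc i) ⟧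
    stage-suc⁺ i = fromDecidable⁺ (F? (stage i)) (F-resp (stage i))

    stage-step : ∀ i → ⟦ stage i ⟧ ⊆ ⟦ stage (suc i) ⟧
    stage-step zero ()
    stage-step (suc i) = stage-suc⁺ (suc i) ∘ F-mono (stage-step i) ∘ stage-suc⁻ i

    new? : ∀ i → Dec (Σ[ xs ∈ Vec Universe k ] ⟦ stage (suc i) ⟧ xs × ¬ ⟦ stage i ⟧ xs)
    new? i = search (Vec-listing L k)
               (λ xs≈ys (p , ¬q) → resp (stage (suc i)) xs≈ys p , ¬q ∘ resp (stage i) (≋-sym xs≈ys))
               (λ xs → ⟦⟧? (stage (suc i)) xs ×-dec ¬? (⟦⟧? (stage i) xs))

    no-new : ∀ {i} → ¬ (Σ[ xs ∈ Vec Universe k ] ⟦ stage (suc i) ⟧ xs × ¬ ⟦ stage i ⟧ xs) →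
             F (stage i) ⊆ ⟦ stage i ⟧
    no-new {i} ¬new {xs} p with ⟦⟧? (stage i) xs
    ... | yes q = q
    ... | no ¬q = contradiction (xs , stage-suc⁺ i p , ¬q) ¬new

    private
      tuples : List (Vec Universe k)
      tuples = Listing.elements (Vec-listing L k)

      count : ℕ → ℕ
      count i = length (filter (⟦⟧? (stage i)) tuples)

      closed-suc : ∀ i → F (stage i) ⊆ ⟦ stage i ⟧ → F (stage (suc i)) ⊆ ⟦ stage (suc i) ⟧
      closed-suc i closed = stage-suc⁺ i ∘ F-mono (closed ∘ stage-suc⁻ i)

      -- Pigeonhole: while a stage is not closed, the next one contains a listed tuple that it
      -- omits, so the count rises at every step. It cannot exceed the length of the listing, which
      -- explains the value of `closure`. Repetitions in the listing do no harm.
      closed-or-grows : ∀ n → (F (stage n) ⊆ ⟦ stage n ⟧) ⊎ n ≤ count n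
      closed-or-grows zero = inj₂ z≤n
      closed-or-grows (suc n) with closed-or-grows n | new? n
      ... | inj₁ c | _ = inj₁ (closed-suc n c)
      ... | inj₂ _ | no ¬new = inj₁ (closed-suc n (no-new {n} ¬new))
      ... | inj₂ n≤c | yes (xs , p , ¬q) = inj₂ (ℕₚ.≤-<-trans n≤c
              (filter-mono-< (⟦⟧? (stage n)) (⟦⟧? (stage (suc n))) (stage-step n)
                (Any.map (λ {ys} xs≈ys → resp (stage (suc n)) xs≈ys p , ¬q ∘ resp (stage n) (≋-sym xs≈ys))
                         (Listing.complete (Vec-listing L k) xs))))

    closure : ℕ
    closure = suc (length tuples)

    fix : Relation 𝔄 k
    fix = stage closure

    fix-closed : F fix ⊆ ⟦ fix ⟧
    fix-closed with closed-or-grows closure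
    ... | inj₁ c = c
    ... | inj₂ c = contradiction (ℕₚ.≤-trans c (length-filter _ tuples)) (ℕₚ.<-irrefl refl)

    stage⊆ : ∀ (P : Pred (Vec Universe k) 0ℓ) →
             (∀ S → ⟦ S ⟧ ⊆ P → F S ⊆ P) → ∀ i → ⟦ stage i ⟧ ⊆ P
    stage⊆ P closed (suc i) = closed (stage i) (stage⊆ P closed i) ∘ stage-suc⁻ i

    stage⊆fix : ∀ i → ⟦ stage i ⟧ ⊆ ⟦ fix ⟧
    stage⊆fix = stage⊆ ⟦ fix ⟧ (λ S S⊆fix → fix-closed ∘ F-mono {S} {fix} S⊆fix)

    closed-fixed : ∀ i → F (stage i) ⊆ ⟦ stage i ⟧ → IsFixedPoint {𝔄 = 𝔄} F (stage i)
    closed-fixed i closed = (λ {xs} → stage-suc⁻ i ∘ stage-step i {xs}) , closed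

    fix-least : IsLeastFixedPoint {𝔄 = 𝔄} F fix
    fix-least = closed-fixed closure fix-closed
              , λ S (_ , FS⊆S) → stage⊆ ⟦ S ⟧ (λ R R⊆S → FS⊆S ∘ F-mono {R} {S} R⊆S) closure

    -- By definition a least fixed point is compared only with Bool-valued relations. Since it lies
    -- in `fix`, induction along the stages extends the comparison to arbitrary predicates, such as
    -- `ForcedTuple`.
    least⊆ : ∀ {R} → IsLeastFixedPoint {𝔄 = 𝔄} F R → ∀ (P : Pred (Vec Universe k) 0ℓ) →
             (∀ S → ⟦ S ⟧ ⊆ P → F S ⊆ P) → ⟦ R ⟧ ⊆ P
    least⊆ (_ , least) P closed = stage⊆ P closed closure ∘ least fix (proj₁ fix-least)

    least≐fix : ∀ {R} → IsLeastFixedPoint {𝔄 = 𝔄} F R → ⟦ R ⟧ ≐ ⟦ fix ⟧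
    least≐fix {R} (fp , least) = least fix (proj₁ fix-least) , proj₂ fix-least R fp

-- Decidability and monotonicity of LFP on a finite structure

module FiniteLFP {σ : Vocabulary} (𝔉 : FiniteStructure σ) where
  open FiniteStructure 𝔉 public
  open IsEquivalence isEquivalence public using () renaming (refl to ≈-refl; sym to ≈-sym; trans to ≈-trans)

  𝔄 : Structure σ
  𝔄 = structure

  open Tuples 𝔄 public

  listing : Listing _≈_
  listing = record
    { elements = mapₗ from (allFin size)
    ; complete = λ x → map⁺ (Any.map (λ { refl → ≈-sym (inverseʳ refl) }) (∈-allFin (to x)))
    }
    where open Inverse enumeration

  _≈?_ : Decidable₂ _≈_
  x ≈? y = map′ (λ e → ≈-trans (≈-sym (inverseʳ refl)) (inverseʳ e)) to-cong (to x Fin.≟ to y)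
    where open Inverse enumeration

  mutual
    -- Mutual with monotonicity because an `lfp` is decided by running its iteration, which asks for
    -- a body that is decidable, monotone and invariant under `_≈_`.
    satLFP? : ∀ {Δ Θ n} (φ : LFP σ Δ Θ n) δ θ ρ → Dec (SatLFP 𝔄 φ δ θ ρ)
    satLFP? (eq x y)    δ θ ρ = _ ≈? _
    satLFP? (atom s xs) δ θ ρ = rel? s _
    satLFP? (var X xs)  δ θ ρ = ⟦⟧? (lookupAll δ X) _
    satLFP? (not φ)     δ θ ρ = ¬? (satLFP? φ θ δ ρ)
    satLFP? (φ and ψ)   δ θ ρ = satLFP? φ δ θ ρ ×-dec satLFP? ψ δ θ ρ
    satLFP? (ex φ)      δ θ ρ =
      search listing (λ a≈b → satLFP-mono φ {δ} {δ} {θ} {θ} (⊑-refl {δ = δ}) (⊑-refl {δ = θ}) (a≈b ∷ ≋-refl)) (λ a → satLFP? φ δ θ (a ∷ ρ))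
    satLFP? (lfp φ xs)  δ θ ρ =
      map′ (λ p → fix , fix-least , p) (λ (R , least , p) → proj₁ (least≐fix {R} least) p) (⟦⟧? fix _)
      where open Fixpoint φ δ θ ρ

    -- The three properties form one statement: `not` exchanges growth of `δ` with shrinking of `θ`,
    -- and the `lfp` case compares two iterations in which everything changes at once. There the
    -- larger fixed point is closed under the smaller operator and hence contains all its stages.
    satLFP-mono : ∀ {Δ Θ n} (φ : LFP σ Δ Θ n) {δ δ′ θ θ′ ρ ρ′} →
                  δ ⊑ δ′ → θ′ ⊑ θ → Pointwise _≈_ ρ ρ′ →
                  SatLFP 𝔄 φ δ θ ρ → SatLFP 𝔄 φ δ′ θ′ ρ′
    satLFP-mono (eq x y) δ⊑ θ⊒ ρ≈ p =
      ≈-trans (≈-sym (PW.lookup ρ≈ x)) (≈-trans p (PW.lookup ρ≈ y))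
    satLFP-mono (atom s xs) δ⊑ θ⊒ ρ≈ p = rel-resp s (lookupPW ρ≈ xs) p
    satLFP-mono (var X xs) {δ} δ⊑ θ⊒ ρ≈ p = δ⊑ X (resp (lookupAll δ X) (lookupPW ρ≈ xs) p)
    satLFP-mono (not φ) {δ} {δ′} {θ} {θ′} δ⊑ θ⊒ ρ≈ ¬p p = ¬p (satLFP-mono φ {θ′} {θ} {δ′} {δ} θ⊒ δ⊑ (≋-sym ρ≈) p)
    satLFP-mono (φ and ψ) {δ} {δ′} {θ} {θ′} δ⊑ θ⊒ ρ≈ (p , q) =
      satLFP-mono φ {δ} {δ′} {θ} {θ′} δ⊑ θ⊒ ρ≈ p , satLFP-mono ψ {δ} {δ′} {θ} {θ′} δ⊑ θ⊒ ρ≈ q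
    satLFP-mono (ex φ) {δ} {δ′} {θ} {θ′} δ⊑ θ⊒ ρ≈ (a , p) =
      a , satLFP-mono φ {δ} {δ′} {θ} {θ′} δ⊑ θ⊒ (≈-refl ∷ ρ≈) p
    satLFP-mono (lfp {k = k} φ xs) {δ} {δ′} {θ} {θ′} {ρ} {ρ′} δ⊑ θ⊒ ρ≈ (R , least , p) =
      I′.fix , I′.fix-least , resp I′.fix (lookupPW ρ≈ xs) (I.least⊆ {R} least ⟦ I′.fix ⟧ closed p)
      where
      module I  = Fixpoint φ δ θ ρ
      module I′ = Fixpoint φ δ′ θ′ ρ′
      closed : ∀ S → ⟦ S ⟧ ⊆ ⟦ I′.fix ⟧ → (λ bs → SatLFP 𝔄 φ (S ∷ δ) θ (bs ++ ρ)) ⊆ ⟦ I′.fix ⟧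
      closed S S⊆ q =
        I′.fix-closed (satLFP-mono φ {S ∷ δ} {I′.fix ∷ δ′} {θ} {θ′}
          (⊑-∷ {R = S} {S = I′.fix} {δ = δ} {δ′ = δ′} S⊆ δ⊑) θ⊒ (PW.++⁺ ≋-refl ρ≈) q)

    module Fixpoint {Δ Θ n k} (φ : LFP σ (k ∷ Δ) Θ (k + n)) δ θ ρ =
      Iteration listing (λ S bs → SatLFP 𝔄 φ (S ∷ δ) θ (bs ++ ρ))
        (λ S bs → satLFP? φ (S ∷ δ) θ (bs ++ ρ))
        (λ S bs≈ → satLFP-mono φ {S ∷ δ} {S ∷ δ} {θ} {θ} (⊑-refl {δ = S ∷ δ}) (⊑-refl {δ = θ}) (PW.++⁺ bs≈ ≋-refl))
        (λ {R} {S} R⊆S → satLFP-mono φ {R ∷ δ} {S ∷ δ} {θ} {θ} (⊑-∷ {R = R} {S = S} {δ = δ} {δ′ = δ} R⊆S (⊑-refl {δ = δ})) (⊑-refl {δ = θ}) ≋-refl)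

-- Unit propagation

module UnitPropagation (ψ : Structure cnfVoc) where
  open Structure ψ
  open CNF ψ
  open IsEquivalence isEquivalence using () renaming (refl to ≈-refl; sym to ≈-sym; trans to ≈-trans)

  data Forced : Pred Universe 0ℓ where
    force : ∀ {c v} → C c → P v c → (∀ u → N u c → Forced u) → Forced v

  Refuted : Set
  Refuted = Σ[ c ∈ Universe ] ((C c × ¬ (∃[ v ] P v c)) × (∀ u → N u c → Forced u))

  P-respˡ : ∀ {c u v} → u ≈ v → P u c → P v c
  P-respˡ u≈v = rel-resp _ (u≈v ∷ ≈-refl ∷ [])

  N-respˡ : ∀ {c u v} → u ≈ v → N u c → N v c
  N-respˡ u≈v = rel-resp _ (u≈v ∷ ≈-refl ∷ [])

  Forced-resp : Forced Respects _≈_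
  Forced-resp u≈v (force c p fs) = force c (P-respˡ u≈v p) fs

  ≈ₗ-trans : ∀ {k l m} → k ≈ₗ l → l ≈ₗ m → k ≈ₗ m
  ≈ₗ-trans (pos p) (pos q) = pos (≈-trans p q)
  ≈ₗ-trans (neg p) (neg q) = neg (≈-trans p q)

  ≈ₗ-sym : ∀ {k l} → k ≈ₗ l → l ≈ₗ k
  ≈ₗ-sym (pos p) = pos (≈-sym p)
  ≈ₗ-sym (neg p) = neg (≈-sym p)

  ⟪⟫-resp : ∀ D {k l} → k ≈ₗ l → ⟪ D ⟫ k → ⟪ D ⟫ l
  ⟪⟫-resp D k≈l = Any.map (≈ₗ-trans (≈ₗ-sym k≈l))

  isHorn : ∀ {D} → Derivable D → IsHorn ⟪ D ⟫
  isHorn (axiom _ _ h) = h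
  isHorn (resolve _ _ _ _ _ _ h) = h

  derivable-≐ : ∀ {D E} → ⟪ D ⟫ ≐ ⟪ E ⟫ → Derivable D → Derivable E
  derivable-≐ (D⊆E , E⊆D) (axiom c (D⊆c , c⊆D) h) =
    axiom c (D⊆c ∘ E⊆D , D⊆E ∘ c⊆D) (λ p q → h (E⊆D p) (E⊆D q))
  derivable-≐ (D⊆E , E⊆D) (resolve v d e p n (F⊆ , ⊆F) h) =
    resolve v d e p n (F⊆ ∘ E⊆D , D⊆E ∘ ⊆F) (λ p q → h (E⊆D p) (E⊆D q))

  module _ (L : Listing _≈_) (_≈?_ : Decidable₂ _≈_)
           (P? : Decidable₂ P) (N? : Decidable₂ N) where

    private
      ∃P? : ∀ c → Dec (Σ[ v ∈ Universe ] P v c)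
      ∃P? c = Listing.search L P-respˡ (λ v → P? v c)

    -- Unit propagation makes some positive literal of each derived clause true
    -- as soon as its negative literals are false.
    sound : ∀ {D} → Derivable D → (∀ u → ⟪ D ⟫ (neg u) → Forced u) →
            Refuted ⊎ Σ[ v ∈ Universe ] (⟪ D ⟫ (pos v) × Forced v)
    sound (axiom {c} Cc (D⊆c , c⊆D) _) forced with ∃P? c
    ... | yes (v , p) = inj₂ (v , c⊆D p , force Cc p (λ u → forced u ∘ c⊆D))
    ... | no ¬p = inj₁ (c , (Cc , ¬p) , λ u → forced u ∘ c⊆D)
    -- Only `pos v` leaves `D`, so the negative literals of `D` survive in `F` and are forced. The
    -- positive literal found in `D` either survives too, or it is `v`; then `v` is forced, and with
    -- it every negative literal of `E`.
    sound (resolve {D} {E} {F} v d e v∈D v∈E (F⊆ , ⊆F) _) forced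
      with sound d (λ u u∈D → forced u (⊆F (inj₁ (u∈D , λ ()))))
    ... | inj₁ r = inj₁ r
    ... | inj₂ (w , w∈D , Fw) with v ≈? w
    ...   | no v≉w = inj₂ (w , ⊆F (inj₁ (w∈D , λ { (pos e) → v≉w e })) , Fw)
    ...   | yes v≈w with sound e forcedE
      where
      forcedE : ∀ u → ⟪ E ⟫ (neg u) → Forced u
      forcedE u u∈E with v ≈? u
      ... | yes v≈u = Forced-resp (≈-trans (≈-sym v≈w) v≈u) Fw
      ... | no v≉u = forced u (⊆F (inj₂ (u∈E , λ { (neg e) → v≉u e })))
    ...     | inj₁ r = inj₁ r
    ...     | inj₂ (x , x∈E , Fx) = inj₂ (x , ⊆F (inj₂ (x∈E , λ ())) , Fx)

    clause : List Universe → List Universe → Clause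
    clause vs us = mapₗ pos vs ++ₗ mapₗ neg us

    pos⁻ : ∀ vs us {v} → ⟪ clause vs us ⟫ (pos v) → Any (v ≈_) vs
    pos⁻ vs us p with ++⁻ (mapₗ pos vs) p
    ... | inj₁ q = Any.map (λ { (pos e) → e }) (map⁻ q)
    ... | inj₂ q with Any.satisfied (map⁻ q)
    ...   | _ , ()

    neg⁻ : ∀ vs us {u} → ⟪ clause vs us ⟫ (neg u) → Any (u ≈_) us
    neg⁻ vs us p with ++⁻ (mapₗ pos vs) p
    ... | inj₂ q = Any.map (λ { (neg e) → e }) (map⁻ q)
    ... | inj₁ q with Any.satisfied (map⁻ q)
    ...   | _ , ()

    pos⁺ : ∀ vs us {v} → Any (v ≈_) vs → ⟪ clause vs us ⟫ (pos v)
    pos⁺ vs us = ++⁺ˡ ∘ map⁺ ∘ Any.map pos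

    neg⁺ : ∀ vs us {u} → Any (u ≈_) us → ⟪ clause vs us ⟫ (neg u)
    neg⁺ vs us = ++⁺ʳ (mapₗ pos vs) ∘ map⁺ ∘ Any.map neg

    unit : Universe → Clause
    unit v = pos v ∷ []

    -- Resolving with the unit clause of `u` deletes every copy of `neg u`. An occurrence with a
    -- later copy is therefore dropped without resolving: the set of literals is the same without
    -- it.
    eliminate : ∀ vs us → Allₗ (Derivable ∘ unit) us → Derivable (clause vs us) → Derivable (clause vs [])
    eliminate vs [] [] d = d
    eliminate vs (u ∷ us) (f ∷ fs) d with any? (u ≈?_) us
    ... | yes u∈us = eliminate vs us fs (derivable-≐ (to , from) d)
      where
      to : ⟪ clause vs (u ∷ us) ⟫ ⊆ ⟪ clause vs us ⟫
      to {pos v} p = pos⁺ vs us (pos⁻ vs (u ∷ us) p)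
      to {neg v} p with neg⁻ vs (u ∷ us) p
      ... | here v≈u = neg⁺ vs us (Any.map (≈-trans v≈u) u∈us)
      ... | there v∈ = neg⁺ vs us v∈
      from : ⟪ clause vs us ⟫ ⊆ ⟪ clause vs (u ∷ us) ⟫
      from {pos v} p = pos⁺ vs (u ∷ us) (pos⁻ vs us p)
      from {neg v} p = neg⁺ vs (u ∷ us) (there (neg⁻ vs us p))
    ... | no u∉us = eliminate vs us fs
          (resolve u f d (here (pos ≈-refl)) (neg⁺ vs (u ∷ us) (here ≈-refl)) (to , from)
            (λ p q → isHorn d (up p) (up q)))
      where
      up : ∀ {v} → ⟪ clause vs us ⟫ (pos v) → ⟪ clause vs (u ∷ us) ⟫ (pos v)
      up p = pos⁺ vs (u ∷ us) (pos⁻ vs us p)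
      to : ∀ {l} → ⟪ clause vs us ⟫ l →
           (⟪ unit u ⟫ l × ¬ (pos u ≈ₗ l)) ⊎ (⟪ clause vs (u ∷ us) ⟫ l × ¬ (neg u ≈ₗ l))
      to {pos v} p = inj₂ (up p , λ ())
      to {neg v} p = inj₂ (neg⁺ vs (u ∷ us) (there (neg⁻ vs us p))
                          , λ { (neg u≈v) → u∉us (Any.map (≈-trans u≈v) (neg⁻ vs us p)) })
      from : ∀ {l} → (⟪ unit u ⟫ l × ¬ (pos u ≈ₗ l)) ⊎ (⟪ clause vs (u ∷ us) ⟫ l × ¬ (neg u ≈ₗ l)) →
             ⟪ clause vs us ⟫ l
      from (inj₁ (here e , ¬e)) = contradiction (≈ₗ-sym e) ¬e
      from {pos v} (inj₂ (p , _)) = pos⁺ vs us (pos⁻ vs (u ∷ us) p)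
      from {neg v} (inj₂ (p , ¬e)) with neg⁻ vs (u ∷ us) p
      ... | here v≈u = contradiction (neg (≈-sym v≈u)) ¬e
      ... | there v∈ = neg⁺ vs us v∈

    private
      ∈-filter⁺ : ∀ {R : Pred Universe 0ℓ} (R? : Decidable R) → R Respects _≈_ →
                  ∀ {v} → R v → Any (v ≈_) (filter R? (Listing.elements L))
      ∈-filter⁺ R? R-resp {v} = Membershipₛ.∈-filter⁺ universe R? R-resp (Listing.complete L v)
      ∈-filter⁻ : ∀ {R : Pred Universe 0ℓ} (R? : Decidable R) → R Respects _≈_ →
                  ∀ {v} → Any (v ≈_) (filter R? (Listing.elements L)) → R v
      ∈-filter⁻ R? R-resp = proj₂ ∘ Membershipₛ.∈-filter⁻ universe R? R-resp {xs = Listing.elements L}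

    module _ (horn : ∀ c → C c → IsHorn (literals c)) where

      positives negatives : Universe → List Universe
      positives c = filter (λ v → P? v c) (Listing.elements L)
      negatives c = filter (λ u → N? u c) (Listing.elements L)

      derive-positives : ∀ {c} → C c → (∀ u → N u c → Derivable (unit u)) → Derivable (clause (positives c) [])
      derive-positives {c} Cc ds = eliminate (positives c) (negatives c)
        (All.map (λ {u} → ds u) (all-filter (λ u → N? u c) (Listing.elements L)))
        (axiom Cc (to , from) (λ p q → horn c Cc (to p) (to q)))
        where
        to : ⟪ clause (positives c) (negatives c) ⟫ ⊆ literals c
        to {pos v} p = ∈-filter⁻ (λ v → P? v c) P-respˡ (pos⁻ (positives c) (negatives c) p)
        to {neg u} p = ∈-filter⁻ (λ v → N? v c) N-respˡ (neg⁻ (positives c) (negatives c) p)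
        from : literals c ⊆ ⟪ clause (positives c) (negatives c) ⟫
        from {pos v} p = pos⁺ (positives c) (negatives c) (∈-filter⁺ (λ v → P? v c) P-respˡ p)
        from {neg u} p = neg⁺ (positives c) (negatives c) (∈-filter⁺ (λ v → N? v c) N-respˡ p)

      derive-unit : ∀ {v} → Forced v → Derivable (unit v)
      derive-unit {v} (force {c} Cc p fs) =
        derivable-≐ (to , from) (derive-positives Cc (λ u → derive-unit ∘ fs u))
        where
        to : ⟪ clause (positives c) [] ⟫ ⊆ ⟪ unit v ⟫
        to {pos w} q = here (pos (horn c Cc (∈-filter⁻ (λ v → P? v c) P-respˡ (pos⁻ (positives c) [] q)) p))
        to {neg w} q with neg⁻ (positives c) [] q
        ... | ()
        from : ⟪ unit v ⟫ ⊆ ⟪ clause (positives c) [] ⟫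
        from (here e) = ⟪⟫-resp _ (≈ₗ-sym e) (pos⁺ (positives c) [] (∈-filter⁺ (λ v → P? v c) P-respˡ p))

      refutable⇔ : Derivable [] ⇔ Refuted
      refutable⇔ = mk⇔ to from
        where
        to : Derivable [] → Refuted
        to d with sound d (λ _ ())
        ... | inj₁ r = r
        from : Refuted → Derivable []
        from (c , (Cc , ¬p) , fs) = derivable-≐ (no-literal , λ { () }) (derive-positives Cc (λ u → derive-unit ∘ fs u))
          where
          no-literal : ⟪ clause (positives c) [] ⟫ ⊆ ⟪ [] ⟫
          no-literal {pos v} q = contradiction (v , ∈-filter⁻ (λ v → P? v c) P-respˡ (pos⁻ (positives c) [] q)) ¬p
          no-literal {neg v} q with neg⁻ (positives c) [] q
          ... | ()

-- From FO(Horn-Res) to LFP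

infixr 3 _∧_
infixr 2 _⊃_
infix  4 _≃_

-- The conditions on an interpreted structure are written once in this language and then pulled
-- back. It has all connectives, so that `Holds` unfolds to the intended statement; LFP has only
-- `not`, `and` and `ex`.
data Form (τ : Vocabulary) : ℕ → Set where
  _≃_     : ∀ {m} → Fin m → Fin m → Form τ m
  pred    : ∀ {m k} → k ∈ τ → Vec (Fin m) k → Form τ m
  neg     : ∀ {m} → Form τ m → Form τ m
  _∧_ _∨_ _⊃_ : ∀ {m} → Form τ m → Form τ m → Form τ m
  all some : ∀ {m} → Form τ (suc m) → Form τ m

module _ {τ : Vocabulary} (𝔅 : RawStructure τ) where
  open RawStructure 𝔅 using (Universe; _≈_) renaming (rel to rel𝔅)

  Holds : ∀ {m} → Form τ m → Vec Universe m → Set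
  Holds (x ≃ y)    e = lookup e x ≈ lookup e y
  Holds (pred s xs) e = rel𝔅 s (map (lookup e) xs)
  Holds (neg φ)    e = ¬ Holds φ e
  Holds (φ ∧ ψ)    e = Holds φ e × Holds ψ e
  Holds (φ ∨ ψ)    e = Holds φ e ⊎ Holds ψ e
  Holds (φ ⊃ ψ)    e = Holds φ e → Holds ψ e
  Holds (all φ)    e = ∀ a → Holds φ (a ∷ e)
  Holds (some φ)   e = Σ[ a ∈ Universe ] Holds φ (a ∷ e)

stable-⊎ : ∀ {A B : Set} → Dec A → Dec B → ¬ (¬ A × ¬ B) → A ⊎ B
stable-⊎ (yes a) _ _ = inj₁ a
stable-⊎ (no ¬a) (yes b) _ = inj₂ b
stable-⊎ (no ¬a) (no ¬b) n = contradiction (¬a , ¬b) n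

stable-→ : ∀ {A B : Set} → Dec B → ¬ (A × ¬ B) → A → B
stable-→ b? n a = decidable-stable b? (λ ¬b → n (a , ¬b))

-- Polymorphic in Δ and Θ, because translations of FO(Q) formulas have no free
-- relation variables but are used inside lfp.
Template : Vocabulary → ℕ → Set
Template σ m = ∀ {Δ Θ N} → Vec (Fin N) m → LFP σ Δ Θ N

exs : ∀ {σ Δ Θ N} d → LFP σ Δ Θ (d + N) → LFP σ Δ Θ N
exs zero    φ = φ
exs (suc d) φ = exs d (ex φ)

module _ {N : ℕ} (d : ℕ) where

  fresh : Vec (Fin (d + N)) d
  fresh = tabulate (_↑ˡ N)

  weaken : ∀ {n} → Vec (Fin N) n → Vec (Fin (d + N)) n
  weaken = map (d ↑ʳ_)

  module _ {A : Set} (bs : Vec A d) (ρ : Vec A N) where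

    map-lookup-fresh : map (lookup (bs ++ ρ)) fresh ≡ bs
    map-lookup-fresh = trans (sym (tabulate-∘ (lookup (bs ++ ρ)) (_↑ˡ N)))
      (trans (tabulate-cong (lookup-++ˡ bs ρ)) (tabulate∘lookup bs))

    map-lookup-weaken : ∀ {n} (xs : Vec (Fin N) n) → map (lookup (bs ++ ρ)) (weaken xs) ≡ map (lookup ρ) xs
    map-lookup-weaken xs = trans (sym (map-∘ (lookup (bs ++ ρ)) (d ↑ʳ_) xs)) (map-cong (lookup-++ʳ bs ρ) xs)

module Pull {σ τ : Vocabulary} {d n : ℕ} (tδ : Template σ (d + n)) (t≈ : Template σ ((d + d) + n))
            (tS : ∀ {k} → k ∈ τ → Template σ (k * d + n)) where

  -- The usual pull-back along an interpretation: a variable becomes a `d`-tuple, atoms become the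
  -- defining formulas, quantifiers are relativised to `tδ`. The remaining connectives are classical
  -- abbreviations, justified by decidability.
  pull : ∀ {m} → Form τ m → ∀ {Δ Θ N} → Vec (Fin N) n → Vec (Vec (Fin N) d) m → LFP σ Δ Θ N
  pull (x ≃ y)    r b = t≈ ((lookup b x ++ lookup b y) ++ r)
  pull (pred s xs) r b = tS s (concat (map (lookup b) xs) ++ r)
  pull (neg φ)    r b = not (pull φ r b)
  pull (φ ∧ ψ)    r b = pull φ r b and pull ψ r b
  pull (φ ∨ ψ)    r b = not (not (pull φ r b) and not (pull ψ r b))
  pull (φ ⊃ ψ)    r b = not (pull φ r b and not (pull ψ r b))
  pull (all φ)    r b = not (exs d (tδ (fresh d ++ weaken d r) and not (pull φ (weaken d r) (fresh d ∷ map (weaken d) b))))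
  pull (some φ)   r b = exs d (tδ (fresh d ++ weaken d r) and pull φ (weaken d r) (fresh d ∷ map (weaken d) b))

module _ {σ : Vocabulary} (𝔉 : FiniteStructure σ) where
  open FiniteLFP 𝔉

  exs⇔ : ∀ {Δ Θ N} d (φ : LFP σ Δ Θ (d + N)) {δ θ ρ} →
         SatLFP 𝔄 (exs d φ) δ θ ρ ⇔ (Σ[ bs ∈ Vec Universe d ] SatLFP 𝔄 φ δ θ (bs ++ ρ))
  exs⇔ zero φ = mk⇔ ([] ,_) (λ { ([] , p) → p })
  exs⇔ (suc d) φ = mk⇔ (λ p → let bs , a , q = Equivalence.to (exs⇔ d (ex φ)) p in a ∷ bs , q)
                       (λ { (a ∷ bs , q) → Equivalence.from (exs⇔ d (ex φ)) (bs , a , q) })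

  Realizes : ∀ {m} → Template σ m → Pred (Vec Universe m) 0ℓ → Set
  Realizes t P = ∀ {Δ Θ N} δ θ ρ xs → SatLFP 𝔄 (t {Δ} {Θ} {N} xs) δ θ ρ ⇔ P (map (lookup ρ) xs)

  module PullCorrect {τ : Vocabulary} {d n : ℕ} {tδ : Template σ (d + n)} {t≈ : Template σ ((d + d) + n)}
            {tS : ∀ {k} → k ∈ τ → Template σ (k * d + n)}
            {Pδ : Pred (Vec Universe (d + n)) 0ℓ} {P≈ : Pred (Vec Universe ((d + d) + n)) 0ℓ}
            {PS : ∀ {k} → k ∈ τ → Pred (Vec Universe (k * d + n)) 0ℓ} (δ-ok : Realizes tδ Pδ) (≈-ok : Realizes t≈ P≈)
            (S-ok : ∀ {k} (s : k ∈ τ) → Realizes (tS s) (PS s))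
            (v : Vec Universe n) where
    open Pull {τ = τ} {d} {n} tδ t≈ tS

    𝔅 : RawStructure τ
    𝔅 = record
      { Universe = Σ[ b ∈ Vec Universe d ] Pδ (b ++ v)
      ; _≈_      = λ b b′ → P≈ ((proj₁ b ++ proj₁ b′) ++ v)
      ; rel      = λ s bs → PS s (concat (map proj₁ bs) ++ v)
      }
    open RawStructure 𝔅 using () renaming (Universe to U)

    Evaluates : ∀ {m N} → Vec Universe N → Vec (Vec (Fin N) d) m → Vec U m → Set
    Evaluates ρ b e = map (map (lookup ρ)) b ≡ map proj₁ e

    evaluate-params : ∀ {N} (bs : Vec Universe d) {ρ : Vec Universe N} {r} → map (lookup ρ) r ≡ v →
                      map (lookup (bs ++ ρ)) (weaken d r) ≡ v
    evaluate-params bs {ρ} {r} r≡ = trans (map-lookup-weaken d bs ρ r) r≡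

    evaluate-fresh : ∀ {m N} (a : U) {ρ : Vec Universe N} {b} {e : Vec U m} → Evaluates ρ b e →
                     Evaluates (proj₁ a ++ ρ) (fresh d ∷ map (weaken d) b) (a ∷ e)
    evaluate-fresh a {ρ} {b} b≡ = cong₂ _∷_ (map-lookup-fresh d (proj₁ a) ρ)
      (trans (sym (map-∘ (map (lookup (proj₁ a ++ ρ))) (weaken d) b))
             (trans (map-cong (map-lookup-weaken d (proj₁ a) ρ) b) b≡))

    δ⇔ : ∀ {Δ Θ N} {δ θ} bs {ρ : Vec Universe N} {r} → map (lookup ρ) r ≡ v →
         SatLFP 𝔄 (tδ {Δ} {Θ} (fresh d ++ weaken d r)) δ θ (bs ++ ρ) ⇔ Pδ (bs ++ v)
    δ⇔ {δ = δ} {θ} bs {ρ} {r} r≡ = subst (λ ys → SatLFP 𝔄 (tδ (fresh d ++ weaken d r)) δ θ (bs ++ ρ) ⇔ Pδ ys)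
      (trans (map-++ (lookup (bs ++ ρ)) (fresh d) (weaken d r))
             (cong₂ _++_ (map-lookup-fresh d bs ρ) (evaluate-params bs {r = r} r≡)))
      (δ-ok δ θ (bs ++ ρ) (fresh d ++ weaken d r))

    private
      evaluate-lookup : ∀ {m N} {ρ : Vec Universe N} {b} {e : Vec U m} → Evaluates ρ b e →
                        ∀ x → map (lookup ρ) (lookup b x) ≡ proj₁ (lookup e x)
      evaluate-lookup {ρ = ρ} {b} {e} b≡ x =
        trans (sym (lookup-map x (map (lookup ρ)) b)) (trans (cong (λ z → lookup z x) b≡) (lookup-map x proj₁ e))

    exδ⇔ : ∀ {Δ Θ N} {δ θ} {ρ : Vec Universe N} {r} → map (lookup ρ) r ≡ v →
           (φ : LFP σ Δ Θ (d + N)) {Q : U → Set} →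
           (∀ a → SatLFP 𝔄 φ δ θ (proj₁ a ++ ρ) ⇔ Q a) →
           SatLFP 𝔄 (exs d (tδ (fresh d ++ weaken d r) and φ)) δ θ ρ ⇔ (Σ[ a ∈ U ] Q a)
    exδ⇔ {δ = δ} {θ} {ρ} {r} r≡ φ φ⇔ = mk⇔
      (λ p → let bs , pδ , q = to (exs⇔ d (tδ (fresh d ++ weaken d r) and φ)) p
                 a = bs , to (δ⇔ {δ = δ} {θ} bs {r = r} r≡) pδ
             in a , to (φ⇔ a) q)
      (λ (a , q) → from (exs⇔ d (tδ (fresh d ++ weaken d r) and φ))
                     (proj₁ a , from (δ⇔ {δ = δ} {θ} (proj₁ a) {r = r} r≡) (proj₂ a) , from (φ⇔ a) q))
      where open Equivalence

    pull⇔ : ∀ {m} (φ : Form τ m) {Δ Θ N} {δ : Allₗ (Relation 𝔄) Δ} {θ : Allₗ (Relation 𝔄) Θ} {ρ : Vec Universe N} {r b e} →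
            map (lookup ρ) r ≡ v → Evaluates ρ b e →
            SatLFP 𝔄 (pull φ r b) δ θ ρ ⇔ Holds 𝔅 φ e
    pull⇔ (x ≃ y) {δ = δ} {θ} {ρ} {r} {b} {e} r≡ b≡ = subst (λ ys → SatLFP 𝔄 (pull (x ≃ y) r b) δ θ ρ ⇔ P≈ ys)
      (trans (map-++ (lookup ρ) (lookup b x ++ lookup b y) r)
             (cong₂ _++_ (trans (map-++ (lookup ρ) (lookup b x) (lookup b y))
                                (cong₂ _++_ (evaluate-lookup {ρ = ρ} {b} {e} b≡ x) (evaluate-lookup {ρ = ρ} {b} {e} b≡ y))) r≡))
      (≈-ok δ θ ρ ((lookup b x ++ lookup b y) ++ r))
    pull⇔ (pred s xs) {δ = δ} {θ} {ρ} {r} {b} {e} r≡ b≡ = subst (λ ys → SatLFP 𝔄 (pull (pred s xs) r b) δ θ ρ ⇔ PS s ys)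
      (trans (map-++ (lookup ρ) (concat (map (lookup b) xs)) r)
        (cong₂ _++_ (trans (map-concat (lookup ρ) (map (lookup b) xs))
          (cong concat (trans (sym (map-∘ (map (lookup ρ)) (lookup b) xs))
            (trans (map-cong (evaluate-lookup {ρ = ρ} {b} {e} b≡) xs) (map-∘ proj₁ (lookup e) xs))))) r≡))
      (S-ok s δ θ ρ (concat (map (lookup b) xs) ++ r))
    pull⇔ (neg φ) {δ = δ} {θ} {e = e} r≡ b≡ = mk⇔ (_∘ from ih) (_∘ to ih)
      where open Equivalence
            ih = pull⇔ φ {δ = θ} {δ} {e = e} r≡ b≡
    pull⇔ (φ ∧ ψ) {δ = δ} {θ} {e = e} r≡ b≡ =
      mk⇔ (λ (p , q) → to ih₁ p , to ih₂ q) (λ (p , q) → from ih₁ p , from ih₂ q)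
      where open Equivalence
            ih₁ = pull⇔ φ {δ = δ} {θ} {e = e} r≡ b≡
            ih₂ = pull⇔ ψ {δ = δ} {θ} {e = e} r≡ b≡
    pull⇔ (φ ∨ ψ) {δ = δ} {θ} {ρ} {r} {b} {e} r≡ b≡ =
      mk⇔ (λ p → Sum.map (to ih₁) (to ih₂) (stable-⊎ (satLFP? (pull φ r b) δ θ ρ) (satLFP? (pull ψ r b) δ θ ρ) p))
          (λ { (inj₁ p) (¬p , _) → ¬p (from ih₁ p) ; (inj₂ q) (_ , ¬q) → ¬q (from ih₂ q) })
      where open Equivalence
            ih₁ = pull⇔ φ {δ = δ} {θ} {e = e} r≡ b≡
            ih₂ = pull⇔ ψ {δ = δ} {θ} {e = e} r≡ b≡
    pull⇔ (φ ⊃ ψ) {δ = δ} {θ} {ρ} {r} {b} {e} r≡ b≡ =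
      mk⇔ (λ p → to ih₂ ∘ stable-→ (satLFP? (pull ψ r b) δ θ ρ) p ∘ from ih₁)
          (λ f (p , ¬q) → ¬q (from ih₂ (f (to ih₁ p))))
      where open Equivalence
            ih₁ = pull⇔ φ {δ = θ} {δ} {e = e} r≡ b≡
            ih₂ = pull⇔ ψ {δ = δ} {θ} {e = e} r≡ b≡
    pull⇔ (all φ) {δ = δ} {θ} {ρ} {r} {b} {e} r≡ b≡ =
      mk⇔ (λ p a → to (ih a) (decidable-stable (satLFP? φ′ δ θ (proj₁ a ++ ρ)) (λ ¬q → p (from e⇔ (a , ¬q)))))
          (λ f p → let a , ¬q = to e⇔ p in ¬q (from (ih a) (f a)))
      where open Equivalence
            φ′ = pull φ (weaken d r) (fresh d ∷ map (weaken d) b)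
            ih = λ a → pull⇔ φ {δ = δ} {θ} {proj₁ a ++ ρ} {weaken d r} {fresh d ∷ map (weaken d) b} {a ∷ e} (evaluate-params (proj₁ a) {r = r} r≡) (evaluate-fresh a {e = e} b≡)
            e⇔ = exδ⇔ {δ = θ} {δ} {r = r} r≡ (not φ′) (λ a → mk⇔ id id)
    pull⇔ (some φ) {δ = δ} {θ} {ρ} {r} {b} {e} r≡ b≡ =
      exδ⇔ {δ = δ} {θ} {r = r} r≡ (pull φ (weaken d r) (fresh d ∷ map (weaken d) b)) (λ a → pull⇔ φ {δ = δ} {θ} {e = a ∷ e} (evaluate-params (proj₁ a) {r = r} r≡) (evaluate-fresh a {e = e} b≡))

-- Horn refutability of an interpreted structure as an LFP formula

module _ where
  private
    C V : ∀ {m} → Fin m → Form cnfVoc m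
    C c = pred (here refl) (c ∷ [])
    V v = pred (there (here refl)) (v ∷ [])

    P N : ∀ {m} → Fin m → Fin m → Form cnfVoc m
    P v c = pred (there (there (here refl))) (v ∷ c ∷ [])
    N v c = pred (there (there (there (here refl)))) (v ∷ c ∷ [])

    pattern 0f = zero
    pattern 1f = suc zero
    pattern 2f = suc (suc zero)
    pattern 3f = suc (suc (suc zero))

  congruent : Form cnfVoc 0
  congruent = all (0f ≃ 0f)
            ∧ all (all (1f ≃ 0f ⊃ 0f ≃ 1f))
            ∧ all (all (all (2f ≃ 1f ⊃ 1f ≃ 0f ⊃ 2f ≃ 0f)))
            ∧ all (all (1f ≃ 0f ⊃ C 1f ⊃ C 0f))
            ∧ all (all (1f ≃ 0f ⊃ V 1f ⊃ V 0f))
            ∧ all (all (all (all (3f ≃ 2f ⊃ 1f ≃ 0f ⊃ P 3f 1f ⊃ P 2f 0f))))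
            ∧ all (all (all (all (3f ≃ 2f ⊃ 1f ≃ 0f ⊃ N 3f 1f ⊃ N 2f 0f))))

  hornFormula : Form cnfVoc 0
  hornFormula = all (C 0f ∨ V 0f)
              ∧ all (neg (C 0f ∧ V 0f))
              ∧ all (all (P 1f 0f ⊃ V 1f ∧ C 0f))
              ∧ all (all (N 1f 0f ⊃ V 1f ∧ C 0f))
              ∧ all (C 0f ⊃ all (all (P 1f 2f ⊃ P 0f 2f ⊃ 1f ≃ 0f)))

  module _ (𝔅 : RawStructure cnfVoc) where

    congruent⇔ : Holds 𝔅 congruent [] ⇔ IsCongruent 𝔅
    congruent⇔ = mk⇔ to from
      where
      to : Holds 𝔅 congruent [] → IsCongruent 𝔅
      to (r , s , t , c , v , p , n) = record
        { isEquivalence = record { refl = r _ ; sym = s _ _ ; trans = t _ _ _ }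
        ; rel-resp = λ
            { (here refl) (x ∷ []) → c _ _ x
            ; (there (here refl)) (x ∷ []) → v _ _ x
            ; (there (there (here refl))) (x ∷ y ∷ []) → p _ _ _ _ x y
            ; (there (there (there (here refl)))) (x ∷ y ∷ []) → n _ _ _ _ x y
            } }
      from : IsCongruent 𝔅 → Holds 𝔅 congruent []
      from c = (λ _ → IsEquivalence.refl isEquivalence) , (λ _ _ → IsEquivalence.sym isEquivalence)
        , (λ _ _ _ → IsEquivalence.trans isEquivalence)
        , (λ _ _ x → rel-resp _ (x ∷ [])) , (λ _ _ x → rel-resp _ (x ∷ []))
        , (λ _ _ _ _ x y → rel-resp _ (x ∷ y ∷ [])) , (λ _ _ _ _ x y → rel-resp _ (x ∷ y ∷ []))
        where open IsCongruent c

    module _ (c : IsCongruent 𝔅) where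
      private
        ψ : Structure cnfVoc
        ψ = record { raw = 𝔅 ; isCongruent = c }
      open CNF ψ using (EncodesCNF; IsHorn; literals) renaming (C to C𝔅)

      hornFormula⇔ : Holds 𝔅 hornFormula [] ⇔ (EncodesCNF × (∀ x → C𝔅 x → IsHorn (literals x)))
      hornFormula⇔ = mk⇔
        (λ (a , b , p , n , h) → record { clause-or-variable = a ; disjoint = b ; P-typed = p _ _ ; N-typed = n _ _ }
                               , λ x Cx → h x Cx _ _)
        (λ (e , h) → let open CNF.EncodesCNF e in
            clause-or-variable , disjoint , (λ _ _ → P-typed) , (λ _ _ → N-typed) , λ x Cx _ _ → h x Cx)

  module HornPull {σ d n} (tδ : Template σ (d + n)) (t≈ : Template σ ((d + d) + n))
                  (tS : ∀ {k} → k ∈ cnfVoc → Template σ (k * d + n)) where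
    open Pull {τ = cnfVoc} {d} {n} tδ t≈ tS

    module _ {Δ Θ} (X : ∀ {N} → Vec (Fin N) n → Vec (Fin N) d → LFP σ Δ Θ N) where

      -- The universal quantifier puts `X` under two negations, so `X` stays positive. It can
      -- therefore be the variable bound by `lfp`, as in `forcedStep`, or the completed fixed point
      -- `forced`, as in `hornRes`.
      allNegative : ∀ {N} → Vec (Fin N) n → Vec (Fin N) d → LFP σ Δ Θ N
      allNegative r c = not (exs d (tδ (fresh d ++ weaken d r) and
        (pull (N 0f 1f) (weaken d r) (fresh d ∷ weaken d c ∷ []) and not (X (weaken d r) (fresh d)))))

      someClause : ∀ {m N} → Form cnfVoc (suc m) → Vec (Fin N) n → Vec (Vec (Fin N) d) m → LFP σ Δ Θ N
      someClause γ r b = exs d (tδ (fresh d ++ weaken d r) and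
        (pull γ (weaken d r) (fresh d ∷ map (weaken d) b) and allNegative (weaken d r) (fresh d)))

    -- The fixed point is taken over all `d`-tuples, so membership in the interpreted universe has
    -- to be imposed by the step itself.
    forcedStep : ∀ {Δ Θ N} → Vec (Fin N) n → LFP σ (d ∷ Δ) Θ (d + N)
    forcedStep r = tδ (fresh d ++ weaken d r) and
      someClause (λ _ xs → var (here refl) xs) (C 0f ∧ P 1f 0f) (weaken d r) (fresh d ∷ [])

    forced : ∀ {Δ Θ N} → Vec (Fin N) n → Vec (Fin N) d → LFP σ Δ Θ N
    forced r xs = lfp (forcedStep r) xs

    -- The quantifier also asserts that the interpretation is defined, hence the conjunct
    -- `congruent`.
    hornRes : ∀ {Δ Θ N} → Vec (Fin N) n → LFP σ Δ Θ N
    hornRes r = pull congruent r [] and (pull hornFormula r [] and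
      someClause forced (C 0f ∧ neg (some (P 0f 1f))) r [])

  module _ {σ : Vocabulary} (𝔉 : FiniteStructure σ) where
    open FiniteLFP 𝔉

    module HornPullCorrect {d n : ℕ} {tδ : Template σ (d + n)} {t≈ : Template σ ((d + d) + n)}
              {tS : ∀ {k} → k ∈ cnfVoc → Template σ (k * d + n)}
              {Pδ : Pred (Vec Universe (d + n)) 0ℓ} {P≈ : Pred (Vec Universe ((d + d) + n)) 0ℓ}
              {PS : ∀ {k} → k ∈ cnfVoc → Pred (Vec Universe (k * d + n)) 0ℓ}
              (δ-ok : Realizes 𝔉 tδ Pδ) (≈-ok : Realizes 𝔉 t≈ P≈)
              (S-ok : ∀ {k} (s : k ∈ cnfVoc) → Realizes 𝔉 (tS s) (PS s))
              (v : Vec Universe n) where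
      open Pull {τ = cnfVoc} {d} {n} tδ t≈ tS
      open HornPull {d = d} {n} tδ t≈ tS
      open PullCorrect 𝔉 {cnfVoc} {d} {n} {tδ} {t≈} {tS} {Pδ} {P≈} {PS} δ-ok ≈-ok S-ok v
      open RawStructure 𝔅 using () renaming (Universe to U; rel to rel𝔅)
      open Equivalence

      N𝔅 : U → U → Set
      N𝔅 u c = rel𝔅 (there (there (there (here refl)))) (u ∷ c ∷ [])

      module _ {Δ Θ} {X : ∀ {N} → Vec (Fin N) n → Vec (Fin N) d → LFP σ Δ Θ N} {δ θ}
               {Y : Pred (Vec Universe d) 0ℓ}
               (X-ok : ∀ {N} {ρ : Vec Universe N} {r} → map (lookup ρ) r ≡ v →
                       ∀ xs → SatLFP 𝔄 (X r xs) δ θ ρ ⇔ Y (map (lookup ρ) xs)) where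

        allNegative⇔ : ∀ {N} {ρ : Vec Universe N} {r xs} (c : U) → map (lookup ρ) r ≡ v → map (lookup ρ) xs ≡ proj₁ c →
                       SatLFP 𝔄 (allNegative X r xs) δ θ ρ ⇔ (∀ u → N𝔅 u c → Y (proj₁ u))
        allNegative⇔ {ρ = ρ} {r} {xs} c r≡ c≡ = mk⇔
          (λ p u nu → decidable-stable (map′ (to (X⇔ u)) (from (X⇔ u)) (satLFP? Xu δ θ (proj₁ u ++ ρ)))
                        (λ ¬y → p (from e⇔ (u , from (N⇔ u) nu , ¬y ∘ to (X⇔ u)))))
          (λ f p → let u , nu , ¬x = to e⇔ p in ¬x (from (X⇔ u) (f u (to (N⇔ u) nu))))
          where
          Xu = X (weaken d r) (fresh d)
          Nu = pull (N 0f 1f) (weaken d r) (fresh d ∷ weaken d xs ∷ [])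
          e⇔ = exδ⇔ {δ = θ} {δ} {r = r} r≡ (Nu and not Xu) (λ a → mk⇔ id id)
          N⇔ : ∀ u → SatLFP 𝔄 Nu θ δ (proj₁ u ++ ρ) ⇔ N𝔅 u c
          N⇔ u = pull⇔ (N 0f 1f) {δ = θ} {δ} {e = u ∷ c ∷ []} (evaluate-params (proj₁ u) {r = r} r≡)
                   (evaluate-fresh u {b = xs ∷ []} {e = c ∷ []} (cong (_∷ []) c≡))
          X⇔ : ∀ u → SatLFP 𝔄 Xu δ θ (proj₁ u ++ ρ) ⇔ Y (proj₁ u)
          X⇔ u = subst (λ z → SatLFP 𝔄 Xu δ θ (proj₁ u ++ ρ) ⇔ Y z) (map-lookup-fresh d (proj₁ u) ρ)
                   (X-ok {r = weaken d r} (evaluate-params (proj₁ u) {r = r} r≡) (fresh d))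

        someClause⇔ : ∀ {m N} (γ : Form cnfVoc (suc m)) {ρ : Vec Universe N} {r b} {e : Vec U m} →
                      map (lookup ρ) r ≡ v → Evaluates ρ b e →
                      SatLFP 𝔄 (someClause X γ r b) δ θ ρ ⇔
                      (Σ[ c ∈ U ] (Holds 𝔅 γ (c ∷ e) × (∀ u → N𝔅 u c → Y (proj₁ u))))
        someClause⇔ γ {ρ} {r} {b} {e} r≡ b≡ =
          exδ⇔ {δ = δ} {θ} {r = r} r≡ (pull γ (weaken d r) (fresh d ∷ map (weaken d) b) and allNegative X (weaken d r) (fresh d))
            λ c → let γ⇔ = pull⇔ γ {δ = δ} {θ} {e = c ∷ e} (evaluate-params (proj₁ c) {r = r} r≡) (evaluate-fresh c {e = e} b≡)
                      n⇔ = allNegative⇔ {r = weaken d r} {fresh d} c (evaluate-params (proj₁ c) {r = r} r≡) (map-lookup-fresh d (proj₁ c) ρ)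
                  in mk⇔ (λ (p , q) → to γ⇔ p , to n⇔ q) (λ (p , q) → from γ⇔ p , from n⇔ q)

      module _ (c𝔅 : IsCongruent 𝔅) where
        ψ : Structure cnfVoc
        ψ = record { raw = 𝔅 ; isCongruent = c𝔅 }
        open UnitPropagation ψ
        open CNF ψ using () renaming (C to C𝔅; P to P𝔅)

        ForcedTuple : Pred (Vec Universe d) 0ℓ
        ForcedTuple bs = Σ[ p ∈ Pδ (bs ++ v) ] Forced (bs , p)

        -- An element of `𝔅` carries a proof of `Pδ`, while the fixed point sees only tuples. The
        -- relation of `𝔅` ignores these proofs, so reflexivity identifies two elements with the
        -- same tuple.
        ForcedTuple⇒Forced : ∀ u → ForcedTuple (proj₁ u) → Forced u
        ForcedTuple⇒Forced u (p , f) = Forced-resp (IsEquivalence.refl (IsCongruent.isEquivalence c𝔅) {u}) f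

        forcedStep⇔ : ∀ {Δ Θ N} {δ : Allₗ (Relation 𝔄) Δ} {θ : Allₗ (Relation 𝔄) Θ} {ρ : Vec Universe N} {r} →
          map (lookup ρ) r ≡ v → ∀ S bs →
          SatLFP 𝔄 (forcedStep r) (S ∷ δ) θ (bs ++ ρ) ⇔
          (Σ[ p ∈ Pδ (bs ++ v) ] Σ[ c ∈ U ] ((C𝔅 c × P𝔅 (bs , p) c) × (∀ u → N𝔅 u c → ⟦ S ⟧ (proj₁ u))))
        forcedStep⇔ {δ = δ} {θ} {ρ} {r} r≡ S bs = mk⇔
          (λ (p , q) → let p′ = to d⇔ p in p′ , to (s⇔ p′) q)
          (λ (p , q) → from d⇔ p , from (s⇔ p) q)
          where
          d⇔ = δ⇔ {δ = S ∷ δ} {θ} bs {r = r} r≡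
          s⇔ = λ p → someClause⇔ {X = λ _ xs → var (here refl) xs} {S ∷ δ} {θ} {⟦ S ⟧} (λ _ _ → mk⇔ id id) (C 0f ∧ P 1f 0f)
                 {bs ++ ρ} {weaken d r} {fresh d ∷ []} {(bs , p) ∷ []}
                 (evaluate-params bs {r = r} r≡) (cong (_∷ []) (map-lookup-fresh d bs ρ))

        forced⇔ : ∀ {Δ Θ} (δ : Allₗ (Relation 𝔄) Δ) (θ : Allₗ (Relation 𝔄) Θ) {N} {ρ : Vec Universe N} {r} →
          map (lookup ρ) r ≡ v → ∀ xs →
          SatLFP 𝔄 (forced r xs) δ θ ρ ⇔ ForcedTuple (map (lookup ρ) xs)
        forced⇔ δ θ {ρ = ρ} {r} r≡ xs = mk⇔
          (λ (R , least , p) → least⊆ {R} least ForcedTuple closed p)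
          (λ (_ , f) → fix , fix-least , Forced⊆fix f)
          where
          open Fixpoint (forcedStep r) δ θ ρ
          step⇔ = forcedStep⇔ {δ = δ} {θ} {r = r} r≡
          closed : ∀ S → ⟦ S ⟧ ⊆ ForcedTuple → (λ bs → SatLFP 𝔄 (forcedStep r) (S ∷ δ) θ (bs ++ ρ)) ⊆ ForcedTuple
          closed S S⊆ {bs} q with to (step⇔ S bs) q
          ... | p , c , (Cc , Pc) , n = p , force {c} Cc Pc (λ u nu → ForcedTuple⇒Forced u (S⊆ (n u nu)))
          Forced⊆fix : ∀ {u} → Forced u → ⟦ fix ⟧ (proj₁ u)
          Forced⊆fix {bs , p} (force {c} Cc Pc fs) =
            fix-closed (from (step⇔ fix bs) (p , c , (Cc , Pc) , λ u nu → Forced⊆fix (fs u nu)))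

        refuted⇔ : ∀ {Δ Θ N} {δ : Allₗ (Relation 𝔄) Δ} {θ : Allₗ (Relation 𝔄) Θ} {ρ : Vec Universe N} {r} →
          map (lookup ρ) r ≡ v →
          SatLFP 𝔄 (someClause forced (C 0f ∧ neg (some (P 0f 1f))) r []) δ θ ρ ⇔ Refuted
        refuted⇔ {δ = δ} {θ} {ρ} {r} r≡ = mk⇔
          (λ p → let c , γ , n = to s⇔ p in c , γ , λ u nu → ForcedTuple⇒Forced u (n u nu))
          (λ (c , γ , n) → from s⇔ (c , γ , λ u nu → proj₂ u , n u nu))
          where
          s⇔ = someClause⇔ {X = forced} {δ} {θ} {ForcedTuple} (λ {N} {ρ} {r} → forced⇔ δ θ {r = r})
                 (C 0f ∧ neg (some (P 0f 1f))) {ρ} {r} {[]} {[]} r≡ refl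

module _ {A : Set} {_≈_ : Rel A 0ℓ} {P : Pred A 0ℓ} {_∼_ : Rel (Σ A P) 0ℓ} (L : Listing _≈_)
         (P? : Decidable P) (P-resp : P Respects _≈_)
         (≈⇒∼ : ∀ {x y} → proj₁ x ≈ proj₁ y → x ∼ y) where
  private
    witnesses : ∀ x → Dec (P x) → List (Σ A P)
    witnesses x (yes p) = (x , p) ∷ []
    witnesses x (no _)  = []

    ∈-witnesses : ∀ {x p y} → x ≈ y → (P?y : Dec (P y)) → Any ((x , p) ∼_) (witnesses y P?y)
    ∈-witnesses x≈y (yes q)       = here (≈⇒∼ x≈y)
    ∈-witnesses {p = p} x≈y (no ¬q) = contradiction (P-resp x≈y p) ¬q

  Σ-listing : Listing _∼_
  Σ-listing = record
    { elements = concatMap (λ x → witnesses x (P? x)) (Listing.elements L)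
    ; complete = λ (x , p) → concatMap⁺ _ (Any.map (λ {y} x≈y → ∈-witnesses x≈y (P? y)) (Listing.complete L x))
    }

-- Translation of FO(Horn-Res) into LFP

translate : ∀ {σ n} → FO+Q cnfVoc σ n → Template σ n
translate (eq x y)    rs = eq (lookup rs x) (lookup rs y)
translate (atom s xs) rs = atom s (map (lookup rs) xs)
translate (not φ)     rs = not (translate φ rs)
translate (φ and ψ)   rs = translate φ rs and translate ψ rs
translate (ex φ)      rs = ex (translate φ (zero ∷ map suc rs))
translate (Q (interpretation d φδ φ≈ φS)) rs =
  HornPull.hornRes {d = d} (translate φδ) (translate φ≈) (λ s → translate (φS s)) rs

module _ {σ : Vocabulary} (𝔉 : FiniteStructure σ) where
  open FiniteLFP 𝔉
  open Equivalence

  module _ {m} (t : Template σ m) (P : Pred (Vec Universe m) 0ℓ) (ok : Realizes 𝔉 t P) where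

    realizes-variables : ∀ ρ → SatLFP 𝔄 {[]} {[]} (t (Vec.allFin m)) [] [] ρ ⇔ P ρ
    realizes-variables ρ = subst (λ ys → SatLFP 𝔄 (t (Vec.allFin m)) [] [] ρ ⇔ P ys)
      (map-lookup-allFin ρ) (ok [] [] ρ (Vec.allFin m))

    realizes-dec : Decidable P
    realizes-dec ρ = map′ (to (realizes-variables ρ)) (from (realizes-variables ρ)) (satLFP? (t (Vec.allFin m)) [] [] ρ)

    realizes-resp : P Respects Pointwise _≈_
    realizes-resp {ρ} {ρ′} ρ≈ p = to (realizes-variables ρ′)
      (satLFP-mono (t (Vec.allFin m)) {[]} {[]} {[]} {[]} (λ ()) (λ ()) ρ≈ (from (realizes-variables ρ) p))

  module _ {d n : ℕ} {tδ : Template σ (d + n)} {t≈ : Template σ ((d + d) + n)}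
           {tS : ∀ {k} → k ∈ cnfVoc → Template σ (k * d + n)}
           {Pδ : Pred (Vec Universe (d + n)) 0ℓ} {P≈ : Pred (Vec Universe ((d + d) + n)) 0ℓ}
           {PS : ∀ {k} → k ∈ cnfVoc → Pred (Vec Universe (k * d + n)) 0ℓ}
           (δ-ok : Realizes 𝔉 tδ Pδ) (≈-ok : Realizes 𝔉 t≈ P≈)
           (S-ok : ∀ {k} (s : k ∈ cnfVoc) → Realizes 𝔉 (tS s) (PS s))
           (v : Vec Universe n) where
    open HornPull {d = d} {n} tδ t≈ tS
    open HornPullCorrect 𝔉 {d} {n} {tδ} {t≈} {tS} {Pδ} {P≈} {PS} δ-ok ≈-ok S-ok v
    open PullCorrect 𝔉 {cnfVoc} {d} {n} {tδ} {t≈} {tS} {Pδ} {P≈} {PS} δ-ok ≈-ok S-ok v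

    propagation⇔ : (c : IsCongruent 𝔅) → let open CNF (ψ c) in (∀ x → C x → IsHorn (literals x)) →
                   Derivable [] ⇔ UnitPropagation.Refuted (ψ c)
    propagation⇔ c = UnitPropagation.refutable⇔ (ψ c)
      (Σ-listing (Vec-listing listing d) (λ b → realizes-dec tδ Pδ δ-ok (b ++ v))
        (λ b≈ → realizes-resp tδ Pδ δ-ok (PW.++⁺ b≈ ≋-refl))
        (λ {x} b≈ → realizes-resp t≈ P≈ ≈-ok (PW.++⁺ (PW.++⁺ (≋-refl {ρ = proj₁ x}) b≈) (≋-refl {ρ = v}))
                     (IsEquivalence.refl (IsCongruent.isEquivalence c) {x})))
      (λ x y → realizes-dec t≈ P≈ ≈-ok ((proj₁ x ++ proj₁ y) ++ v))
      (λ x y → realizes-dec (tS sP) (PS sP) (S-ok sP) (concat (map proj₁ (x ∷ y ∷ [])) ++ v))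
      (λ x y → realizes-dec (tS sN) (PS sN) (S-ok sN) (concat (map proj₁ (x ∷ y ∷ [])) ++ v))
      where sP = there (there (here refl))
            sN = there (there (there (here refl)))

    hornRes⇔ : ∀ {Δ Θ N} (δ : Allₗ (Relation 𝔄) Δ) (θ : Allₗ (Relation 𝔄) Θ) (ρ : Vec Universe N) r →
      map (lookup ρ) r ≡ v →
      SatLFP 𝔄 (hornRes r) δ θ ρ ⇔ (Σ[ c ∈ IsCongruent 𝔅 ] HornRes (record { raw = 𝔅 ; isCongruent = c }))
    hornRes⇔ δ θ ρ r r≡ = mk⇔
      (λ (p , q , s) →
        let c = to (congruent⇔ 𝔅) (to pc p)
            e , h = to (hornFormula⇔ 𝔅 c) (to ph q)
        in c , record { encodesCNF = e ; horn = h
                      ; refutable = from (propagation⇔ c h) (to (refuted⇔ c {δ = δ} {θ} {r = r} r≡) s) })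
      (λ (c , H) → let open HornRes H in
          from pc (from (congruent⇔ 𝔅) c)
        , from ph (from (hornFormula⇔ 𝔅 c) (encodesCNF , horn))
        , from (refuted⇔ c {δ = δ} {θ} {r = r} r≡) (to (propagation⇔ c horn) refutable))
      where
      pc = pull⇔ congruent {δ = δ} {θ} {b = []} {[]} r≡ refl
      ph = pull⇔ hornFormula {δ = δ} {θ} {b = []} {[]} r≡ refl

  translate⇔ : ∀ {n} (φ : FO+Q cnfVoc σ n) → Realizes 𝔉 (translate φ) (SatQ HornRes 𝔄 φ)
  translate⇔ (eq x y) δ θ ρ rs
    rewrite lookup-map x (lookup ρ) rs | lookup-map y (lookup ρ) rs = mk⇔ id id
  translate⇔ (atom s xs) δ θ ρ rs
    rewrite map-cong (λ x → lookup-map x (lookup ρ) rs) xs | sym (map-∘ (lookup ρ) (lookup rs) xs) = mk⇔ id id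
  translate⇔ (not φ) δ θ ρ rs = mk⇔ (_∘ from ih) (_∘ to ih)
    where ih = translate⇔ φ θ δ ρ rs
  translate⇔ (φ and ψ) δ θ ρ rs = mk⇔ (λ (p , q) → to ih₁ p , to ih₂ q) (λ (p , q) → from ih₁ p , from ih₂ q)
    where ih₁ = translate⇔ φ δ θ ρ rs
          ih₂ = translate⇔ ψ δ θ ρ rs
  translate⇔ (ex φ) δ θ ρ rs = mk⇔ (λ (a , p) → a , to (ih a) p) (λ (a , p) → a , from (ih a) p)
    where
    ih = λ a → subst (λ ys → SatLFP 𝔄 (translate φ (zero ∷ map suc rs)) δ θ (a ∷ ρ) ⇔ SatQ HornRes 𝔄 φ (a ∷ ys))
                 (sym (map-∘ (lookup (a ∷ ρ)) suc rs))
                 (translate⇔ φ δ θ (a ∷ ρ) (zero ∷ map suc rs))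
  translate⇔ (Q (interpretation d φδ φ≈ φS)) δ θ ρ rs =
    hornRes⇔ {d} {tδ = translate φδ} {translate φ≈} {λ s → translate (φS s)} {SatQ HornRes 𝔄 φδ} {SatQ HornRes 𝔄 φ≈} {λ s → SatQ HornRes 𝔄 (φS s)}
      (translate⇔ φδ) (translate⇔ φ≈) (λ s → translate⇔ (φS s))
      (map (lookup ρ) rs) δ θ ρ rs refl

  satQ? : ∀ {n} (φ : FO+Q cnfVoc σ n) → Decidable (SatQ HornRes 𝔄 φ)
  satQ? φ = realizes-dec (translate φ) (SatQ HornRes 𝔄 φ) (translate⇔ φ)

  module _ {n} (I : Interpretation (FO+Q cnfVoc σ) cnfVoc n) (v : Vec Universe n)
           (c : IsCongruent (interpret HornRes 𝔄 I v)) where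
    private
      ψᴵ : Structure cnfVoc
      ψᴵ = record { raw = interpret HornRes 𝔄 I v ; isCongruent = c }
    open CNF ψᴵ

    interpret-propagation⇔ : (∀ x → C x → IsHorn (literals x)) → Derivable [] ⇔ UnitPropagation.Refuted ψᴵ
    interpret-propagation⇔ = propagation⇔ {dim} {n} {translate φδ} {translate φ≈} {λ s → translate (φS s)}
      {SatQ HornRes 𝔄 φδ} {SatQ HornRes 𝔄 φ≈} {λ s → SatQ HornRes 𝔄 (φS s)}
      (translate⇔ φδ) (translate⇔ φ≈) (λ s → translate⇔ (φS s)) v c
      where open Interpretation I

-- Structures with at most one element

falsum : ∀ {σ n} → FO+Q cnfVoc σ n
falsum = ex (not (eq zero zero))

-- On structures with at most one element, lfp X φ is φ(∅).
flatten : ∀ {σ Δ Θ m n} → LFP σ Δ Θ m → Vec (Fin n) m → FO+Q cnfVoc σ n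
flatten (eq x y)    rs = eq (lookup rs x) (lookup rs y)
flatten (atom s xs) rs = atom s (map (lookup rs) xs)
flatten (var X xs)  rs = falsum
flatten (not φ)     rs = not (flatten φ rs)
flatten (φ and ψ)   rs = flatten φ rs and flatten ψ rs
flatten (ex φ)      rs = ex (flatten φ (zero ∷ map suc rs))
flatten (lfp φ xs)  rs = flatten φ (map (lookup rs) xs ++ rs)

module _ {σ : Vocabulary} (𝔉 : FiniteStructure σ) where
  open FiniteLFP 𝔉
  open Equivalence

  Void : ∀ {Δ} → Allₗ (Relation 𝔄) Δ → Set
  Void δ = ∀ {k} (X : k ∈ _) xs → ¬ ⟦ lookupAll δ {k} X ⟧ xs

  module _ (≈-all : ∀ a b → a ≈ b) where

    -- Tuples of equal length are all equal. If the body fails at the empty relation for one tuple,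
    -- it fails for all, and the empty relation is the least fixed point; if it holds, monotonicity
    -- makes it hold at `fix`, which therefore contains the tuple. So each relation variable may be
    -- read as empty, as `Void` records.
    flatten⇔ : ∀ {Δ Θ m n} (φ : LFP σ Δ Θ m) {δ θ} → Void δ → Void θ → ∀ (ρ : Vec Universe n) rs →
               SatQ HornRes 𝔄 (flatten φ rs) ρ ⇔ SatLFP 𝔄 φ δ θ (map (lookup ρ) rs)
    flatten⇔ (eq x y) δ∅ θ∅ ρ rs
      rewrite lookup-map x (lookup ρ) rs | lookup-map y (lookup ρ) rs = mk⇔ id id
    flatten⇔ (atom s xs) δ∅ θ∅ ρ rs
      rewrite map-cong (λ x → lookup-map x (lookup ρ) rs) xs | sym (map-∘ (lookup ρ) (lookup rs) xs) = mk⇔ id id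
    flatten⇔ (var X xs) δ∅ θ∅ ρ rs = mk⇔ (λ (a , a≉a) → contradiction ≈-refl a≉a) (λ p → contradiction p (δ∅ X _))
    flatten⇔ (not φ) δ∅ θ∅ ρ rs = mk⇔ (_∘ from ih) (_∘ to ih)
      where ih = flatten⇔ φ θ∅ δ∅ ρ rs
    flatten⇔ (φ and ψ) δ∅ θ∅ ρ rs = mk⇔ (λ (p , q) → to ih₁ p , to ih₂ q) (λ (p , q) → from ih₁ p , from ih₂ q)
      where ih₁ = flatten⇔ φ δ∅ θ∅ ρ rs
            ih₂ = flatten⇔ ψ δ∅ θ∅ ρ rs
    flatten⇔ (ex φ) {δ} {θ} δ∅ θ∅ ρ rs = mk⇔ (λ (a , p) → a , to (ih a) p) (λ (a , p) → a , from (ih a) p)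
      where
      ih = λ a → subst (λ ys → SatQ HornRes 𝔄 (flatten φ (zero ∷ map suc rs)) (a ∷ ρ) ⇔ SatLFP 𝔄 φ δ θ (a ∷ ys))
                   (sym (map-∘ (lookup (a ∷ ρ)) suc rs))
                   (flatten⇔ φ δ∅ θ∅ (a ∷ ρ) (zero ∷ map suc rs))
    flatten⇔ {n = n} (lfp {k = k} φ xs) {δ} {θ} δ∅ θ∅ ρ rs = mk⇔
      (λ p → fix , fix-least , fix-closed (satLFP-mono φ {empty ∷ δ} {fix ∷ δ} {θ} {θ}
                 (⊑-∷ {R = empty} {S = fix} {δ = δ} {δ′ = δ} (λ ()) (⊑-refl {δ = δ})) (⊑-refl {δ = θ}) ≋-refl (to ih p)))
      (λ (R , least , p) → from ih (fix⊆ (proj₁ (least≐fix {R} least) p)))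
      where
      v = map (lookup ρ) rs
      open Fixpoint φ δ θ v
      step : Pred (Vec Universe k) 0ℓ
      step bs = SatLFP 𝔄 φ (empty ∷ δ) θ (bs ++ v)
      ih : SatQ HornRes 𝔄 (flatten φ (map (lookup rs) xs ++ rs)) ρ ⇔ step (map (lookup v) xs)
      ih = subst (λ ys → SatQ HornRes 𝔄 (flatten φ (map (lookup rs) xs ++ rs)) ρ ⇔ SatLFP 𝔄 φ (empty ∷ δ) θ ys)
             (trans (map-++ (lookup ρ) (map (lookup rs) xs) rs)
                    (cong (_++ v) (trans (sym (map-∘ (lookup ρ) (lookup rs) xs))
                                         (map-cong (λ x → sym (lookup-map x (lookup ρ) rs)) xs))))
             (flatten⇔ φ {empty ∷ δ} {θ} (λ { (here refl) xs () ; (there X) → δ∅ X }) θ∅ ρ (map (lookup rs) xs ++ rs))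
      ≋-all : ∀ {k} (bs cs : Vec Universe k) → Pointwise _≈_ bs cs
      ≋-all [] [] = []
      ≋-all (b ∷ bs) (c ∷ cs) = ≈-all b c ∷ ≋-all bs cs
      fix⊆ : ∀ {bs} → ⟦ fix ⟧ bs → step bs
      fix⊆ {bs} p with satLFP? φ (empty ∷ δ) θ (bs ++ v)
      ... | yes q = q
      ... | no ¬q = contradiction
        (proj₂ fix-least empty ((λ ()) , λ {cs} q → contradiction
          (satLFP-mono φ {empty ∷ δ} {empty ∷ δ} {θ} {θ} (⊑-refl {δ = empty ∷ δ}) (⊑-refl {δ = θ}) (PW.++⁺ (≋-all cs bs) ≋-refl) q) ¬q) {bs} p)
        (λ ())

-- Horn programs

Ref : List ℕ → Set
Ref []       = ⊥
Ref (k ∷ ks) = Fin k ⊎ Ref ks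

-- The Boolean is the sign of the literal.
data Guard (σ : Vocabulary) (R : Set) : Set where
  equal   : Bool → R → R → Guard σ R
  related : ∀ {k} → Bool → k ∈ σ → Vec R k → Guard σ R
  initial : Bool → R → Guard σ R

Signed : Bool → Set → Set
Signed true  P = P
Signed false P = ¬ P

bySign : ∀ {A : Set} → (Bool → A) → List A
bySign f = f true ∷ f false ∷ []

∈-bySign : ∀ {A : Set} (f : Bool → A) s → f s ∈ bySign f
∈-bySign f true  = here refl
∈-bySign f false = there (here refl)

-- Facts are names applied to tuples of elements; in the body of a rule the
-- positions mapped to nothing are universally quantified.
module HornSystem (σ : Vocabulary) (Name : Set) (arity : Name → List ℕ) where

  record Rule : Set where
    constructor rule
    field
      registers : List ℕ
      guards    : List (Guard σ (Ref registers))
      head      : Maybe (Σ[ f ∈ Name ] (Ref (arity f) → Ref registers))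
      body      : List (Σ[ f ∈ Name ] (Ref (arity f) → Maybe (Ref registers)))

  module Semantics (𝔄 : Structure σ) (x₀ : Structure.Universe 𝔄) where
    open Structure 𝔄 renaming (rel to rel𝔄)
    open IsEquivalence isEquivalence using () renaming (refl to ≈-refl; sym to ≈-sym; trans to ≈-trans)

    ⟦_⟧ᵍ : ∀ {R} → Guard σ R → (R → Universe) → Set
    ⟦ equal s a b ⟧ᵍ    ρ = Signed s (ρ a ≈ ρ b)
    ⟦ related s S as ⟧ᵍ ρ = Signed s (rel𝔄 S (map ρ as))
    ⟦ initial s a ⟧ᵍ    ρ = Signed s (ρ a ≈ x₀)

    Matches : ∀ {R : Set} → Maybe R → (R → Universe) → Universe → Set
    Matches (just r) ρ a = a ≈ ρ r
    Matches nothing  ρ a = ⊤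

    Premises : (r : Rule) → (∀ f → (Ref (arity f) → Universe) → Set) → (Ref (Rule.registers r) → Universe) → Set
    Premises r Holds ρ = (∀ {g} → g ∈ Rule.guards r → ⟦ g ⟧ᵍ ρ)
      × (∀ {f pat} → (f , pat) ∈ Rule.body r → ∀ a → (∀ i → Matches (pat i) ρ (a i)) → Holds f a)

    module _ (rules : List Rule) where

      data Derivable : ∀ f → (Ref (arity f) → Universe) → Set where
        derive : ∀ {r} → r ∈ rules → ∀ {f h} → Rule.head r ≡ just (f , h) → ∀ ρ →
                 (∀ {g} → g ∈ Rule.guards r → ⟦ g ⟧ᵍ ρ) →
                 (∀ {f pat} → (f , pat) ∈ Rule.body r → ∀ a → (∀ i → Matches (pat i) ρ (a i)) → Derivable f a) →
                 ∀ {a} → (∀ i → a i ≈ ρ (h i)) → Derivable f a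

      Derivable-resp : ∀ {f a b} → (∀ i → b i ≈ a i) → Derivable f a → Derivable f b
      Derivable-resp b≈a (derive r∈ h≡ ρ gs ps a≈) = derive r∈ h≡ ρ gs ps (λ i → ≈-trans (b≈a i) (a≈ i))

-- done holds of a tuple that does not witness that a stage can still grow.
data Kind : Set where
  val mem : Bool → Kind
  done    : Kind

-- Compiling an LFP sentence into a Horn program

module Compilation {σ : Vocabulary} (root : LFPSentence σ) where

  -- Occurrences, given as paths from the root: unlike a subformula, an occurrence determines its
  -- context and the `lfp` binding each of its relation variables.
  data Sub : ∀ {Δ Θ n} → LFP σ Δ Θ n → Set where
    top   : Sub root
    not↓  : ∀ {Δ Θ n} {φ : LFP σ Θ Δ n} → Sub {Δ} {Θ} (not φ) → Sub φ
    and₁↓ : ∀ {Δ Θ n} {φ ψ : LFP σ Δ Θ n} → Sub (φ and ψ) → Sub φ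
    and₂↓ : ∀ {Δ Θ n} {φ ψ : LFP σ Δ Θ n} → Sub (φ and ψ) → Sub ψ
    ex↓   : ∀ {Δ Θ n} {φ : LFP σ Δ Θ (suc n)} → Sub (ex φ) → Sub φ
    lfp↓  : ∀ {Δ Θ n k} {φ : LFP σ (k ∷ Δ) Θ (k + n)} {xs} → Sub (lfp φ xs) → Sub φ

  -- Below lfp, the context grows by the argument tuple and by a pointer to a
  -- stage of the fixed point: a flag and a tuple that entered at this stage.
  shape : ∀ {Δ Θ n} {φ : LFP σ Δ Θ n} → Sub φ → List ℕ
  shape top       = []
  shape (not↓ p)  = shape p
  shape (and₁↓ p) = shape p
  shape (and₂↓ p) = shape p
  shape (ex↓ p)   = 1 ∷ shape p
  shape (lfp↓ {k = k} p) = k ∷ 1 ∷ k ∷ shape p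

  outer : ∀ {k l m ks} → Ref ks → Ref (k ∷ l ∷ m ∷ ks)
  outer = inj₂ ∘ inj₂ ∘ inj₂

  variable-of : ∀ {Δ Θ n} {φ : LFP σ Δ Θ n} (p : Sub φ) → Fin n → Ref (shape p)
  variable-of (not↓ p)  = variable-of p
  variable-of (and₁↓ p) = variable-of p
  variable-of (and₂↓ p) = variable-of p
  variable-of (ex↓ p) zero    = inj₁ zero
  variable-of (ex↓ p) (suc x) = inj₂ (variable-of p x)
  variable-of (lfp↓ {k = k} p) = [ inj₁ , outer ∘ variable-of p ] ∘ splitAt k

  pointer : ∀ {Δ Θ n k} {φ : LFP σ (k ∷ Δ) Θ (k + n)} {xs} → Sub (lfp φ xs) → List ℕ
  pointer {k = k} p = 1 ∷ k ∷ shape p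

  -- For a relation variable, `site` is the `lfp` that binds it, and `args` says where its pointer,
  -- followed by the context of that `lfp`, is found in the current context.
  record Binder (R : Set) (k : ℕ) : Set where
    constructor binder
    field
      {Δ Θ} : List ℕ
      {n}   : ℕ
      {φ}   : LFP σ (k ∷ Δ) Θ (k + n)
      {xs}  : Vec (Fin n) k
      site  : Sub (lfp φ xs)
      args  : Ref (pointer site) → R

  weakenBinder : ∀ {R S k} → (R → S) → Binder R k → Binder S k
  weakenBinder f (binder site args) = binder site (f ∘ args)

  mutual
    binder⁺ : ∀ {Δ Θ n} {φ : LFP σ Δ Θ n} (p : Sub φ) {k} → k ∈ Δ → Binder (Ref (shape p)) k
    binder⁺ (not↓ p)  X = binder⁻ p X
    binder⁺ (and₁↓ p) X = binder⁺ p X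
    binder⁺ (and₂↓ p) X = binder⁺ p X
    binder⁺ (ex↓ p)   X = weakenBinder inj₂ (binder⁺ p X)
    binder⁺ (lfp↓ p) (here refl) = binder p inj₂
    binder⁺ (lfp↓ p) (there X)   = weakenBinder outer (binder⁺ p X)

    binder⁻ : ∀ {Δ Θ n} {φ : LFP σ Δ Θ n} (p : Sub φ) {k} → k ∈ Θ → Binder (Ref (shape p)) k
    binder⁻ (not↓ p)  X = binder⁺ p X
    binder⁻ (and₁↓ p) X = binder⁻ p X
    binder⁻ (and₂↓ p) X = binder⁻ p X
    binder⁻ (ex↓ p)   X = weakenBinder inj₂ (binder⁻ p X)
    binder⁻ (lfp↓ p)  X = weakenBinder outer (binder⁻ p X)

  record Position : Set where
    constructor at
    field
      {Δ Θ} : List ℕ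
      {n}   : ℕ
      {φ}   : LFP σ Δ Θ n
      sub   : Sub φ

  Name : Set
  Name = Position × Kind

  arity : Name → List ℕ
  arity (at p , _) = shape p

  open HornSystem σ Name arity

  infix 6 _▹_
  _▹_ : ∀ {Δ Θ n} {φ : LFP σ Δ Θ n} → Sub φ → Kind → Name
  p ▹ κ = at p , κ

  eqRule : ∀ {Δ Θ n} {φ : LFP σ Δ Θ n} → Fin n → Fin n → Sub φ → Bool → Rule
  eqRule x y p s =
    rule (shape p) (equal s (variable-of p x) (variable-of p y) ∷ []) (just (p ▹ val s , id)) []

  atomRule : ∀ {Δ Θ n k} {φ : LFP σ Δ Θ n} → k ∈ σ → Vec (Fin n) k → Sub φ → Bool → Rule
  atomRule S xs p s =
    rule (shape p) (related s S (map (variable-of p) xs) ∷ []) (just (p ▹ val s , id)) []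

  varRule : ∀ {Δ Θ n k} {φ : LFP σ Δ Θ n} → k ∈ Δ → Vec (Fin n) k → Sub φ → Bool → Rule
  varRule X xs p s =
    rule (shape p) [] (just (p ▹ val s , id))
      ((lfp↓ site ▹ mem s , just ∘ [ variable-of p ∘ lookup xs , args ]) ∷ [])
    where open Binder (binder⁺ p X) using (site; args)

  -- A tuple that is new at a stage points to the next stage.
  nextRule : ∀ {Δ Θ n k} {φ : LFP σ (k ∷ Δ) Θ (k + n)} {xs} → Sub (lfp φ xs) → Bool → Rule
  nextRule {k = k} p s =
    -- The registers hold a tuple, the new flag, the new tuple, the old pointer and the outer
    -- context. The first tuple is in the next stage iff the body holds of it at the old stage, so
    -- the last premise has the sign of the conclusion.
    rule (k ∷ 1 ∷ shape c) (initial false (inj₂ (inj₁ zero)) ∷ [])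
      (just (c ▹ mem s , [ inj₁ , [ inj₂ ∘ inj₁ , [ inj₂ ∘ inj₂ ∘ inj₁ , inj₂ ∘ inj₂ ∘ outer ] ] ]))
      ((c ▹ val true , just ∘ inj₂ ∘ inj₂) ∷ (c ▹ mem false , just ∘ inj₂ ∘ inj₂) ∷
       (c ▹ val s , just ∘ [ inj₁ , inj₂ ∘ inj₂ ∘ inj₂ ]) ∷ [])
    where c = lfp↓ p

  rulesAt : ∀ {Δ Θ n} (φ : LFP σ Δ Θ n) → Sub φ → List Rule
  rulesAt (eq x y)    p = bySign (eqRule x y p)
  rulesAt (atom S xs) p = bySign (atomRule S xs p)
  rulesAt (var X xs)  p = bySign (varRule X xs p)
  rulesAt (not φ) p =
    rule (shape p) [] (just (p ▹ val true , id)) ((not↓ p ▹ val false , just) ∷ []) ∷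
    rule (shape p) [] (just (p ▹ val false , id)) ((not↓ p ▹ val true , just) ∷ []) ∷ []
  rulesAt (φ and ψ) p =
    rule (shape p) [] (just (p ▹ val true , id)) ((and₁↓ p ▹ val true , just) ∷ (and₂↓ p ▹ val true , just) ∷ []) ∷
    rule (shape p) [] (just (p ▹ val false , id)) ((and₁↓ p ▹ val false , just) ∷ []) ∷
    rule (shape p) [] (just (p ▹ val false , id)) ((and₂↓ p ▹ val false , just) ∷ []) ∷ []
  rulesAt (ex φ) p =
    rule (1 ∷ shape p) [] (just (p ▹ val true , inj₂)) ((ex↓ p ▹ val true , just) ∷ []) ∷
    rule (shape p) [] (just (p ▹ val false , id)) ((ex↓ p ▹ val false , [ (λ _ → nothing) , just ]) ∷ []) ∷ []
  rulesAt (lfp {k = k} φ xs) p =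
    -- Stage zero is empty, whatever tuple accompanies the initial flag.
    rule (shape c) (initial true (inj₂ (inj₁ zero)) ∷ []) (just (c ▹ mem false , id)) [] ∷
    rule (shape c) [] (just (c ▹ done , id)) ((c ▹ val false , just) ∷ []) ∷
    rule (shape c) [] (just (c ▹ done , id)) ((c ▹ mem true , just) ∷ []) ∷
    -- Any pointer will do, as every stage is contained in the least fixed point.
    rule (pointer p) [] (just (p ▹ val true , inj₂ ∘ inj₂))
      ((c ▹ mem true , just ∘ [ value , id ]) ∷ []) ∷
    -- With `done` for every tuple the denoted stage is closed, so it is the least fixed point and a
    -- tuple outside it is refuted.
    rule (pointer p) [] (just (p ▹ val false , inj₂ ∘ inj₂))
      ((c ▹ mem false , just ∘ [ value , id ]) ∷ (c ▹ done , [ (λ _ → nothing) , just ]) ∷ []) ∷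
    bySign (nextRule p)
    where
    c = lfp↓ p
    value : Fin k → Ref (pointer p)
    value i = inj₂ (inj₂ (variable-of p (lookup xs i)))

  below : ∀ {Δ Θ n} (φ : LFP σ Δ Θ n) → Sub φ → List Position
  below (eq x y)    p = at p ∷ []
  below (atom s xs) p = at p ∷ []
  below (var X xs)  p = at p ∷ []
  below (not φ)     p = at p ∷ below φ (not↓ p)
  below (φ and ψ)   p = at p ∷ below φ (and₁↓ p) ++ₗ below ψ (and₂↓ p)
  below (ex φ)      p = at p ∷ below φ (ex↓ p)
  below (lfp φ xs)  p = at p ∷ below φ (lfp↓ p)

  here-below : ∀ {Δ Θ n} (φ : LFP σ Δ Θ n) (p : Sub φ) → at p ∈ below φ p
  here-below (eq x y)    p = here refl
  here-below (atom s xs) p = here refl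
  here-below (var X xs)  p = here refl
  here-below (not φ)     p = here refl
  here-below (φ and ψ)   p = here refl
  here-below (ex φ)      p = here refl
  here-below (lfp φ xs)  p = here refl

  positions : List Position
  positions = below root top

  below⊆positions : ∀ {Δ Θ n} {φ : LFP σ Δ Θ n} (p : Sub φ) {q} → q ∈ below φ p → q ∈ positions
  below⊆positions top       = id
  below⊆positions (not↓ p)  = below⊆positions p ∘ there
  below⊆positions (and₁↓ p) = below⊆positions p ∘ there ∘ ++⁺ˡ
  below⊆positions (and₂↓ {φ = φ} p) = below⊆positions p ∘ there ∘ ++⁺ʳ (below φ (and₁↓ p))
  below⊆positions (ex↓ p)   = below⊆positions p ∘ there
  below⊆positions (lfp↓ p)  = below⊆positions p ∘ there

  ∈-positions : ∀ {Δ Θ n} {φ : LFP σ Δ Θ n} (p : Sub φ) → at p ∈ positions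
  ∈-positions {φ = φ} p = below⊆positions p (here-below φ p)

  kinds : List Kind
  kinds = done ∷ bySign val ++ₗ bySign mem

  ∈-kinds : ∀ κ → κ ∈ kinds
  ∈-kinds (val s) = there (++⁺ˡ (∈-bySign val s))
  ∈-kinds (mem s) = there (++⁺ʳ (bySign val) (∈-bySign mem s))
  ∈-kinds done    = here refl

  names : List Name
  names = cartesianProduct positions kinds

  ∈-names : ∀ f → f ∈ names
  ∈-names (at p , κ) = ∈-cartesianProduct⁺ (∈-positions p) (∈-kinds κ)

  rules : List Rule
  rules = concatMap (λ q → rulesAt _ (Position.sub q)) positions

  ∈-rules : ∀ {Δ Θ n} {φ : LFP σ Δ Θ n} (p : Sub φ) {r} → r ∈ rulesAt φ p → r ∈ rules
  ∈-rules p r∈ = concatMap⁺ (λ q → rulesAt _ (Position.sub q)) (Any.map (λ { refl → r∈ }) (∈-positions p))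

  ∈-rules⁻ : ∀ {r} → r ∈ rules → Σ[ q ∈ Position ] r ∈ rulesAt _ (Position.sub q)
  ∈-rules⁻ r∈ = Any.satisfied (concatMap⁻ (λ q → rulesAt _ (Position.sub q)) {xs = positions} r∈)

  -- A rule without head becomes a clause without positive literals; its single premise turns
  -- derivability of the root into a contradiction.
  goal : Rule
  goal = rule [] [] nothing ((top ▹ val true , just) ∷ [])

  program : List Rule
  program = goal ∷ rules

-- Stages

module _ {P : Pred ℕ 0ℓ} (P? : Decidable P) where

  -- For upward closed `P` this is the least `i` below the bound with `P i`, and the bound itself if
  -- there is none. Applied to membership in the stages, it is the stage at which a tuple enters.
  rank : ℕ → ℕ
  rank zero = zero
  rank (suc b) with P? b
  ... | yes _ = rank b
  ... | no _  = suc b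

  module _ (P-suc : ∀ i → P i → P (suc i)) where

    mono-≤ : ∀ {i j} → i ≤′ j → P i → P j
    mono-≤ ≤′-refl p = p
    mono-≤ (≤′-step {n = j} i≤j) p = P-suc j (mono-≤ i≤j p)

    rank-jump : ∀ {i} b → suc i ≤′ b → P (suc i) → ¬ P i → rank b ≡ suc i
    rank-jump zero (≤′-reflexive ())
    rank-jump (suc b) i<b p ¬p with P? b | i<b
    ... | no ¬q | ≤′-refl = refl
    ... | no ¬q | ≤′-step i<b′ = contradiction (mono-≤ i<b′ p) ¬q
    ... | yes q | ≤′-refl = contradiction q ¬p
    ... | yes q | ≤′-step i<b′ = rank-jump b i<b′ p ¬p

rank-cong : ∀ {P Q : Pred ℕ 0ℓ} (P? : Decidable P) (Q? : Decidable Q) → P ≐ Q → ∀ b → rank P? b ≡ rank Q? b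
rank-cong P? Q? P≐Q zero = refl
rank-cong P? Q? P≐Q@(P⊆Q , Q⊆P) (suc b) with P? b | Q? b
... | yes _ | yes _ = rank-cong P? Q? P≐Q b
... | no _  | no _  = refl
... | yes p | no ¬q = contradiction (P⊆Q p) ¬q
... | no ¬p | yes q = contradiction (Q⊆P q) ¬p

-- Denotations of environments and pointers

module Meanings {σ : Vocabulary} (root : LFPSentence σ) (𝔉 : FiniteStructure σ)
                (x₀ : FiniteStructure.Universe 𝔉) where
  open FiniteLFP 𝔉
  open Compilation root
  open HornSystem σ Name arity
  open Semantics 𝔄 x₀

  Env : List ℕ → Set
  Env ks = Ref ks → Universe

  infix 4 _≗ₑ_
  _≗ₑ_ : ∀ {ks} → Env ks → Env ks → Set
  ρ ≗ₑ ρ′ = ∀ i → ρ i ≈ ρ′ i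

  values : ∀ {Δ Θ n} {φ : LFP σ Δ Θ n} (p : Sub φ) → Env (shape p) → Vec Universe n
  values top       ρ = []
  values (not↓ p)  ρ = values p ρ
  values (and₁↓ p) ρ = values p ρ
  values (and₂↓ p) ρ = values p ρ
  values (ex↓ p)   ρ = ρ (inj₁ zero) ∷ values p (ρ ∘ inj₂)
  values (lfp↓ p)  ρ = tabulate (ρ ∘ inj₁) ++ values p (ρ ∘ outer)

  lookup-values : ∀ {Δ Θ n} {φ : LFP σ Δ Θ n} (p : Sub φ) ρ x →
                  lookup (values p ρ) x ≡ ρ (variable-of p x)
  lookup-values (not↓ p)  ρ x = lookup-values p ρ x
  lookup-values (and₁↓ p) ρ x = lookup-values p ρ x
  lookup-values (and₂↓ p) ρ x = lookup-values p ρ x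
  lookup-values (ex↓ p) ρ zero    = refl
  lookup-values (ex↓ p) ρ (suc x) = lookup-values p (ρ ∘ inj₂) x
  lookup-values (lfp↓ {k = k} p) ρ x = trans (lookup-splitAt k (tabulate (ρ ∘ inj₁)) (values p (ρ ∘ outer)) x)
                                             (split (splitAt k x))
    where
    split : ∀ z → [ lookup (tabulate (ρ ∘ inj₁)) , lookup (values p (ρ ∘ outer)) ] z ≡
                  ρ ([ inj₁ , outer ∘ variable-of p ] z)
    split (inj₁ i) = lookup∘tabulate (ρ ∘ inj₁) i
    split (inj₂ y) = lookup-values p (ρ ∘ outer) y

  tabulate-≈ : ∀ {k} {f g : Fin k → Universe} → (∀ i → f i ≈ g i) → Pointwise _≈_ (tabulate f) (tabulate g)
  tabulate-≈ {zero}  f≈g = []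
  tabulate-≈ {suc k} f≈g = f≈g zero ∷ tabulate-≈ (f≈g ∘ suc)

  values-resp : ∀ {Δ Θ n} {φ : LFP σ Δ Θ n} (p : Sub φ) {ρ ρ′} → ρ ≗ₑ ρ′ →
                Pointwise _≈_ (values p ρ) (values p ρ′)
  values-resp top       ρ≈ = []
  values-resp (not↓ p)  ρ≈ = values-resp p ρ≈
  values-resp (and₁↓ p) ρ≈ = values-resp p ρ≈
  values-resp (and₂↓ p) ρ≈ = values-resp p ρ≈
  values-resp (ex↓ p)   ρ≈ = ρ≈ (inj₁ zero) ∷ values-resp p (ρ≈ ∘ inj₂)
  values-resp (lfp↓ p)  ρ≈ = PW.++⁺ (tabulate-≈ (ρ≈ ∘ inj₁)) (values-resp p (ρ≈ ∘ outer))

  mutual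
    -- The operator whose stage a pointer names depends on the outer relation variables, and their
    -- values are read off from pointers further out. Hence relations and stages are defined
    -- together, along the path `p`.
    relations⁺ : ∀ {Δ Θ n} {φ : LFP σ Δ Θ n} (p : Sub φ) → Env (shape p) → Allₗ (Relation 𝔄) Δ
    relations⁺ top       ρ = []
    relations⁺ (not↓ p)  ρ = relations⁻ p ρ
    relations⁺ (and₁↓ p) ρ = relations⁺ p ρ
    relations⁺ (and₂↓ p) ρ = relations⁺ p ρ
    relations⁺ (ex↓ p)   ρ = relations⁺ p (ρ ∘ inj₂)
    relations⁺ (lfp↓ p)  ρ = stageAt p (ρ ∘ inj₂) ∷ relations⁺ p (ρ ∘ outer)

    relations⁻ : ∀ {Δ Θ n} {φ : LFP σ Δ Θ n} (p : Sub φ) → Env (shape p) → Allₗ (Relation 𝔄) Θ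
    relations⁻ top       ρ = []
    relations⁻ (not↓ p)  ρ = relations⁺ p ρ
    relations⁻ (and₁↓ p) ρ = relations⁻ p ρ
    relations⁻ (and₂↓ p) ρ = relations⁻ p ρ
    relations⁻ (ex↓ p)   ρ = relations⁻ p (ρ ∘ inj₂)
    relations⁻ (lfp↓ p)  ρ = relations⁻ p (ρ ∘ outer)

    module FixpointAt {Δ Θ n k} {φ : LFP σ (k ∷ Δ) Θ (k + n)} {xs} (p : Sub (lfp φ xs)) (ρ : Env (shape p)) =
      Fixpoint φ (relations⁺ p ρ) (relations⁻ p ρ) (values p ρ)

    -- A tuple outside the fixed point gets the last stage, so every pointer denotes
    -- a stage.
    stageNumber : ∀ {Δ Θ n k} {φ : LFP σ (k ∷ Δ) Θ (k + n)} {xs} (p : Sub (lfp φ xs)) → Env (pointer p) → ℕ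
    stageNumber p π with π (inj₁ zero) ≈? x₀
    ... | yes _ = zero
    ... | no _  = rank (λ i → ⟦⟧? (FixpointAt.stage p (π ∘ inj₂ ∘ inj₂) i) (tabulate (π ∘ inj₂ ∘ inj₁)))
                       (FixpointAt.closure p (π ∘ inj₂ ∘ inj₂))

    stageAt : ∀ {Δ Θ n k} {φ : LFP σ (k ∷ Δ) Θ (k + n)} {xs} (p : Sub (lfp φ xs)) → Env (pointer p) → Relation 𝔄 k
    stageAt p π = FixpointAt.stage p (π ∘ inj₂ ∘ inj₂) (stageNumber p π)

  mutual
    relations⁺-resp : ∀ {Δ Θ n} {φ : LFP σ Δ Θ n} (p : Sub φ) {ρ ρ′} → ρ ≗ₑ ρ′ → relations⁺ p ρ ⊑ relations⁺ p ρ′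
    relations⁺-resp (not↓ p)  ρ≈ = relations⁻-resp p ρ≈
    relations⁺-resp (and₁↓ p) ρ≈ = relations⁺-resp p ρ≈
    relations⁺-resp (and₂↓ p) ρ≈ = relations⁺-resp p ρ≈
    relations⁺-resp (ex↓ p)   ρ≈ = relations⁺-resp p (ρ≈ ∘ inj₂)
    relations⁺-resp (lfp↓ p) {ρ} {ρ′} ρ≈ =
      ⊑-∷ {R = stageAt p (ρ ∘ inj₂)} {S = stageAt p (ρ′ ∘ inj₂)}
          {δ = relations⁺ p (ρ ∘ outer)} {δ′ = relations⁺ p (ρ′ ∘ outer)}
          (stageAt-resp p (ρ≈ ∘ inj₂)) (relations⁺-resp p (ρ≈ ∘ outer))

    relations⁻-resp : ∀ {Δ Θ n} {φ : LFP σ Δ Θ n} (p : Sub φ) {ρ ρ′} → ρ ≗ₑ ρ′ → relations⁻ p ρ ⊑ relations⁻ p ρ′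
    relations⁻-resp (not↓ p)  ρ≈ = relations⁺-resp p ρ≈
    relations⁻-resp (and₁↓ p) ρ≈ = relations⁻-resp p ρ≈
    relations⁻-resp (and₂↓ p) ρ≈ = relations⁻-resp p ρ≈
    relations⁻-resp (ex↓ p)   ρ≈ = relations⁻-resp p (ρ≈ ∘ inj₂)
    relations⁻-resp (lfp↓ p)  ρ≈ = relations⁻-resp p (ρ≈ ∘ outer)

    stage-resp : ∀ {Δ Θ n k} {φ : LFP σ (k ∷ Δ) Θ (k + n)} {xs} (p : Sub (lfp φ xs)) {ρ ρ′} → ρ ≗ₑ ρ′ →
                 ∀ i → ⟦ FixpointAt.stage p ρ i ⟧ ⊆ ⟦ FixpointAt.stage p ρ′ i ⟧
    stage-resp {φ = φ} p {ρ} {ρ′} ρ≈ (suc i) =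
      I′.stage-suc⁺ i ∘
      satLFP-mono φ {I.stage i ∷ relations⁺ p ρ} {I′.stage i ∷ relations⁺ p ρ′} {relations⁻ p ρ} {relations⁻ p ρ′}
        (⊑-∷ {R = I.stage i} {S = I′.stage i} {δ = relations⁺ p ρ} {δ′ = relations⁺ p ρ′}
             (stage-resp p ρ≈ i) (relations⁺-resp p ρ≈))
        (relations⁻-resp p (≈-sym ∘ ρ≈)) (PW.++⁺ ≋-refl (values-resp p ρ≈)) ∘
      I.stage-suc⁻ i
      where
      module I  = FixpointAt p ρ
      module I′ = FixpointAt p ρ′

    stageNumber-resp : ∀ {Δ Θ n k} {φ : LFP σ (k ∷ Δ) Θ (k + n)} {xs} (p : Sub (lfp φ xs)) {π π′ : Env (pointer p)} →
                       π ≗ₑ π′ → stageNumber p π ≡ stageNumber p π′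
    stageNumber-resp p {π} {π′} π≈ with π (inj₁ zero) ≈? x₀ | π′ (inj₁ zero) ≈? x₀
    ... | yes _ | yes _ = refl
    ... | yes e | no ¬e = contradiction (≈-trans (≈-sym (π≈ (inj₁ zero))) e) ¬e
    ... | no ¬e | yes e = contradiction (≈-trans (π≈ (inj₁ zero)) e) ¬e
    ... | no _  | no _  = rank-cong
      (λ i → ⟦⟧? (I.stage i) (tabulate (π ∘ inj₂ ∘ inj₁))) (λ i → ⟦⟧? (I′.stage i) (tabulate (π′ ∘ inj₂ ∘ inj₁)))
      ( (λ {i} → resp (I′.stage i) (tabulate-≈ (π≈ ∘ inj₂ ∘ inj₁)) ∘ stage-resp p (π≈ ∘ inj₂ ∘ inj₂) i)
      , (λ {i} → resp (I.stage i) (tabulate-≈ (≈-sym ∘ π≈ ∘ inj₂ ∘ inj₁)) ∘ stage-resp p (≈-sym ∘ π≈ ∘ inj₂ ∘ inj₂) i))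
      -- The bound depends only on the arity and the listing, so it is the same for both
      -- environments.
      I.closure
      where
      module I  = FixpointAt p (π ∘ inj₂ ∘ inj₂)
      module I′ = FixpointAt p (π′ ∘ inj₂ ∘ inj₂)

    stageAt-resp : ∀ {Δ Θ n k} {φ : LFP σ (k ∷ Δ) Θ (k + n)} {xs} (p : Sub (lfp φ xs)) {π π′ : Env (pointer p)} →
                   π ≗ₑ π′ → ⟦ stageAt p π ⟧ ⊆ ⟦ stageAt p π′ ⟧
    stageAt-resp p {π} {π′} π≈ {xs} m =
      subst (λ i → ⟦ FixpointAt.stage p (π′ ∘ inj₂ ∘ inj₂) i ⟧ xs) (stageNumber-resp p π≈)
        (stage-resp p (π≈ ∘ inj₂ ∘ inj₂) (stageNumber p π) m)

  binder⁺-stage : ∀ {Δ Θ n} {φ : LFP σ Δ Θ n} (p : Sub φ) ρ {k} (X : k ∈ Δ) →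
                  lookupAll (relations⁺ p ρ) X ≡ stageAt (Binder.site (binder⁺ p X)) (ρ ∘ Binder.args (binder⁺ p X))
  binder⁻-stage : ∀ {Δ Θ n} {φ : LFP σ Δ Θ n} (p : Sub φ) ρ {k} (X : k ∈ Θ) →
                  lookupAll (relations⁻ p ρ) X ≡ stageAt (Binder.site (binder⁻ p X)) (ρ ∘ Binder.args (binder⁻ p X))
  binder⁺-stage (not↓ p)  ρ X = binder⁻-stage p ρ X
  binder⁺-stage (and₁↓ p) ρ X = binder⁺-stage p ρ X
  binder⁺-stage (and₂↓ p) ρ X = binder⁺-stage p ρ X
  binder⁺-stage (ex↓ p)   ρ X = binder⁺-stage p (ρ ∘ inj₂) X
  binder⁺-stage (lfp↓ p)  ρ (here refl) = refl
  binder⁺-stage (lfp↓ p)  ρ (there X)   = binder⁺-stage p (ρ ∘ outer) X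
  binder⁻-stage (not↓ p)  ρ X = binder⁺-stage p ρ X
  binder⁻-stage (and₁↓ p) ρ X = binder⁻-stage p ρ X
  binder⁻-stage (and₂↓ p) ρ X = binder⁻-stage p ρ X
  binder⁻-stage (ex↓ p)   ρ X = binder⁻-stage p (ρ ∘ inj₂) X
  binder⁻-stage (lfp↓ p)  ρ X = binder⁻-stage p (ρ ∘ outer) X

-- Soundness of the program

signed-map : ∀ s {P Q : Set} → (P → Q) → (Q → P) → Signed s P → Signed s Q
signed-map true  f g = f
signed-map false f g = _∘ g

∈-bySign⁻ : ∀ {A : Set} (f : Bool → A) {x} → x ∈ bySign f → Σ[ s ∈ Bool ] x ≡ f s
∈-bySign⁻ f (here refl)         = true , refl
∈-bySign⁻ f (there (here refl)) = false , refl

module Correctness {σ : Vocabulary} (root : LFPSentence σ) (𝔉 : FiniteStructure σ)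
                   (x₀ : FiniteStructure.Universe 𝔉) where
  open FiniteLFP 𝔉
  open Compilation root
  open HornSystem σ Name arity
  open Semantics 𝔄 x₀
  open Meanings root 𝔉 x₀

  True : ∀ {Δ Θ n} {φ : LFP σ Δ Θ n} (p : Sub φ) → Env (shape p) → Set
  True {φ = φ} p ρ = SatLFP 𝔄 φ (relations⁺ p ρ) (relations⁻ p ρ) (values p ρ)

  True-resp : ∀ {Δ Θ n} {φ : LFP σ Δ Θ n} (p : Sub φ) {ρ ρ′} → ρ ≗ₑ ρ′ → True p ρ → True p ρ′
  True-resp {φ = φ} p {ρ} {ρ′} ρ≈ =
    satLFP-mono φ {relations⁺ p ρ} {relations⁺ p ρ′} {relations⁻ p ρ} {relations⁻ p ρ′}
      (relations⁺-resp p ρ≈) (relations⁻-resp p (≈-sym ∘ ρ≈)) (values-resp p ρ≈)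

  -- Facts of kinds `mem` and `done` are concluded only at bodies of fixed points. At the other
  -- positions, which are also paired with these kinds in `Name`, `⊤` is a filler.
  Member : ∀ {Δ Θ n} {φ : LFP σ Δ Θ n} (p : Sub φ) → Env (shape p) → Set
  Member (lfp↓ p) ρ = ⟦ stageAt p (ρ ∘ inj₂) ⟧ (tabulate (ρ ∘ inj₁))
  Member _        ρ = ⊤

  Member-resp : ∀ {Δ Θ n} {φ : LFP σ Δ Θ n} (p : Sub φ) {ρ ρ′} → ρ ≗ₑ ρ′ → Member p ρ → Member p ρ′
  Member-resp (lfp↓ p) {ρ} {ρ′} ρ≈ =
    resp (stageAt p (ρ′ ∘ inj₂)) (tabulate-≈ (ρ≈ ∘ inj₁)) ∘ stageAt-resp p (ρ≈ ∘ inj₂)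
  Member-resp top       ρ≈ = id
  Member-resp (not↓ p)  ρ≈ = id
  Member-resp (and₁↓ p) ρ≈ = id
  Member-resp (and₂↓ p) ρ≈ = id
  Member-resp (ex↓ p)   ρ≈ = id

  Meaning : ∀ f → Env (arity f) → Set
  Meaning (at p , val s) ρ = Signed s (True p ρ)
  Meaning (at p , mem s) ρ = Signed s (Member p ρ)
  Meaning (at p , done)  ρ = ¬ True p ρ ⊎ Member p ρ

  Meaning-resp : ∀ f {ρ ρ′} → ρ ≗ₑ ρ′ → Meaning f ρ → Meaning f ρ′
  Meaning-resp (at p , val s) ρ≈ = signed-map s (True-resp p ρ≈) (True-resp p (≈-sym ∘ ρ≈))
  Meaning-resp (at p , mem s) ρ≈ = signed-map s (Member-resp p ρ≈) (Member-resp p (≈-sym ∘ ρ≈))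
  Meaning-resp (at p , done)  ρ≈ = Sum.map (_∘ True-resp p (≈-sym ∘ ρ≈)) (Member-resp p ρ≈)

  map-values : ∀ {Δ Θ n} {φ : LFP σ Δ Θ n} (p : Sub φ) ρ {k} (xs : Vec (Fin n) k) →
               map (lookup (values p ρ)) xs ≡ map ρ (map (variable-of p) xs)
  map-values p ρ xs = trans (map-cong (lookup-values p ρ) xs) (map-∘ ρ (variable-of p) xs)

  tabulate-values : ∀ {Δ Θ n} {φ : LFP σ Δ Θ n} (p : Sub φ) ρ {k} (xs : Vec (Fin n) k) →
                    tabulate (ρ ∘ variable-of p ∘ lookup xs) ≡ map (lookup (values p ρ)) xs
  tabulate-values p ρ xs = trans (tabulate-∘ (ρ ∘ variable-of p) (lookup xs))
    (trans (cong (map (ρ ∘ variable-of p)) (tabulate∘lookup xs)) (sym (map-cong (lookup-values p ρ) xs)))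

  module _ {Δ Θ n k} {φ : LFP σ (k ∷ Δ) Θ (k + n)} {xs} (p : Sub (lfp φ xs)) where

    initial-stage : (π : Env (pointer p)) → π (inj₁ zero) ≈ x₀ → stageNumber p π ≡ 0
    initial-stage π f≈x₀ with π (inj₁ zero) ≈? x₀
    ... | yes _ = refl
    ... | no f≉x₀ = contradiction f≈x₀ f≉x₀

    module _ (π : Env (pointer p)) where
      open FixpointAt p (π ∘ inj₂ ∘ inj₂)

      -- The stage at which a tuple enters is unique, so the pointer built by `nextRule` denotes the
      -- successor of the old stage, whichever derivation produced it.
      next-stage : ¬ (π (inj₁ zero) ≈ x₀) → ∀ i →
                   ⟦ stage (suc i) ⟧ (tabulate (π ∘ inj₂ ∘ inj₁)) → ¬ ⟦ stage i ⟧ (tabulate (π ∘ inj₂ ∘ inj₁)) →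
                   stageNumber p π ≡ suc i
      next-stage f≉x₀ i x∈ x∉ with π (inj₁ zero) ≈? x₀
      ... | yes f≈x₀ = contradiction f≈x₀ f≉x₀
      ... | no _ = rank-jump (λ i → ⟦⟧? (stage i) x) step closure (ℕₚ.≤⇒≤′ i<closure) x∈ x∉
        where
        x = tabulate (π ∘ inj₂ ∘ inj₁)
        step : ∀ i → ⟦ stage i ⟧ x → ⟦ stage (suc i) ⟧ x
        step i = stage-step i
        -- Otherwise the tuple, being in the fixed point, would be in stage `closure` and hence
        -- already in stage `i`.
        i<closure : suc i ≤ closure
        i<closure with suc i ℕₚ.≤? closure
        ... | yes i<c = i<c
        ... | no i≮c = contradiction
          (mono-≤ (λ i → ⟦⟧? (stage i) x) step (ℕₚ.≤⇒≤′ (ℕₚ.≮⇒≥ i≮c)) (stage⊆fix (suc i) x∈)) x∉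

  Sound : Rule → Set
  Sound r = ∀ {f h} → Rule.head r ≡ just (f , h) → ∀ ρ → Premises r Meaning ρ → Meaning f (ρ ∘ h)

  rulesAt-sound : ∀ {Δ Θ n} (φ : LFP σ Δ Θ n) (p : Sub φ) {r} → r ∈ rulesAt φ p → Sound r
  rulesAt-sound (eq x y) p r∈ h≡ ρ (gs , _) with ∈-bySign⁻ (eqRule x y p) r∈ | h≡
  ... | s , refl | refl rewrite lookup-values p ρ x | lookup-values p ρ y = gs (here refl)
  rulesAt-sound (atom S xs) p r∈ h≡ ρ (gs , _) with ∈-bySign⁻ (atomRule S xs p) r∈ | h≡
  ... | s , refl | refl = subst (Signed s ∘ rel S) (sym (map-values p ρ xs)) (gs (here refl))
  rulesAt-sound (var X xs) p r∈ h≡ ρ (_ , ps) with ∈-bySign⁻ (varRule X xs p) r∈ | h≡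
  ... | s , refl | refl = subst₂ (λ R ys → Signed s (⟦ R ⟧ ys))
    (sym (binder⁺-stage p ρ X)) (tabulate-values p ρ xs) (ps (here refl) _ (λ i → ≈-refl))
  rulesAt-sound (not φ) p (here refl) refl ρ (_ , ps) = ps (here refl) ρ (λ i → ≈-refl)
  rulesAt-sound (not φ) p (there (here refl)) refl ρ (_ , ps) ¬q = ¬q (ps (here refl) ρ (λ i → ≈-refl))
  rulesAt-sound (φ and ψ) p (here refl) refl ρ (_ , ps) =
    ps (here refl) ρ (λ i → ≈-refl) , ps (there (here refl)) ρ (λ i → ≈-refl)
  rulesAt-sound (φ and ψ) p (there (here refl)) refl ρ (_ , ps) (q , _) = ps (here refl) ρ (λ i → ≈-refl) q
  rulesAt-sound (φ and ψ) p (there (there (here refl))) refl ρ (_ , ps) (_ , q) = ps (here refl) ρ (λ i → ≈-refl) q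
  rulesAt-sound (ex φ) p (here refl) refl ρ (_ , ps) = ρ (inj₁ zero) , ps (here refl) ρ (λ i → ≈-refl)
  rulesAt-sound (ex φ) p (there (here refl)) refl ρ (_ , ps) (a , q) =
    ps (here refl) [ (λ _ → a) , ρ ] (λ { (inj₁ _) → tt ; (inj₂ i) → ≈-refl }) q
  rulesAt-sound (lfp φ xs) p (here refl) refl ρ (gs , _) m =
    subst (λ i → ⟦ FixpointAt.stage p (ρ ∘ outer) i ⟧ (tabulate (ρ ∘ inj₁))) (initial-stage p (ρ ∘ inj₂) (gs (here refl))) m
  rulesAt-sound (lfp φ xs) p (there (here refl)) refl ρ (_ , ps) = inj₁ (ps (here refl) ρ (λ i → ≈-refl))
  rulesAt-sound (lfp φ xs) p (there (there (here refl))) refl ρ (_ , ps) = inj₂ (ps (here refl) ρ (λ i → ≈-refl))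
  rulesAt-sound (lfp φ xs) p (there (there (there (here refl)))) refl ρ (_ , ps) =
    fix , fix-least , subst ⟦ fix ⟧ (tabulate-values p (ρ ∘ inj₂ ∘ inj₂) xs)
                        (stage⊆fix (stageNumber p ρ) (ps (here refl) _ (λ i → ≈-refl)))
    where open FixpointAt p (ρ ∘ inj₂ ∘ inj₂)
  rulesAt-sound (lfp φ xs) p (there (there (there (there (here refl))))) refl ρ (_ , ps) (R , (_ , least) , m) =
    ps (here refl) _ (λ i → ≈-refl)
      (least (stageAt p ρ) (closed-fixed (stageNumber p ρ) closed)
        (subst ⟦ R ⟧ (sym (tabulate-values p (ρ ∘ inj₂ ∘ inj₂) xs)) m))
    where
    open FixpointAt p (ρ ∘ inj₂ ∘ inj₂)
    closed : ∀ {bs} → SatLFP 𝔄 φ (stageAt p ρ ∷ relations⁺ p (ρ ∘ inj₂ ∘ inj₂)) (relations⁻ p (ρ ∘ inj₂ ∘ inj₂))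
                        (bs ++ values p (ρ ∘ inj₂ ∘ inj₂)) → ⟦ stageAt p ρ ⟧ bs
    closed {bs} q rewrite sym (tabulate∘lookup bs)
      with ps (there (here refl)) [ lookup bs , ρ ] (λ { (inj₁ _) → tt ; (inj₂ i) → ≈-refl })
    ... | inj₁ ¬q = contradiction q ¬q
    ... | inj₂ m  = m
  rulesAt-sound (lfp φ xs) p (there (there (there (there (there r∈))))) h≡ ρ (gs , ps) with ∈-bySign⁻ (nextRule p) r∈ | h≡
  ... | s , refl | refl =
    subst (λ i → Signed s (⟦ stage i ⟧ (tabulate (ρ ∘ inj₁))))
      -- The first two premises put the new tuple into the stage after `i` and outside stage `i`,
      -- which fixes the denotation of the new pointer.
      (sym (next-stage p (ρ ∘ [ inj₂ ∘ inj₁ , [ inj₂ ∘ inj₂ ∘ inj₁ , inj₂ ∘ inj₂ ∘ outer ] ])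
              (gs (here refl)) i
              (stage-suc⁺ i (ps (here refl) _ (λ i → ≈-refl)))
              (ps (there (here refl)) _ (λ i → ≈-refl))))
      (signed-map s (stage-suc⁺ i) (stage-suc⁻ i) (ps (there (there (here refl))) _ (λ i → ≈-refl)))
    where
    open FixpointAt p (ρ ∘ inj₂ ∘ inj₂ ∘ outer)
    i = stageNumber p (ρ ∘ inj₂ ∘ inj₂ ∘ inj₂)

  sound : ∀ {f a} → Derivable program f a → Meaning f a
  sound (derive (here refl) () _ _ _ _)
  sound {f} (derive {r} (there r∈) h≡ ρ gs ps a≈) with ∈-rules⁻ r∈
  ... | at p , r∈p = Meaning-resp f (≈-sym ∘ a≈)
    (rulesAt-sound _ p r∈p h≡ ρ (gs , λ b∈ a m → sound (ps b∈ a m)))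

-- Completeness of the program

module Completeness {σ : Vocabulary} (root : LFPSentence σ) (𝔉 : FiniteStructure σ)
                    (x₀ y₀ : FiniteStructure.Universe 𝔉)
                    (y₀≉x₀ : ¬ FiniteStructure._≈_ 𝔉 y₀ x₀) where
  open FiniteLFP 𝔉
  open Compilation root
  open HornSystem σ Name arity
  open Semantics 𝔄 x₀
  open Meanings root 𝔉 x₀
  open Correctness root 𝔉 x₀

  Derived : ∀ f → Env (arity f) → Set
  Derived = Derivable program

  Members : ∀ {Δ Θ n k} {φ : LFP σ (k ∷ Δ) Θ (k + n)} {xs} (p : Sub (lfp φ xs)) → Env (pointer p) → Set
  Members p π = ∀ s u → Signed s (⟦ stageAt p π ⟧ (tabulate u)) → Derived (lfp↓ p ▹ mem s) [ u , π ]

  -- Completeness fails at arbitrary environments: a pointer with non-initial flag to a tuple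
  -- outside the fixed point denotes a stage by convention, but no membership fact about it is
  -- derivable. So every enclosing pointer is required to have all its membership and non-membership
  -- facts derived.
  Available : ∀ {Δ Θ n} {φ : LFP σ Δ Θ n} (p : Sub φ) → Env (shape p) → Set
  Available top       ρ = ⊤
  Available (not↓ p)  ρ = Available p ρ
  Available (and₁↓ p) ρ = Available p ρ
  Available (and₂↓ p) ρ = Available p ρ
  Available (ex↓ p)   ρ = Available p (ρ ∘ inj₂)
  Available (lfp↓ p)  ρ = Members p (ρ ∘ inj₂) × Available p (ρ ∘ outer)

  available⁺ : ∀ {Δ Θ n} {φ : LFP σ Δ Θ n} (p : Sub φ) ρ → Available p ρ → ∀ {k} (X : k ∈ Δ) →
               Members (Binder.site (binder⁺ p X)) (ρ ∘ Binder.args (binder⁺ p X))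
  available⁻ : ∀ {Δ Θ n} {φ : LFP σ Δ Θ n} (p : Sub φ) ρ → Available p ρ → ∀ {k} (X : k ∈ Θ) →
               Members (Binder.site (binder⁻ p X)) (ρ ∘ Binder.args (binder⁻ p X))
  available⁺ (not↓ p)  ρ av X = available⁻ p ρ av X
  available⁺ (and₁↓ p) ρ av X = available⁺ p ρ av X
  available⁺ (and₂↓ p) ρ av X = available⁺ p ρ av X
  available⁺ (ex↓ p)   ρ av X = available⁺ p (ρ ∘ inj₂) av X
  available⁺ (lfp↓ p)  ρ (m , av) (here refl) = m
  available⁺ (lfp↓ p)  ρ (m , av) (there X)   = available⁺ p (ρ ∘ outer) av X
  available⁻ (not↓ p)  ρ av X = available⁺ p ρ av X
  available⁻ (and₁↓ p) ρ av X = available⁻ p ρ av X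
  available⁻ (and₂↓ p) ρ av X = available⁻ p ρ av X
  available⁻ (ex↓ p)   ρ av X = available⁻ p (ρ ∘ inj₂) av X
  available⁻ (lfp↓ p)  ρ (m , av) X = available⁻ p (ρ ∘ outer) av X

  ≗ₑ-refl : ∀ {ks} {ρ : Env ks} → ρ ≗ₑ ρ
  ≗ₑ-refl i = ≈-refl

  ⊎-≗ₑ : ∀ {k ks} {ρ ρ′ : Env (k ∷ ks)} → (∀ i → ρ (inj₁ i) ≈ ρ′ (inj₁ i)) → (ρ ∘ inj₂) ≗ₑ (ρ′ ∘ inj₂) → ρ ≗ₑ ρ′
  ⊎-≗ₑ f g (inj₁ i) = f i
  ⊎-≗ₑ f g (inj₂ i) = g i

  fire : ∀ {Δ Θ n} {φ : LFP σ Δ Θ n} (p : Sub φ) {r} → r ∈ rulesAt φ p →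
         ∀ {f h} → Rule.head r ≡ just (f , h) → ∀ ρ → Premises r Derived ρ →
         ∀ {a} → a ≗ₑ (ρ ∘ h) → Derived f a
  fire p r∈ h≡ ρ (gs , ps) = derive (there (∈-rules p r∈)) h≡ ρ gs ps

  -- Structural induction with the environment general: the `lfp` case evaluates its body again at
  -- each stage of the walk, under a new pointer whose facts were derived in the step before.
  complete : ∀ {Δ Θ n} (φ : LFP σ Δ Θ n) (p : Sub φ) ρ → Available p ρ →
             ∀ s → Signed s (True p ρ) → Derived (p ▹ val s) ρ
  complete (eq x y) p ρ av s t = fire p (∈-bySign (eqRule x y p) s) refl ρ
    ((λ { (here refl) → subst₂ (λ a b → Signed s (a ≈ b)) (lookup-values p ρ x) (lookup-values p ρ y) t }) , λ ()) ≗ₑ-refl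
  complete (atom S xs) p ρ av s t = fire p (∈-bySign (atomRule S xs p) s) refl ρ
    ((λ { (here refl) → subst (Signed s ∘ rel S) (map-values p ρ xs) t }) , λ ()) ≗ₑ-refl
  complete (var X xs) p ρ av s t = fire p (∈-bySign (varRule X xs p) s) refl ρ
    ((λ ()) , λ { (here refl) a a≈ → Derivable-resp program (⊎-≗ₑ (a≈ ∘ inj₁) (a≈ ∘ inj₂))
      (available⁺ p ρ av X s (ρ ∘ variable-of p ∘ lookup xs)
        (subst₂ (λ R ys → Signed s (⟦ R ⟧ ys)) (binder⁺-stage p ρ X) (sym (tabulate-values p ρ xs)) t)) }) ≗ₑ-refl
  complete (not φ) p ρ av true t = fire p (here refl) refl ρ
    ((λ ()) , λ { (here refl) a a≈ → Derivable-resp program a≈ (complete φ (not↓ p) ρ av false t) }) ≗ₑ-refl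
  complete (not φ) p ρ av false t = fire p (there (here refl)) refl ρ
    ((λ ()) , λ { (here refl) a a≈ → Derivable-resp program a≈ (complete φ (not↓ p) ρ av true
      (decidable-stable (satLFP? φ (relations⁻ p ρ) (relations⁺ p ρ) (values p ρ)) t)) }) ≗ₑ-refl
  complete (φ and ψ) p ρ av true (t , u) = fire p (here refl) refl ρ
    ((λ ()) , λ { (here refl) a a≈ → Derivable-resp program a≈ (complete φ (and₁↓ p) ρ av true t)
                ; (there (here refl)) a a≈ → Derivable-resp program a≈ (complete ψ (and₂↓ p) ρ av true u) }) ≗ₑ-refl
  complete (φ and ψ) p ρ av false t with satLFP? φ (relations⁺ p ρ) (relations⁻ p ρ) (values p ρ)
  ... | no ¬q = fire p (there (here refl)) refl ρ
    ((λ ()) , λ { (here refl) a a≈ → Derivable-resp program a≈ (complete φ (and₁↓ p) ρ av false ¬q) }) ≗ₑ-refl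
  ... | yes q = fire p (there (there (here refl))) refl ρ
    ((λ ()) , λ { (here refl) a a≈ → Derivable-resp program a≈ (complete ψ (and₂↓ p) ρ av false (t ∘ (q ,_))) }) ≗ₑ-refl
  complete (ex φ) p ρ av true (a , t) = fire p (here refl) refl [ (λ _ → a) , ρ ]
    ((λ ()) , λ { (here refl) b b≈ → Derivable-resp program b≈ (complete φ (ex↓ p) [ (λ _ → a) , ρ ] av true t) }) ≗ₑ-refl
  complete (ex φ) p ρ av false t = fire p (there (here refl)) refl ρ
    ((λ ()) , λ { (here refl) b b≈ → Derivable-resp program (⊎-≗ₑ (λ _ → ≈-refl) (b≈ ∘ inj₂))
      (complete φ (ex↓ p) [ b ∘ inj₁ , ρ ] av false (λ q → t (b (inj₁ zero) , q))) }) ≗ₑ-refl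
  complete (lfp {k = k} φ xs) p ρ av = conclude
    where
    open FixpointAt p ρ
    c = lfp↓ p

    pointTo : Universe → (Fin k → Universe) → Env (pointer p)
    pointTo f z = [ (λ _ → f) , [ z , ρ ] ]

    Closed : Relation 𝔄 k → Set
    Closed S = ∀ {bs} → SatLFP 𝔄 φ (S ∷ relations⁺ p ρ) (relations⁻ p ρ) (bs ++ values p ρ) → ⟦ S ⟧ bs

    -- A closed stage admits no new tuple, hence no pointer to a later stage. The walk then stays
    -- where it is, so it reaches either stage `i` itself or an earlier closed stage.
    record Reached (i : ℕ) : Set where
      field
        flag    : Universe
        newest  : Fin k → Universe
      π : Env (pointer p)
      π = pointTo flag newest
      field
        members : Members p π
        upToDate : Closed (stageAt p π) ⊎ stageNumber p π ≡ i

      completeAt : ∀ u s → Signed s (True c [ u , π ]) → Derived (c ▹ val s) [ u , π ]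
      completeAt u = complete φ c [ u , π ] (members , av)

    initially : Reached 0
    initially = record
      -- The flag alone selects the empty stage; the tuple beside it is arbitrary.
      { flag = x₀ ; newest = λ _ → x₀
      ; members = members
      ; upToDate = inj₂ (initial-stage p π ≈-refl) }
      where
      π = pointTo x₀ (λ _ → x₀)
      members : Members p π
      members false u t = fire p (here refl) refl [ u , π ] ((λ { (here refl) → ≈-refl }) , λ ()) ≗ₑ-refl
      members true  u t rewrite initial-stage p π ≈-refl = ⊥-elim t

    advance : ∀ {i} (R : Reached i) → let j = stageNumber p (Reached.π R) in
              j ≡ i → ∀ x → ⟦ stage (suc j) ⟧ x → ¬ ⟦ stage j ⟧ x → Reached (suc i)
    advance R j≡i x x∈ x∉ = record
      -- A flag different from `x₀` makes the tuple count, so the pointer denotes the stage at which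
      -- `x` enters.
      { flag = y₀ ; newest = lookup x
      ; members = λ s u t → fire p (there (there (there (there (there (∈-bySign (nextRule p) s)))))) refl
          [ u , [ (λ _ → y₀) , [ lookup x , π ] ] ]
          ( (λ { (here refl) → y₀≉x₀ })
          , λ { (here refl) a a≈ → Derivable-resp program (⊎-≗ₑ (a≈ ∘ inj₁) (a≈ ∘ inj₂))
                  (completeAt (lookup x) true (stage-suc⁻ j x∈′))
              ; (there (here refl)) a a≈ → Derivable-resp program (⊎-≗ₑ (a≈ ∘ inj₁) (a≈ ∘ inj₂))
                  (members false (lookup x) x∉′)
              ; (there (there (here refl))) a a≈ → Derivable-resp program (⊎-≗ₑ (a≈ ∘ inj₁) (a≈ ∘ inj₂))
                  (completeAt u s (signed-map s (stage-suc⁻ j) (stage-suc⁺ j)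
                    (subst (λ l → Signed s (⟦ stage l ⟧ (tabulate u))) number≡ t))) })
          (⊎-≗ₑ (λ _ → ≈-refl) (⊎-≗ₑ (λ _ → ≈-refl) (⊎-≗ₑ (λ _ → ≈-refl) ≗ₑ-refl)))
      ; upToDate = inj₂ (trans number≡ (cong suc j≡i)) }
      where
      open Reached R
      j = stageNumber p π
      x∈′ : ⟦ stage (suc j) ⟧ (tabulate (lookup x))
      x∈′ = subst ⟦ stage (suc j) ⟧ (sym (tabulate∘lookup x)) x∈
      x∉′ : ¬ ⟦ stage j ⟧ (tabulate (lookup x))
      x∉′ = x∉ ∘ subst ⟦ stage j ⟧ (tabulate∘lookup x)
      number≡ : stageNumber p (pointTo y₀ (lookup x)) ≡ suc j
      number≡ = next-stage p (pointTo y₀ (lookup x)) y₀≉x₀ j x∈′ x∉′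

    reach : ∀ i → Reached i
    reach zero = initially
    reach (suc i) with reach i
    ... | R with Reached.upToDate R
    ...   | inj₁ closed = record { Reached R using (flag; newest; members) ; upToDate = inj₁ closed }
    ...   | inj₂ j≡i with new? (stageNumber p (Reached.π R))
    ...     | no ¬new = record { Reached R using (flag; newest; members)
                               ; upToDate = inj₁ (no-new {stageNumber p (Reached.π R)} ¬new) }
    ...     | yes (x , x∈ , x∉) = advance R j≡i x x∈ x∉

    open Reached (reach closure)

    number : ℕ
    number = stageNumber p π

    closed : Closed (stage number)
    closed with upToDate
    ... | inj₁ c  = c
    -- The walk has made all `closure` steps, so it ended at `fix`.
    ... | inj₂ j≡ = subst (Closed ∘ stage) (sym j≡) fix-closed

    doneAt : ∀ u → Derived (c ▹ done) [ u , π ]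
    doneAt u with ⟦⟧? (stage number) (tabulate u)
    ... | yes m = fire p (there (there (here refl))) refl [ u , π ]
      ((λ ()) , λ { (here refl) a a≈ → Derivable-resp program a≈ (members true u m) }) ≗ₑ-refl
    ... | no ¬m = fire p (there (here refl)) refl [ u , π ]
      ((λ ()) , λ { (here refl) a a≈ → Derivable-resp program a≈ (completeAt u false (¬m ∘ closed)) }) ≗ₑ-refl

    conclude : ∀ s → Signed s (True p ρ) → Derived (p ▹ val s) ρ
    conclude true (S , (_ , least) , m) = fire p (there (there (there (here refl)))) refl π
      ((λ ()) , λ { (here refl) a a≈ → Derivable-resp program (⊎-≗ₑ (a≈ ∘ inj₁) (a≈ ∘ inj₂))
        (members true (ρ ∘ variable-of p ∘ lookup xs)
          (least (stage number) (closed-fixed number closed) (subst ⟦ S ⟧ (sym (tabulate-values p ρ xs)) m))) }) ≗ₑ-refl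
    conclude false t = fire p (there (there (there (there (here refl))))) refl π
      ((λ ()) , λ { (here refl) a a≈ → Derivable-resp program (⊎-≗ₑ (a≈ ∘ inj₁) (a≈ ∘ inj₂))
                      (members false (ρ ∘ variable-of p ∘ lookup xs)
                        (λ m → t (fix , fix-least , subst ⟦ fix ⟧ (tabulate-values p ρ xs) (stage⊆fix number m))))
                  ; (there (here refl)) a a≈ → Derivable-resp program (⊎-≗ₑ (λ _ → ≈-refl) (a≈ ∘ inj₂)) (doneAt (a ∘ inj₁)) }) ≗ₑ-refl

  derivable⇔ : Derived (top ▹ val true) (λ ()) ⇔ 𝔄 ⊨LFP root
  derivable⇔ = mk⇔ (λ d → sound d) (complete root top (λ ()) tt true)

-- Encoding a program by a Horn formula

⋀ : ∀ {σ n} {A : Set} → List A → (A → FO+Q cnfVoc σ n) → FO+Q cnfVoc σ n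
⋀ []       f = not falsum
⋀ (a ∷ as) f = f a and ⋀ as f

⋁ : ∀ {σ n} {A : Set} → List A → (A → FO+Q cnfVoc σ n) → FO+Q cnfVoc σ n
⋁ as f = not (⋀ as (not ∘ f))

signed : ∀ {σ n} → Bool → FO+Q cnfVoc σ n → FO+Q cnfVoc σ n
signed true  φ = φ
signed false φ = not φ

slot : ∀ ks → Ref ks → ℕ
slot (k ∷ ks) (inj₁ i) = toℕ i
slot (k ∷ ks) (inj₂ r) = k + slot ks r

slot< : ∀ ks r → slot ks r < sum ks
slot< (k ∷ ks) (inj₁ i) = ℕₚ.<-≤-trans (toℕ<n i) (ℕₚ.m≤m+n k (sum ks))
slot< (k ∷ ks) (inj₂ r) = ℕₚ.+-monoʳ-< k (slot< ks r)

unslot : ∀ ks → ℕ → Maybe (Ref ks)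
unslot []       n = nothing
unslot (k ∷ ks) n with n <? k
... | yes n<k = just (inj₁ (fromℕ< n<k))
... | no _    = Maybe.map inj₂ (unslot ks (n ∸ k))

unslot-slot : ∀ ks r → unslot ks (slot ks r) ≡ just r
unslot-slot (k ∷ ks) (inj₁ i) with toℕ i <? k
... | yes i<k = cong (just ∘ inj₁) (fromℕ<-toℕ i i<k)
... | no i≮k  = contradiction (toℕ<n i) i≮k
unslot-slot (k ∷ ks) (inj₂ r) with k + slot ks r <? k
... | yes <k = contradiction <k (ℕₚ.≤⇒≯ (ℕₚ.m≤m+n k (slot ks r)))
... | no _ rewrite ℕₚ.m+n∸m≡n k (slot ks r) | unslot-slot ks r = refl

slot-unslot : ∀ ks n {r} → unslot ks n ≡ just r → slot ks r ≡ n
slot-unslot (k ∷ ks) n e with n <? k | e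
... | yes n<k | refl = toℕ-fromℕ< n<k
... | no n≮k  | e′ with unslot ks (n ∸ k) in e″ | e′
...   | just r | refl = trans (cong (k +_) (slot-unslot ks (n ∸ k) e″)) (ℕₚ.m+[n∸m]≡n (ℕₚ.≮⇒≥ n≮k))

∈⇒≤sum : ∀ {A : Set} (f : A → ℕ) {x xs} → x ∈ xs → f x ≤ sum (mapₗ f xs)
∈⇒≤sum f {xs = x ∷ xs} (here refl) = ℕₚ.m≤m+n (f x) _
∈⇒≤sum f {xs = x ∷ xs} (there x∈)  = ℕₚ.m≤n⇒m≤o+n (f x) (∈⇒≤sum f x∈)

module _ {σ : Vocabulary} (𝔉 : FiniteStructure σ) where
  open FiniteLFP 𝔉

  private
    Sat : ∀ {n} → FO+Q cnfVoc σ n → Vec Universe n → Set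
    Sat = SatQ HornRes 𝔄

  module _ {n} {A : Set} {f : A → FO+Q cnfVoc σ n} {ρ : Vec Universe n} where

    ⋀⁻ : ∀ as → Sat (⋀ as f) ρ → ∀ {a} → a ∈ as → Sat (f a) ρ
    ⋀⁻ (a ∷ as) (p , ps) (here refl) = p
    ⋀⁻ (a ∷ as) (p , ps) (there a∈)  = ⋀⁻ as ps a∈

    ⋀⁺ : ∀ as → (∀ {a} → a ∈ as → Sat (f a) ρ) → Sat (⋀ as f) ρ
    ⋀⁺ []       ps = λ (a , a≉a) → a≉a ≈-refl
    ⋀⁺ (a ∷ as) ps = ps (here refl) , ⋀⁺ as (ps ∘ there)

  module _ {n} {A : Set} {f : A → FO+Q cnfVoc σ n} {ρ : Vec Universe n} where

    ⋁⁺ : ∀ as {a} → a ∈ as → Sat (f a) ρ → Sat (⋁ as f) ρ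
    ⋁⁺ as a∈ p ¬ps = ⋀⁻ as ¬ps a∈ p

    -- Disjunction is a negated conjunction, so finding a true disjunct takes decidability of
    -- satisfaction. For formulas with the Horn quantifier this comes from their translation into
    -- LFP.
    ⋁⁻ : ∀ as → Sat (⋁ as f) ρ → Σ[ a ∈ A ] (a ∈ as × Sat (f a) ρ)
    ⋁⁻ as p with any? (λ a → satQ? 𝔉 (f a) ρ) as
    ... | yes q = find q
    ... | no ¬q = contradiction (⋀⁺ as (λ a∈ q → ¬q (lose a∈ q))) p

  module _ {n} {A : Set} {f : A → FO+Q cnfVoc σ n} {ρ : Vec Universe n} {P : A → Set} (f⇔ : ∀ a → Sat (f a) ρ ⇔ P a) where
    open Equivalence

    ⋀⇔ : ∀ as → Sat (⋀ as f) ρ ⇔ (∀ {a} → a ∈ as → P a)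
    ⋀⇔ as = mk⇔ (λ p {a} a∈ → to (f⇔ a) (⋀⁻ as p a∈)) (λ p → ⋀⁺ as (λ {a} a∈ → from (f⇔ a) (p a∈)))

    ⋁⇔ : ∀ as → Sat (⋁ as f) ρ ⇔ (Σ[ a ∈ A ] (a ∈ as × P a))
    ⋁⇔ as = mk⇔ (λ p → let a , a∈ , q = ⋁⁻ as p in a , a∈ , to (f⇔ a) q)
                (λ (a , a∈ , q) → ⋁⁺ as a∈ (from (f⇔ a) q))

  module _ {n k} {f : Fin k → FO+Q cnfVoc σ n} {ρ : Vec Universe n} {P : Fin k → Set} (f⇔ : ∀ i → Sat (f i) ρ ⇔ P i) where
    open Equivalence

    ⋀Fin⇔ : Sat (⋀ (allFin k) f) ρ ⇔ (∀ i → P i)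
    ⋀Fin⇔ = mk⇔ (λ p i → to (⋀⇔ f⇔ (allFin k)) p (∈-allFin i)) (λ p → from (⋀⇔ f⇔ (allFin k)) (λ {i} _ → p i))

    ⋁Fin⇔ : Sat (⋁ (allFin k) f) ρ ⇔ (Σ[ i ∈ Fin k ] P i)
    ⋁Fin⇔ = mk⇔ (λ p → let i , _ , q = to (⋁⇔ f⇔ (allFin k)) p in i , q)
                (λ (i , q) → from (⋁⇔ f⇔ (allFin k)) (i , ∈-allFin i , q))

  signed⇔ : ∀ {n} s {φ : FO+Q cnfVoc σ n} {ρ} {P : Set} → Sat φ ρ ⇔ P → Sat (signed s φ) ρ ⇔ Signed s P
  signed⇔ true  φ⇔ = φ⇔
  signed⇔ false φ⇔ = mk⇔ (_∘ Equivalence.from φ⇔) (_∘ Equivalence.to φ⇔)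

module Encoding {σ : Vocabulary} {Name : Set} {arity : Name → List ℕ} {names : List Name}
                (∈-names : ∀ f → f ∈ names) (rules : List (HornSystem.Rule σ Name arity)) where
  open HornSystem σ Name arity
  open Rule

  -- An element is a one-hot code of a name or a rule followed by slots. The slots must suffice for
  -- every arity and every list of registers; a sum is a convenient common bound.
  #names #rules codeLength payload dim : ℕ
  #names = length names
  #rules = length rules
  codeLength = #names + #rules
  payload = sum (mapₗ (sum ∘ arity) names) + sum (mapₗ (sum ∘ registers) rules)
  dim = codeLength + payload

  ruleNo : Fin #rules → Rule
  ruleNo = Data.List.lookup rules

  nameCode : Name → Fin codeLength
  nameCode f = Any.index (∈-names f) ↑ˡ #rules

  ruleCode : Fin #rules → Fin codeLength
  ruleCode j = #names ↑ʳ j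

  Fits : List ℕ → Set
  Fits ks = sum ks ≤ payload

  arity-fits : ∀ f → Fits (arity f)
  arity-fits f = ℕₚ.m≤n⇒m≤n+o _ (∈⇒≤sum (sum ∘ arity) (∈-names f))

  registers-fit : ∀ j → Fits (registers (ruleNo j))
  registers-fit j = ℕₚ.m≤n⇒m≤o+n _ (∈⇒≤sum (sum ∘ registers) {xs = rules} (∈-lookup j))

  contents : ∀ ks → Fin payload → Maybe (Ref ks)
  contents ks i = unslot ks (toℕ i)

  module _ {ks} (fits : Fits ks) where

    place : Ref ks → Fin payload
    place r = fromℕ< (ℕₚ.<-≤-trans (slot< ks r) fits)

    contents-place : ∀ r → contents ks (place r) ≡ just r
    contents-place r = trans (cong (unslot ks) (toℕ-fromℕ< _)) (unslot-slot ks r)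

    place-contents : ∀ i {r} → contents ks i ≡ just r → place r ≡ i
    place-contents i e = toℕ-injective (trans (toℕ-fromℕ< _) (slot-unslot ks (toℕ i) e))

  bit : ∀ {A : Set} → A → A → (i h : Fin codeLength) → A
  bit x y i h = if does (i Fin.≟ h) then y else x

  bitAt : Fin codeLength → Fin dim
  bitAt i = i ↑ˡ payload

  slotAt : Fin payload → Fin dim
  slotAt i = codeLength ↑ʳ i

  private
    Formula : ℕ → Set
    Formula = FO+Q cnfVoc σ

  -- The parameters x and y of the interpretation denote distinct elements; a
  -- tuple carries code h if its bits are y at h and x elsewhere.
  module Formulas {n} (x y : Fin n) where

    Tuple : Set
    Tuple = Fin dim → Fin n

    hasCode : Fin codeLength → Tuple → Formula n
    hasCode h v = ⋀ (allFin codeLength) λ i → eq (v (bitAt i)) (bit x y i h)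

    guardFormula : ∀ {R : Set} → Guard σ R → (R → Fin n) → Formula n
    guardFormula (equal s a b)    r = signed s (eq (r a) (r b))
    guardFormula (related s S as) r = signed s (atom S (map r as))
    guardFormula (initial s a)    r = signed s (eq (r a) x)

    register : ∀ j → Tuple → Ref (registers (ruleNo j)) → Fin n
    register j c r = c (slotAt (place (registers-fit j) r))

    -- Guards concern only the given structure. They decide whether a rule instance is a clause at
    -- all, so the literals of the clauses are facts only.
    ruleApplies : ∀ j → Tuple → Formula n
    ruleApplies j c = hasCode (ruleCode j) c and
      ⋀ (guards (ruleNo j)) (λ g → guardFormula g (register j c))

    slotFormula : ∀ {R S : Set} → Maybe S → (S → Maybe R) → (R → Fin n) → Fin n → Formula n
    slotFormula nothing  pat r a = eq a x
    slotFormula (just s) pat r a with pat s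
    ... | nothing = not falsum
    ... | just t  = eq a (r t)

    -- The slots beyond the arguments of a fact are filled with x.
    factFormula : ∀ {R : Set} f → (Ref (arity f) → Maybe R) → (R → Fin n) → Tuple → Formula n
    factFormula f pat r v = hasCode (nameCode f) v and
      ⋀ (allFin payload) (λ i → slotFormula (contents (arity f) i) pat r (v (slotAt i)))

    headFormula : ∀ {R : Set} → Maybe (Σ[ f ∈ Name ] (Ref (arity f) → R)) → (R → Fin n) → Tuple → Formula n
    headFormula nothing        r v = falsum
    headFormula (just (f , h)) r v = factFormula f (just ∘ h) r v

    isClause : Tuple → Formula n
    isClause c = ⋁ (allFin #rules) λ j → ruleApplies j c

    isPositive isNegative : Tuple → Tuple → Formula n
    isPositive v c = ⋁ (allFin #rules) λ j → ruleApplies j c and headFormula (head (ruleNo j)) (register j c) v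
    isNegative v c = ⋁ (allFin #rules) λ j → ruleApplies j c and
      ⋁ (body (ruleNo j)) λ (f , pat) → factFormula f pat (register j c) v

  first second : ∀ m → Fin (m + 2)
  first  m = m ↑ʳ zero
  second m = m ↑ʳ suc zero

  module _ {A : Set} (x y : A) where

    lookup-first : ∀ {m} (xs : Vec A m) → lookup (xs ++ x ∷ y ∷ []) (first m) ≡ x
    lookup-first xs = lookup-++ʳ xs (x ∷ y ∷ []) zero

    lookup-second : ∀ {m} (xs : Vec A m) → lookup (xs ++ x ∷ y ∷ []) (second m) ≡ y
    lookup-second xs = lookup-++ʳ xs (x ∷ y ∷ []) (suc zero)

  interp : Interpretation Formula cnfVoc 2
  interp = interpretation dim (not falsum)
    (⋀ (allFin dim) λ i → eq ((i ↑ˡ dim) ↑ˡ 2) ((dim ↑ʳ i) ↑ˡ 2))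
    λ { (here refl)                         → isClause₁ (λ i → (i ↑ˡ 0) ↑ˡ 2)
      ; (there (here refl))                 → not (isClause₁ (λ i → (i ↑ˡ 0) ↑ˡ 2))
      ; (there (there (here refl)))         → isPositive₂ (λ i → (i ↑ˡ (dim + 0)) ↑ˡ 2) (λ i → (dim ↑ʳ (i ↑ˡ 0)) ↑ˡ 2)
      ; (there (there (there (here refl)))) → isNegative₂ (λ i → (i ↑ˡ (dim + 0)) ↑ˡ 2) (λ i → (dim ↑ʳ (i ↑ˡ 0)) ↑ˡ 2)
      }
    where
    open Formulas (first (1 * dim)) (second (1 * dim)) using () renaming (isClause to isClause₁)
    open Formulas (first (2 * dim)) (second (2 * dim)) using () renaming (isPositive to isPositive₂; isNegative to isNegative₂)

-- Truth conditions of the encoding formulas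

module EncodingSemantics {σ : Vocabulary} {Name : Set} {arity : Name → List ℕ} {names : List Name}
       (∈-names : ∀ f → f ∈ names) (rules : List (HornSystem.Rule σ Name arity))
       (𝔉 : FiniteStructure σ) (x₀ y₀ : FiniteStructure.Universe 𝔉) where
  open FiniteLFP 𝔉
  open HornSystem σ Name arity
  open Rule
  open Semantics 𝔄 x₀
  open Encoding ∈-names rules
  open Equivalence

  Word : Set
  Word = Fin dim → Universe

  HasCode : Fin codeLength → Word → Set
  HasCode h w = ∀ i → w (bitAt i) ≈ bit x₀ y₀ i h

  registerOf : ∀ j → Word → Ref (registers (ruleNo j)) → Universe
  registerOf j w r = w (slotAt (place (registers-fit j) r))

  Applies : Fin #rules → Word → Set
  Applies j w = HasCode (ruleCode j) w × (∀ {g} → g ∈ guards (ruleNo j) → ⟦ g ⟧ᵍ (registerOf j w))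

  SlotHolds : ∀ {R S : Set} → Maybe S → (S → Maybe R) → (R → Universe) → Universe → Set
  SlotHolds nothing  pat e a = a ≈ x₀
  SlotHolds (just s) pat e a = Matches (pat s) e a

  IsFact : ∀ {R : Set} f → (Ref (arity f) → Maybe R) → (R → Universe) → Word → Set
  IsFact f pat e w = HasCode (nameCode f) w × (∀ i → SlotHolds (contents (arity f) i) pat e (w (slotAt i)))

  IsHead : ∀ {R : Set} → Maybe (Σ[ f ∈ Name ] (Ref (arity f) → R)) → (R → Universe) → Word → Set
  IsHead nothing        e w = ⊥
  IsHead (just (f , h)) e w = IsFact f (just ∘ h) e w

  IsClause : Word → Set
  IsClause w = Σ[ j ∈ Fin #rules ] Applies j w

  IsPositive IsNegative : Word → Word → Set
  IsPositive v w = Σ[ j ∈ Fin #rules ] (Applies j w × IsHead (head (ruleNo j)) (registerOf j w) v)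
  IsNegative v w = Σ[ j ∈ Fin #rules ] (Applies j w ×
    (Σ[ (f , pat) ∈ (Σ[ f ∈ Name ] (Ref (arity f) → Maybe (Ref (registers (ruleNo j))))) ]
      ((f , pat) ∈ body (ruleNo j) × IsFact f pat (registerOf j w) v)))

  module _ {n} {ρ : Vec Universe n} {x y : Fin n} (x≡ : lookup ρ x ≡ x₀) (y≡ : lookup ρ y ≡ y₀) where
    open Formulas x y

    private
      Sat : FO+Q cnfVoc σ n → Set
      Sat φ = SatQ HornRes 𝔄 φ ρ

    Denotes : ∀ {I : Set} → (I → Fin n) → (I → Universe) → Set
    Denotes v w = ∀ i → lookup ρ (v i) ≡ w i

    eq⇔ : ∀ {a b u v} → lookup ρ a ≡ u → lookup ρ b ≡ v → Sat (eq a b) ⇔ (u ≈ v)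
    eq⇔ refl refl = mk⇔ id id

    lookup-bit : ∀ i h → lookup ρ (bit x y i h) ≡ bit x₀ y₀ i h
    lookup-bit i h with does (i Fin.≟ h)
    ... | true  = y≡
    ... | false = x≡

    hasCode⇔ : ∀ h {v w} → Denotes v w → Sat (hasCode h v) ⇔ HasCode h w
    hasCode⇔ h v≡ = ⋀Fin⇔ 𝔉 λ i → eq⇔ (v≡ (bitAt i)) (lookup-bit i h)

    guard⇔ : ∀ {R} (g : Guard σ R) {r e} → Denotes r e → Sat (guardFormula g r) ⇔ ⟦ g ⟧ᵍ e
    guard⇔ (equal s a b)    r≡ = signed⇔ 𝔉 s (eq⇔ (r≡ a) (r≡ b))
    guard⇔ (related s S as) {r} r≡ = signed⇔ 𝔉 s (subst (λ bs → Sat (atom S (map r as)) ⇔ rel S bs)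
      (trans (sym (map-∘ (lookup ρ) r as)) (map-cong r≡ as)) (mk⇔ id id))
    guard⇔ (initial s a)    r≡ = signed⇔ 𝔉 s (eq⇔ (r≡ a) x≡)

    applies⇔ : ∀ j {c w} → Denotes c w → Sat (ruleApplies j c) ⇔ Applies j w
    applies⇔ j c≡ = hasCode⇔ (ruleCode j) c≡ ×-⇔ ⋀⇔ 𝔉 (λ g → guard⇔ g (λ r → c≡ _)) (guards (ruleNo j))

    true⇔ : Sat (not falsum) ⇔ ⊤
    true⇔ = mk⇔ (λ _ → tt) (λ _ (a , a≉a) → a≉a ≈-refl)

    slot⇔ : ∀ {R S : Set} (m : Maybe S) (pat : S → Maybe R) {r e a u} → Denotes r e → lookup ρ a ≡ u →
            Sat (slotFormula m pat r a) ⇔ SlotHolds m pat e u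
    slot⇔ nothing  pat r≡ a≡ = eq⇔ a≡ x≡
    slot⇔ (just s) pat r≡ a≡ with pat s
    ... | nothing = true⇔
    ... | just t  = eq⇔ a≡ (r≡ t)

    fact⇔ : ∀ {R : Set} f (pat : Ref (arity f) → Maybe R) {r e v w} → Denotes r e → Denotes v w →
            Sat (factFormula f pat r v) ⇔ IsFact f pat e w
    fact⇔ f pat r≡ v≡ = hasCode⇔ (nameCode f) v≡ ×-⇔ ⋀Fin⇔ 𝔉 (λ i → slot⇔ (contents (arity f) i) pat r≡ (v≡ (slotAt i)))

    head⇔ : ∀ {R : Set} (m : Maybe (Σ[ f ∈ Name ] (Ref (arity f) → R))) {r e v w} → Denotes r e → Denotes v w →
            Sat (headFormula m r v) ⇔ IsHead m e w
    head⇔ nothing        r≡ v≡ = mk⇔ (λ (a , a≉a) → a≉a ≈-refl) λ ()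
    head⇔ (just (f , h)) r≡ v≡ = fact⇔ f (just ∘ h) r≡ v≡

    module _ {c : Fin dim → Fin n} {w : Word} (c≡ : Denotes c w) where

      isClause⇔ : Sat (isClause c) ⇔ IsClause w
      isClause⇔ = ⋁Fin⇔ 𝔉 (λ j → applies⇔ j c≡)

      module _ {v : Fin dim → Fin n} {u : Word} (v≡ : Denotes v u) where

        isPositive⇔ : Sat (isPositive v c) ⇔ IsPositive u w
        isPositive⇔ = ⋁Fin⇔ 𝔉 (λ j → applies⇔ j c≡ ×-⇔ head⇔ (head (ruleNo j)) (λ r → c≡ _) v≡)

        isNegative⇔ : Sat (isNegative v c) ⇔ IsNegative u w
        isNegative⇔ = ⋁Fin⇔ 𝔉 (λ j → applies⇔ j c≡ ×-⇔
          ⋁⇔ 𝔉 (λ (f , pat) → fact⇔ f pat (λ r → c≡ _) v≡) (body (ruleNo j)))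

  parameters : Vec Universe 2
  parameters = x₀ ∷ y₀ ∷ []

  𝔅 : RawStructure cnfVoc
  𝔅 = interpret HornRes 𝔄 interp parameters
  open RawStructure 𝔅 using () renaming (Universe to U; _≈_ to _≈𝔅_; rel to rel𝔅)

  word : U → Word
  word b = lookup (proj₁ b)

  private
    lookup₁ : ∀ (b : Vec Universe dim) {m} (ys : Vec Universe m) i →
              lookup ((b ++ []) ++ ys) ((i ↑ˡ 0) ↑ˡ m) ≡ lookup b i
    lookup₁ b ys i = trans (lookup-++ˡ (b ++ []) ys (i ↑ˡ 0)) (lookup-++ˡ b [] i)

    lookup₂ : ∀ {k} (a : Vec Universe dim) (b : Vec Universe k) {m} (ys : Vec Universe m) i →
              lookup ((a ++ b) ++ ys) ((i ↑ˡ k) ↑ˡ m) ≡ lookup a i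
    lookup₂ a b ys i = trans (lookup-++ˡ (a ++ b) ys (i ↑ˡ _)) (lookup-++ˡ a b i)

    lookup₃ : ∀ {k} (a : Vec Universe dim) (b : Vec Universe k) {m} (ys : Vec Universe m) i →
              lookup ((a ++ b) ++ ys) ((dim ↑ʳ i) ↑ˡ m) ≡ lookup b i
    lookup₃ a b ys i = trans (lookup-++ˡ (a ++ b) ys (dim ↑ʳ i)) (lookup-++ʳ a b i)

  ≈𝔅⇔ : ∀ a b → (a ≈𝔅 b) ⇔ (∀ i → word a i ≈ word b i)
  ≈𝔅⇔ (a , _) (b , _) = ⋀Fin⇔ 𝔉 λ i → subst₂ (λ u v → SatQ HornRes 𝔄 (eq ((i ↑ˡ dim) ↑ˡ 2) ((dim ↑ʳ i) ↑ˡ 2)) ((a ++ b) ++ parameters) ⇔ (u ≈ v))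
    (lookup₂ a b parameters i) (lookup₃ a b parameters i) (mk⇔ id id)

  C𝔅 : U → Set
  C𝔅 c = rel𝔅 (here refl) (c ∷ [])

  P𝔅 N𝔅 : U → U → Set
  P𝔅 v c = rel𝔅 (there (there (here refl))) (v ∷ c ∷ [])
  N𝔅 v c = rel𝔅 (there (there (there (here refl)))) (v ∷ c ∷ [])

  C𝔅⇔ : ∀ c → C𝔅 c ⇔ IsClause (word c)
  C𝔅⇔ (c , _) = isClause⇔ (lookup-first x₀ y₀ (c ++ [])) (lookup-second x₀ y₀ (c ++ [])) (lookup₁ c parameters)

  P𝔅⇔ : ∀ v c → P𝔅 v c ⇔ IsPositive (word v) (word c)
  P𝔅⇔ (v , _) (c , _) = isPositive⇔ (lookup-first x₀ y₀ (v ++ (c ++ []))) (lookup-second x₀ y₀ (v ++ (c ++ [])))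
    (λ i → trans (lookup₃ v (c ++ []) parameters (i ↑ˡ 0)) (lookup-++ˡ c [] i)) (lookup₂ v (c ++ []) parameters)

  N𝔅⇔ : ∀ v c → N𝔅 v c ⇔ IsNegative (word v) (word c)
  N𝔅⇔ (v , _) (c , _) = isNegative⇔ (lookup-first x₀ y₀ (v ++ (c ++ []))) (lookup-second x₀ y₀ (v ++ (c ++ [])))
    (λ i → trans (lookup₃ v (c ++ []) parameters (i ↑ˡ 0)) (lookup-++ˡ c [] i)) (lookup₂ v (c ++ []) parameters)

-- Unit propagation on the encoding simulates the program

module EncodingCorrect {σ : Vocabulary} {Name : Set} {arity : Name → List ℕ} {names : List Name}
       (∈-names : ∀ f → f ∈ names) (rules : List (HornSystem.Rule σ Name arity))
       (𝔉 : FiniteStructure σ) (x₀ y₀ : FiniteStructure.Universe 𝔉) (y₀≉x₀ : ¬ FiniteStructure._≈_ 𝔉 y₀ x₀) where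
  open FiniteLFP 𝔉
  open HornSystem σ Name arity
  open Rule
  open Semantics 𝔄 x₀ renaming (Derivable to Derives)
  open Encoding ∈-names rules
  open EncodingSemantics ∈-names rules 𝔉 x₀ y₀
  open Equivalence

  bit-same : ∀ h → bit x₀ y₀ h h ≡ y₀
  bit-same h rewrite dec-true (h Fin.≟ h) refl = refl

  bit-other : ∀ {i h} → ¬ i ≡ h → bit x₀ y₀ i h ≡ x₀
  bit-other {i} {h} i≢h rewrite dec-false (i Fin.≟ h) i≢h = refl

  code-unique : ∀ {h h′} w → HasCode h w → HasCode h′ w → h ≡ h′
  code-unique {h} {h′} w c c′ with h Fin.≟ h′
  ... | yes h≡h′ = h≡h′
  ... | no h≢h′ = contradiction
    (≈-trans (≈-sym (subst (w (bitAt h) ≈_) (bit-same h) (c h))) (subst (w (bitAt h) ≈_) (bit-other h≢h′) (c′ h))) y₀≉x₀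

  fact-not-rule : ∀ f j w → HasCode (nameCode f) w → ¬ HasCode (ruleCode j) w
  fact-not-rule f j w c c′ with trans (sym (splitAt-↑ˡ #names (Any.index (∈-names f)) #rules))
                                 (trans (cong (splitAt #names) (code-unique w c c′)) (splitAt-↑ʳ #names #rules j))
  ... | ()

  nameCode-injective : ∀ {f g} → nameCode f ≡ nameCode g → f ≡ g
  nameCode-injective {f} {g} e = trans (lookup-index (∈-names f))
    (trans (cong (Data.List.lookup names) (↑ˡ-injective #rules _ _ e)) (sym (lookup-index (∈-names g))))

  applies-unique : ∀ {i j} w → Applies i w → Applies j w → i ≡ j
  applies-unique w (c , _) (c′ , _) = ↑ʳ-injective #names _ _ (code-unique w c c′)

  Matches-resp : ∀ {R : Set} (m : Maybe R) {e e′ a b} → (∀ r → e r ≈ e′ r) → a ≈ b → Matches m e a → Matches m e′ b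
  Matches-resp nothing  e≈ a≈b _ = tt
  Matches-resp (just r) e≈ a≈b p = ≈-trans (≈-sym a≈b) (≈-trans p (e≈ r))

  guard-ext : ∀ {R} (g : Guard σ R) {e e′ : R → Universe} → (∀ r → e r ≡ e′ r) → ⟦ g ⟧ᵍ e → ⟦ g ⟧ᵍ e′
  guard-ext (equal s a b)    e≡ = subst₂ (λ u v → Signed s (u ≈ v)) (e≡ a) (e≡ b)
  guard-ext (related s S as) e≡ = subst (Signed s ∘ rel S) (map-cong e≡ as)
  guard-ext (initial s a)    e≡ = subst (λ u → Signed s (u ≈ x₀)) (e≡ a)

  arguments : ∀ f → Word → Ref (arity f) → Universe
  arguments f w r = w (slotAt (place (arity-fits f) r))

  module _ {R : Set} {f} {pat : Ref (arity f) → Maybe R} {e : R → Universe} (w : Word) where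

    fact-matches : IsFact f pat e w → ∀ r → Matches (pat r) e (arguments f w r)
    fact-matches (_ , s) r with s (place (arity-fits f) r)
    ... | m rewrite contents-place (arity-fits f) r = m

    fact-arguments : IsFact f pat e w → IsFact f just (arguments f w) w
    fact-arguments (c , s) = c , slots
      where
      slots : ∀ i → SlotHolds (contents (arity f) i) just (arguments f w) (w (slotAt i))
      slots i with contents (arity f) i in e≡ | s i
      ... | nothing | p = p
      ... | just r  | _ rewrite place-contents (arity-fits f) i e≡ = ≈-refl

    fact-instance : ∀ {a} → IsFact f just a w → (∀ r → Matches (pat r) e (a r)) → IsFact f pat e w
    fact-instance {a} (c , s) m = c , slots
      where
      slots : ∀ i → SlotHolds (contents (arity f) i) pat e (w (slotAt i))
      slots i with contents (arity f) i | s i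
      ... | nothing | p = p
      ... | just r  | p = Matches-resp (pat r) (λ _ → ≈-refl) (≈-sym p) (m r)

  -- This gives the Horn condition: code, arguments and fixed filling of the remaining slots
  -- determine every component, so a rule instance has at most one positive literal up to `_≈_`.
  fact-agree : ∀ {R : Set} {f} {h : Ref (arity f) → R} {e w w′} →
               IsFact f (just ∘ h) e w → IsFact f (just ∘ h) e w′ → ∀ i → w i ≈ w′ i
  fact-agree {f = f} {h} {e} {w} {w′} (c , s) (c′ , s′) i with splitAt codeLength i in split≡
  ... | inj₁ k rewrite sym (splitAt⁻¹-↑ˡ {m = codeLength} {i = i} split≡) = ≈-trans (c k) (≈-sym (c′ k))
  ... | inj₂ k rewrite sym (splitAt⁻¹-↑ʳ {m = codeLength} {i = i} split≡) with contents (arity f) k | s k | s′ k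
  ...   | nothing | p | p′ = ≈-trans p (≈-sym p′)
  ...   | just r  | p | p′ = ≈-trans p (≈-sym p′)

  head-agree : ∀ {R : Set} (m : Maybe (Σ[ f ∈ Name ] (Ref (arity f) → R))) {e w w′} →
               IsHead m e w → IsHead m e w′ → ∀ i → w i ≈ w′ i
  head-agree (just (f , h)) = fact-agree

  head-not-clause : ∀ {R : Set} (m : Maybe (Σ[ f ∈ Name ] (Ref (arity f) → R))) {e} w → IsHead m e w → ¬ IsClause w
  head-not-clause (just (f , h)) w (c , _) (j , c′ , _) = fact-not-rule f j w c c′

  Contradictory : Set
  Contradictory = Σ[ r ∈ Rule ] (r ∈ rules × head r ≡ nothing × Σ[ ρ ∈ _ ] Premises r (Derives rules) ρ)

  -- Stated for any structure with these descriptions, so that the argument concerns rules and facts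
  -- alone, without formulas or variable bookkeeping.
  module Abstract (ψ : Structure cnfVoc) (word : Structure.Universe ψ → Word)
                  (element : Word → Structure.Universe ψ) (word-element : ∀ w i → word (element w) i ≡ w i)
                  (C? : ∀ c → Dec (CNF.C ψ c)) (V⇔ : ∀ v → CNF.V ψ v ⇔ (¬ CNF.C ψ v))
                  (≈⇔ : ∀ u v → Structure._≈_ ψ u v ⇔ (∀ i → word u i ≈ word v i))
                  (C⇔ : ∀ c → CNF.C ψ c ⇔ IsClause (word c))
                  (P⇔ : ∀ v c → CNF.P ψ v c ⇔ IsPositive (word v) (word c))
                  (N⇔ : ∀ v c → CNF.N ψ v c ⇔ IsNegative (word v) (word c)) where
    open Structure ψ using () renaming (Universe to U)
    open CNF ψ
    open UnitPropagation ψ using (Forced; force; Refuted)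

    encode : ∀ {ks} → Fin codeLength → (Ref ks → Universe) → U
    encode {ks} h a = element ([ (λ i → bit x₀ y₀ i h) , (λ i → maybe a x₀ (contents ks i)) ] ∘ splitAt codeLength)

    module _ {ks} (h : Fin codeLength) (a : Ref ks → Universe) where

      encode-bit : ∀ i → word (encode h a) (bitAt i) ≡ bit x₀ y₀ i h
      encode-bit i = trans (word-element _ (bitAt i)) (cong [ _ , _ ] (splitAt-↑ˡ codeLength i payload))

      encode-slot : ∀ i → word (encode h a) (slotAt i) ≡ maybe a x₀ (contents ks i)
      encode-slot i = trans (word-element _ (slotAt i)) (cong [ _ , _ ] (splitAt-↑ʳ codeLength payload i))

      encode-code : HasCode h (word (encode h a))
      encode-code i rewrite encode-bit i = ≈-refl

    encodeFact : ∀ f → (Ref (arity f) → Universe) → U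
    encodeFact f = encode (nameCode f)

    encodeFact-isFact : ∀ f a → IsFact f just a (word (encodeFact f a))
    encodeFact-isFact f a = encode-code (nameCode f) a , slots
      where
      slots : ∀ i → SlotHolds (contents (arity f) i) just a (word (encodeFact f a) (slotAt i))
      slots i rewrite encode-slot (nameCode f) a i with contents (arity f) i
      ... | nothing = ≈-refl
      ... | just r  = ≈-refl

    encodeRule : ∀ j → (Ref (registers (ruleNo j)) → Universe) → U
    encodeRule j = encode (ruleCode j)

    encodeRule-register : ∀ j e r → registerOf j (word (encodeRule j e)) r ≡ e r
    encodeRule-register j e r = trans (encode-slot (ruleCode j) e (place (registers-fit j) r))
      (cong (maybe e x₀) (contents-place (registers-fit j) r))

    encodeRule-applies : ∀ j e → (∀ {g} → g ∈ guards (ruleNo j) → ⟦ g ⟧ᵍ e) → Applies j (word (encodeRule j e))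
    encodeRule-applies j e gs =
      encode-code (ruleCode j) e , λ {g} g∈ → guard-ext g (sym ∘ encodeRule-register j e) (gs g∈)

    encodesCNF : EncodesCNF
    encodesCNF = record
      { clause-or-variable = λ c → Sum.map₂ (from (V⇔ c)) (toSum (C? c))
      ; disjoint = λ c (Cc , Vc) → to (V⇔ c) Vc Cc
      ; P-typed = λ {v} {c} p → let j , a , h = to (P⇔ v c) p in
          from (V⇔ v) (head-not-clause (head (ruleNo j)) (word v) h ∘ to (C⇔ v)) , from (C⇔ c) (j , a)
      ; N-typed = λ {v} {c} p → let j , a , (f , _) , _ , (code , _) = to (N⇔ v c) p in
          from (V⇔ v) (λ Cv → let i , code′ , _ = to (C⇔ v) Cv in fact-not-rule f i (word v) code code′) , from (C⇔ c) (j , a)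
      }

    horn : ∀ c → C c → IsHorn (literals c)
    horn c _ {u} {v} p q with to (P⇔ u c) p | to (P⇔ v c) q
    ... | j , a , h | j′ , a′ , h′ with applies-unique (word c) a a′
    ...   | refl = from (≈⇔ u v) (head-agree (head (ruleNo j)) h h′)

    -- Propagation through a clause is one application of its rule. Every instance of a body pattern
    -- is encoded by an element that occurs negatively in the clause, so a universally quantified
    -- position contributes all its instances to a single clause.
    forced⇒derivable : ∀ {v} → Forced v → ∀ {f a} → IsFact f just a (word v) → Derives rules f a
    forced⇒derivable {v} (force {c} _ p negatives) fact with to (P⇔ v c) p
    ... | j , (code , gs) , h with head (ruleNo j) in head≡
    ...   | just (f , k) with nameCode-injective (code-unique (word v) (proj₁ h) (proj₁ fact))
    ...     | refl = derive (∈-lookup j) head≡ (registerOf j (word c)) gs premises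
                       (λ r → ≈-trans (≈-sym (fact-matches (word v) fact r)) (fact-matches (word v) h r))
      where
      premises : ∀ {q pat} → (q , pat) ∈ body (ruleNo j) → ∀ b → (∀ i → Matches (pat i) (registerOf j (word c)) (b i)) →
                 Derives rules q b
      premises {q} {pat} q∈ b m = forced⇒derivable
        (negatives (encodeFact q b) (from (N⇔ (encodeFact q b) c)
          (j , (code , gs) , (q , pat) , q∈ , fact-instance {pat = pat} (word (encodeFact q b)) (encodeFact-isFact q b) m)))
        (encodeFact-isFact q b)

    module _ (j : Fin #rules) (ρ : Ref (registers (ruleNo j)) → Universe) where

      -- An element carries only one rule code, so all negative literals of this clause come from
      -- the body of rule `j`, with registers `ρ`.
      negative-instance : ∀ u → N u (encodeRule j ρ) →
        Σ[ (q , pat) ∈ (Σ[ f ∈ Name ] (Ref (arity f) → Maybe (Ref (registers (ruleNo j))))) ]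
          ((q , pat) ∈ body (ruleNo j) × (∀ r → Matches (pat r) ρ (arguments q (word u) r)) × IsFact q just (arguments q (word u)) (word u))
      negative-instance u n with to (N⇔ u (encodeRule j ρ)) n
      ... | j′ , (code , _) , (q , pat) , q∈ , fact
        with ↑ʳ-injective #names _ _ (code-unique (word (encodeRule j ρ)) (encode-code (ruleCode j) ρ) code)
      ...   | refl = (q , pat) , q∈
          , (λ r → Matches-resp (pat r) (λ s → IsEquivalence.reflexive isEquivalence (encodeRule-register j ρ s)) ≈-refl (fact-matches {pat = pat} (word u) fact r))
          , fact-arguments {pat = pat} (word u) fact

    derivable⇒forced : ∀ {f a} → Derives rules f a → ∀ {v} → IsFact f just a (word v) → Forced v
    derivable⇒forced (derive r∈ head≡ ρ gs ps a≈) {v} fact with Any.index r∈ | lookup-index r∈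
    derivable⇒forced (derive r∈ {f} {h} head≡ ρ gs ps {a} a≈) {v} fact | j | refl =
      force {c = encodeRule j ρ} (from (C⇔ (encodeRule j ρ)) (j , applies))
        (from (P⇔ v (encodeRule j ρ)) (j , applies , positive))
        (λ u n → let _ , q∈ , m , factᵤ = negative-instance j ρ u n in derivable⇒forced (ps q∈ _ m) factᵤ)
      where
      applies = encodeRule-applies j ρ gs
      positive : IsHead (head (ruleNo j)) (registerOf j (word (encodeRule j ρ))) (word v)
      positive rewrite head≡ = fact-instance {pat = just ∘ h} (word v) {a = a} fact
        (λ r → subst (a r ≈_) (sym (encodeRule-register j ρ (h r))) (a≈ r))

    refuted⇔contradictory : Refuted ⇔ Contradictory
    refuted⇔contradictory = mk⇔ ⇒ ⇐
      where
      ⇒ : Refuted → Contradictory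
      ⇒ (c , (Cc , ¬p) , negatives) with to (C⇔ c) Cc
      ... | j , code , gs = ruleNo j , ∈-lookup j , headless , registerOf j (word c) , gs
          , λ {q} {pat} q∈ b m → forced⇒derivable
              (negatives (encodeFact q b) (from (N⇔ (encodeFact q b) c)
                (j , (code , gs) , (q , pat) , q∈ , fact-instance {pat = pat} (word (encodeFact q b)) (encodeFact-isFact q b) m)))
              (encodeFact-isFact q b)
        where
        headless : head (ruleNo j) ≡ nothing
        headless with head (ruleNo j) in head≡
        ... | nothing = refl
        -- A rule with a head would give the clause a positive literal, the encoding of its head
        -- instance.
        ... | just (f , h) = contradiction (v , from (P⇔ v c) (j , (code , gs) , positive)) ¬p
          where
          v = encodeFact f (registerOf j (word c) ∘ h)
          positive : IsHead (head (ruleNo j)) (registerOf j (word c)) (word v)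
          positive rewrite head≡ = fact-instance {pat = just ∘ h} (word v) (encodeFact-isFact f (registerOf j (word c) ∘ h)) (λ r → ≈-refl)
      ⇐ : Contradictory → Refuted
      ⇐ (r , r∈ , head≡ , ρ , gs , ps) with Any.index r∈ | lookup-index r∈
      ... | j | refl = encodeRule j ρ
          , (from (C⇔ (encodeRule j ρ)) (j , encodeRule-applies j ρ gs) , no-positive)
          , λ u n → let _ , q∈ , m , factᵤ = negative-instance j ρ u n in derivable⇒forced (ps q∈ _ m) factᵤ
        where
        no-positive : ¬ (∃[ v ] P v (encodeRule j ρ))
        no-positive (v , p) with to (P⇔ v (encodeRule j ρ)) p
        ... | j′ , (code , _) , h with ↑ʳ-injective #names _ _ (code-unique (word (encodeRule j ρ)) (encode-code (ruleCode j) ρ) code)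
        ...   | refl rewrite head≡ = h

module QuantifierCorrect {σ : Vocabulary} {Name : Set} {arity : Name → List ℕ} {names : List Name}
       (∈-names : ∀ f → f ∈ names) (rules : List (HornSystem.Rule σ Name arity))
       (𝔉 : FiniteStructure σ) (x₀ y₀ : FiniteStructure.Universe 𝔉) (y₀≉x₀ : ¬ FiniteStructure._≈_ 𝔉 y₀ x₀) where
  open FiniteLFP 𝔉
  open Encoding ∈-names rules
  open EncodingSemantics ∈-names rules 𝔉 x₀ y₀
  open EncodingCorrect ∈-names rules 𝔉 x₀ y₀ y₀≉x₀
  open Interpretation interp using (φδ; φ≈; φS)
  open RawStructure 𝔅 using () renaming (Universe to U; _≈_ to _≈𝔅_)
  open Equivalence

  congruence : IsCongruent 𝔅
  congruence = record
    { isEquivalence = record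
      { refl  = λ {a} → from (≈𝔅⇔ a a) (λ i → ≈-refl)
      ; sym   = λ {a} {b} p → from (≈𝔅⇔ b a) (λ i → ≈-sym (to (≈𝔅⇔ a b) p i))
      ; trans = λ {a} {b} {c} p q → from (≈𝔅⇔ a c) (λ i → ≈-trans (to (≈𝔅⇔ a b) p i) (to (≈𝔅⇔ b c) q i))
      }
    ; rel-resp = λ s {as} {bs} as≈bs → realizes-resp 𝔉 (translate (φS s)) (SatQ HornRes 𝔄 (φS s)) (translate⇔ 𝔉 (φS s))
        (PW.++⁺ (concat-≋ as≈bs) ≋-refl)
    }
    where
    lookup-≋ : ∀ {n} {u v : Vec Universe n} → (∀ i → lookup u i ≈ lookup v i) → Pointwise _≈_ u v
    lookup-≋ {u = []} {[]} p = []
    lookup-≋ {u = _ ∷ _} {_ ∷ _} p = p zero ∷ lookup-≋ (p ∘ suc)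
    concat-≋ : ∀ {k} {as bs : Vec U k} → Pointwise _≈𝔅_ as bs →
               Pointwise _≈_ (concat (map proj₁ as)) (concat (map proj₁ bs))
    concat-≋ [] = []
    concat-≋ {as = a ∷ _} {b ∷ _} (p ∷ ps) = PW.++⁺ (lookup-≋ (to (≈𝔅⇔ a b) p)) (concat-≋ ps)

  module _ (c : IsCongruent 𝔅) where

    private
      ψ : Structure cnfVoc
      ψ = record { raw = 𝔅 ; isCongruent = c }

      element : Word → U
      element w = tabulate w , λ (b , b≉b) → b≉b ≈-refl

      C? : ∀ b → Dec (CNF.C ψ b)
      C? b = satQ? 𝔉 (φS (here refl)) (concat (map proj₁ (b ∷ [])) ++ parameters)

      V⇔ : ∀ b → CNF.V ψ b ⇔ (¬ CNF.C ψ b)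
      V⇔ b = mk⇔ id id

      module Instance = Abstract ψ word element lookup∘tabulate C? V⇔ ≈𝔅⇔ C𝔅⇔ P𝔅⇔ N𝔅⇔

    hornRes⇔contradictory : HornRes ψ ⇔ Contradictory
    hornRes⇔contradictory = mk⇔
      (λ H → to Instance.refuted⇔contradictory (to (refutable⇔refuted (HornRes.horn H)) (HornRes.refutable H)))
      (λ d → record { encodesCNF = Instance.encodesCNF ; horn = Instance.horn
                    ; refutable = from (refutable⇔refuted Instance.horn) (from Instance.refuted⇔contradictory d) })
      where
      refutable⇔refuted = interpret-propagation⇔ 𝔉 interp parameters c

  quantifier⇔ : SatQ HornRes 𝔄 (Q interp) parameters ⇔ Contradictory
  quantifier⇔ = mk⇔ (λ (c , H) → to (hornRes⇔contradictory c) H)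
                    (λ d → congruence , from (hornRes⇔contradictory congruence) d)

-- From contradiction of the program to truth of the sentence

module _ {σ : Vocabulary} (root : LFPSentence σ) where
  open Compilation root
  open HornSystem σ Name arity

  -- Makes `goal` the only source of a contradiction, which then amounts to deriving the truth of
  -- the root.
  headed : ∀ {Δ Θ n} (φ : LFP σ Δ Θ n) (p : Sub φ) → Allₗ (Is-just ∘ Rule.head) (rulesAt φ p)
  headed (eq x y)    p = MaybeAny.just tt ∷ MaybeAny.just tt ∷ []
  headed (atom s xs) p = MaybeAny.just tt ∷ MaybeAny.just tt ∷ []
  headed (var X xs)  p = MaybeAny.just tt ∷ MaybeAny.just tt ∷ []
  headed (not φ)     p = MaybeAny.just tt ∷ MaybeAny.just tt ∷ []
  headed (φ and ψ)   p = MaybeAny.just tt ∷ MaybeAny.just tt ∷ MaybeAny.just tt ∷ []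
  headed (ex φ)      p = MaybeAny.just tt ∷ MaybeAny.just tt ∷ []
  headed (lfp φ xs)  p = MaybeAny.just tt ∷ MaybeAny.just tt ∷ MaybeAny.just tt ∷ MaybeAny.just tt ∷
                         MaybeAny.just tt ∷ MaybeAny.just tt ∷ MaybeAny.just tt ∷ []

  ¬headed : ∀ {A : Set} {m : Maybe A} → m ≡ nothing → ¬ Is-just m
  ¬headed refl ()

  module _ (𝔉 : FiniteStructure σ) (x₀ y₀ : FiniteStructure.Universe 𝔉) (y₀≉x₀ : ¬ FiniteStructure._≈_ 𝔉 y₀ x₀) where
    open FiniteLFP 𝔉
    open Semantics 𝔄 x₀
    open EncodingCorrect ∈-names program 𝔉 x₀ y₀ y₀≉x₀ using (Contradictory)
    open Completeness root 𝔉 x₀ y₀ y₀≉x₀ using (derivable⇔)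

    contradictory⇔ : Contradictory ⇔ 𝔄 ⊨LFP root
    contradictory⇔ = mk⇔ ⇒ ⇐
      where
      open Equivalence
      ⇒ : Contradictory → 𝔄 ⊨LFP root
      ⇒ (_ , here refl , _ , _ , _ , ps) = to derivable⇔ (ps (here refl) (λ ()) (λ ()))
      ⇒ (_ , there r∈ , head≡ , _) with ∈-rules⁻ r∈
      ... | at p , r∈p = contradiction (lookupAll (headed _ p) r∈p) (¬headed head≡)
      ⇐ : 𝔄 ⊨LFP root → Contradictory
      ⇐ t = goal , here refl , refl , (λ ()) , (λ ())
          , λ { (here refl) a _ → Derivable-resp program (λ ()) (from derivable⇔ t) }

module _ {σ : Vocabulary} {n : ℕ} where

  infixr 1 _or_
  _or_ : FO+Q cnfVoc σ n → FO+Q cnfVoc σ n → FO+Q cnfVoc σ n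
  φ or ψ = not (not φ and not ψ)

  or⇔ : ∀ (𝔉 : FiniteStructure σ) φ ψ ρ → let open FiniteLFP 𝔉 in
        SatQ HornRes 𝔄 (φ or ψ) ρ ⇔ (SatQ HornRes 𝔄 φ ρ ⊎ SatQ HornRes 𝔄 ψ ρ)
  or⇔ 𝔉 φ ψ ρ = mk⇔ (stable-⊎ (satQ? 𝔉 φ ρ) (satQ? 𝔉 ψ ρ))
    λ { (inj₁ p) (¬p , _) → ¬p p ; (inj₂ q) (_ , ¬q) → ¬q q }

module _ {σ : Vocabulary} where

  twoElements : FO+HornRes-Sentence σ
  twoElements = ex (ex (not (eq (suc zero) zero)))

  -- The choice of parameters is immaterial: for every pair of distinct elements the quantifier
  -- expresses the truth of `φ`.
  hornSentence : LFPSentence σ → FO+HornRes-Sentence σ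
  hornSentence φ = ex (ex (not (eq (suc zero) zero) and Q (Encoding.interp ∈-names program)))
    where open Compilation φ

  encodeSentence : LFPSentence σ → FO+HornRes-Sentence σ
  encodeSentence φ = hornSentence φ or (not twoElements and flatten φ [])

  encodeSentence⇔ : ∀ φ (𝔉 : FiniteStructure σ) → FiniteStructure.structure 𝔉 ⊨LFP φ ⇔
                    FiniteStructure.structure 𝔉 ⊨FO+HornRes encodeSentence φ
  encodeSentence⇔ φ 𝔉 = mk⇔ ⇒ ⇐
    where
    open FiniteLFP 𝔉
    open Equivalence
    two? : Dec (𝔄 ⊨FO+HornRes twoElements)
    two? = satQ? 𝔉 twoElements []
    horn⇔ : ∀ x₀ y₀ → (y₀≉x₀ : ¬ y₀ ≈ x₀) →
            SatQ HornRes 𝔄 (Q (Encoding.interp (Compilation.∈-names φ) (Compilation.program φ))) (x₀ ∷ y₀ ∷ []) ⇔ 𝔄 ⊨LFP φ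
    horn⇔ x₀ y₀ y₀≉x₀ = mk⇔ (to (contradictory⇔ φ 𝔉 x₀ y₀ y₀≉x₀) ∘ to q⇔) (from q⇔ ∘ from (contradictory⇔ φ 𝔉 x₀ y₀ y₀≉x₀))
      where q⇔ = QuantifierCorrect.quantifier⇔ (Compilation.∈-names φ) (Compilation.program φ) 𝔉 x₀ y₀ y₀≉x₀
    small⇔ : ¬ (𝔄 ⊨FO+HornRes twoElements) → 𝔄 ⊨FO+HornRes flatten φ [] ⇔ 𝔄 ⊨LFP φ
    small⇔ ¬two = flatten⇔ 𝔉 (λ a b → decidable-stable (a ≈? b) (λ a≉b → ¬two (a , b , a≉b))) φ (λ ()) (λ ()) [] []
    large⇒ : 𝔄 ⊨FO+HornRes hornSentence φ → 𝔄 ⊨LFP φ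
    large⇒ (y₀ , x₀ , y₀≉x₀ , q) = to (horn⇔ x₀ y₀ y₀≉x₀) q
    large⇐ : 𝔄 ⊨FO+HornRes twoElements → 𝔄 ⊨LFP φ → 𝔄 ⊨FO+HornRes hornSentence φ
    large⇐ (y₀ , x₀ , y₀≉x₀) t = y₀ , x₀ , y₀≉x₀ , from (horn⇔ x₀ y₀ y₀≉x₀) t
    or⇔′ = or⇔ 𝔉 (hornSentence φ) (not twoElements and flatten φ []) []
    ⇒ : 𝔄 ⊨LFP φ → 𝔄 ⊨FO+HornRes encodeSentence φ
    ⇒ t = from or⇔′ ([ (λ two → inj₁ (large⇐ two t)) , (λ ¬two → inj₂ (¬two , from (small⇔ ¬two) t)) ]′ (toSum two?))
    ⇐ : 𝔄 ⊨FO+HornRes encodeSentence φ → 𝔄 ⊨LFP φ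
    ⇐ s = [ large⇒ , (λ (¬two , f) → to (small⇔ ¬two) f) ]′ (to or⇔′ s)

translateSentence⇔ : ∀ {σ} (φ : FO+HornRes-Sentence σ) (𝔉 : FiniteStructure σ) →
                     FiniteStructure.structure 𝔉 ⊨FO+HornRes φ ⇔ FiniteStructure.structure 𝔉 ⊨LFP translate φ []
translateSentence⇔ φ 𝔉 = mk⇔ (Equivalence.from φ⇔) (Equivalence.to φ⇔)
  where φ⇔ = translate⇔ 𝔉 φ [] [] [] []

theorem3p3 : ∀ {ℓ : Level} (σ : Vocabulary) (𝒞 : Pred (FiniteStructure σ) ℓ) →
    LFP-Definable 𝒞 ⇔ FO+HornRes-Definable 𝒞
theorem3p3 σ 𝒞 = mk⇔
  (λ (φ , 𝒞⇔φ) → encodeSentence φ , λ 𝔉 → encodeSentence⇔ φ 𝔉 ⇔-∘ 𝒞⇔φ 𝔉)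
  (λ (φ , 𝒞⇔φ) → translate φ [] , λ 𝔉 → translateSentence⇔ φ 𝔉 ⇔-∘ 𝒞⇔φ 𝔉)
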